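{- There is an absolute constant $C>0$ such that for all integers $n\ge1$, $k\ge2$ and every pathset $\mathcal{A}\in\mathcal{P}_{P_k}$, $$\chi_{P_k}(\mathcal{A})\ \ge\ \frac{n^{(1/6)\log k}}{2^{C\cdot 2^k}}\cdot\delta(\mathcal{A}).$$
   Context: Logarithms are base 2. $P_k$ is the directed path with vertex set $V_k=\{v_0,\dots,v_k\}$ and edge set $E_k=\{v_iv_{i+1}:0\le i<k\}$. A pattern graph is a graph $G=(V_G,E_G)$ with $E_G\subseteq E_k$ and $V_G$ equal to the set of endpoints of edges in $E_G$ (the empty graph is allowed); $c(G)$ denotes its number of connected components. For a finite set $V$, $[n]^V$ is the set of maps $V\to[n]$ (with $[n]^\emptyset=\{()\}$); for $x\in[n]^V$ and $S\subseteq V$, $x_S$ is the restriction of $x$ to $S$; for disjoint $V,W$ and $x\in[n]^V,y\in[n]^W$, $xy\in[n]^{V\cup W}$ is their common extension. For $\mathcal{A}\subseteq[n]^V$: $\delta(\mathcal{A})=|\mathcal{A}|/n^{|V|}$; for $S\subseteq V$ and $z\in[n]^{V\setminus S}$ let $\mathcal{A}|^z_S=\{y\in[n]^S: yz\in\mathcal{A}\}$ and $\mu_S(\mathcal{A})=\max_{z}|\mathcal{A}|^z_S|/n^{|S|}$. For $\mathcal{A}\subseteq[n]^V,\mathcal{B}\subseteq[n]^W$, the join is $\mathcal{A}\bowtie\mathcal{B}=\{x\in[n]^{V\cup W}:x_V\in\mathcal{A},x_W\in\mathcal{B}\}$. A $G$-pathset is a subset of $[n]^{V_G}$; $\mathcal{P}_G$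 is the set of $G$-pathsets. Let $\varepsilon=1/\log k$ and $\tilde n=n^{1-\varepsilon}$. $\mathcal{A}\in\mathcal{P}_G$ is $G$-small if for every $1\le t\le c(G)$ and every $S\subseteq V_G$ that is the union of the vertex sets of $t$ components of $G$, $\mu_S(\mathcal{A})\le\tilde n^{ -t}$; $\mathcal{P}^{\mathrm{small}}_G$ is the set of $G$-small pathsets. Pathset complexity $\chi_G(\mathcal{A})$ is defined by induction on $|E_G|$: if $G$ is empty, $\chi_G(\mathcal{A})=0$; if $|E_G|=1$, $\chi_G(\mathcal{A})=|\mathcal{A}|$; if $|E_G|\ge2$, $\chi_G(\mathcal{A})=\min\sum_i\big(\chi_{H_i}(\mathcal{B}_i)+\chi_{K_i}(\mathcal{C}_i)\big)$ over finite sequences $(H_i,K_i,\mathcal{B}_i,\mathcal{C}_i)_i$ where $H_i,K_i$ are pattern graphs that are proper subgraphs of $G$ with $H_i\cup K_i=G$, $\mathcal{B}_i\in\mathcal{P}^{\mathrm{small}}_{H_i}$, $\mathcal{C}_i\in\mathcal{P}^{\mathrm{small}}_{K_i}$, and $\mathcal{A}\subseteq\bigcup_i\mathcal{B}_i\bowtie\mathcal{C}_i$. -}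

module Defs where

open import Data.Nat using (ℕ; zero; suc; _+_; _*_; _^_; _≤_; _<_)
open import Data.Bool using (Bool; true; false; _∧_; _∨_; if_then_else_)
open import Data.Fin using (Fin; zero; suc; inject₁)
open import Data.Fin.Subset using (Subset; _∈_; _⊆_; _⊂_; _∪_; _∩_; ∁; ∣_∣; Nonempty)
open import Data.Vec using (Vec; []; _∷_; lookup; tabulate; zipWith; map)
open import Data.Maybe using (Maybe; just; nothing; is-just)
open import Data.List using (List; length; filter)
open import Data.Nat.ListAction using (sum)
import Data.List as L
open import Data.List.Relation.Unary.All using (All)
open import Data.List.Relation.Unary.Any using (Any)
open import Data.List.Relation.Unary.Unique.Propositional using (Unique)
open import Data.List.Membership.Propositional using () renaming (_∈_ to _∈ₗ_)
open import Data.Product using (_×_)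
open import Relation.Binary.PropositionalEquality using (_≡_)
open import Relation.Nullary using (Dec)
import Data.Vec.Properties as VP
import Data.Maybe.Properties as MP
import Data.Fin as F

-- The path P_k: vertices v_0..v_k are Fin (suc k); edge i = v_i v_{i+1}
-- (i : Fin k) joins vertex (inject₁ i) and vertex (suc i).
-- A pattern graph G is its edge set, a Subset k; V_G = endpoints.

leftE : ∀ {k} → Subset k → Fin (suc k) → Bool
leftE G zero    = false
leftE G (suc i) = lookup G i

rightE : ∀ {k} → Subset k → Fin (suc k) → Bool
rightE []      _       = false
rightE (b ∷ G) zero    = b
rightE (b ∷ G) (suc j) = rightE G j

verts : ∀ {k} → Subset k → Subset (suc k)
verts G = tabulate (λ j → leftE G j ∨ rightE G j)

-- number of connected components c(G) of a pattern graph: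
-- components are the maximal runs of consecutive edges, counted by
-- counting the edges i ∈ G with i = 0 or i-1 ∉ G.
compsAux : ∀ {k} → Bool → Subset k → ℕ
compsAux prev []          = 0
compsAux prev (true ∷ G)  = (if prev then 0 else 1) + compsAux true G
compsAux prev (false ∷ G) = compsAux false G

comps : ∀ {k} → Subset k → ℕ
comps = compsAux false

induced : ∀ {k} → Subset k → Subset (suc k) → Subset k
induced G S = tabulate (λ i → lookup G i ∧ (lookup S (inject₁ i) ∧ lookup S (suc i)))

-- S ⊆ V_G is a union of vertex sets of components of G iff S is
-- closed under G-adjacency.
ClosedUnder : ∀ {k} → Subset k → Subset (suc k) → Set
ClosedUnder {k} G S = (i : Fin k) → i ∈ G →
  (inject₁ i ∈ S → suc i ∈ S) × (suc i ∈ S → inject₁ i ∈ S)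

-- Assignments.  An element of [n]^V (V ⊆ V_k) is encoded as a vector
-- x : Vec (Maybe (Fin n)) (suc k) with x_j = just _ exactly for j ∈ V.

Asg : ℕ → ℕ → Set
Asg n k = Vec (Maybe (Fin n)) (suc k)

dom : ∀ {n k} → Asg n k → Subset (suc k)
dom = map is-just

restrict : ∀ {n k} → Subset (suc k) → Asg n k → Asg n k
restrict S x = zipWith (λ b m → if b then m else nothing) S x

_≟A_ : ∀ {n k} (x y : Asg n k) → Dec (x ≡ y)
_≟A_ = VP.≡-dec (MP.≡-dec F._≟_)

record Pathset (n k : ℕ) (G : Subset k) : Set where
  constructor pathset
  field
    elems  : List (Asg n k)
    unique : Unique elems
    domOK  : All (λ x → dom x ≡ verts G) elems
open Pathset public

card : ∀ {n k G} → Pathset n k G → ℕ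
card A = length (elems A)

-- |A|^z_S| for S ⊆ V_G and z ∈ [n]^{V_G ∖ S}: the number of x ∈ A with
-- x_{V_G∖S} = z (for z of another domain this is 0, which is harmless
-- for the maximum defining μ_S).
fiber : ∀ {n k G} → Pathset n k G → Subset (suc k) → Asg n k → ℕ
fiber {G = G} A S z =
  length (filter (λ x → restrict (verts G ∩ ∁ S) x ≟A z) (elems A))

-- Real-exponent inequalities, expressed exactly in ℕ.
-- SmallBound n k t s m  ⇔  m / n^s ≤ ñ^{-t}  where ñ = n^{1-1/log k}
--   (valid for n ≥ 1, k ≥ 2), i.e. m·n^t / n^s ≤ n^{t / log k}, i.e.
--   for all rationals p/q > t/log k (⇔ 2^{tq} < k^p):
--   m^q · n^{tq} ≤ n^{p + sq}.
SmallBound : ℕ → ℕ → ℕ → ℕ → ℕ → Set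
SmallBound n k t s m = (p q : ℕ) → 0 < q → 2 ^ (t * q) < k ^ p →
  m ^ q * n ^ (t * q) ≤ n ^ (p + s * q)

Small : ∀ {n k} (G : Subset k) → Pathset n k G → Set
Small {n} {k} G A = (S : Subset (suc k)) → S ⊆ verts G → ClosedUnder G S →
  Nonempty S → (z : Asg n k) →
  SmallBound n k (comps (induced G S)) ∣ S ∣ (fiber A S z)

-- Pathset complexity.  ChiLe G A c  means  χ_G(A) ≤ c.
-- (χ_G(A) is the minimum of the costs of all decompositions, so
--  χ_G(A) ≥ X  iff  every c with ChiLe G A c satisfies X ≤ c.)

mutual
  record Piece (n k : ℕ) (G : Subset k) : Set where
    inductive
    field
      H K   : Subset k
      H⊂G   : H ⊂ G
      K⊂G   : K ⊂ G
      H∪K   : H ∪ K ≡ G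
      B     : Pathset n k H
      C     : Pathset n k K
      Bsm   : Small H B
      Csm   : Small K C
      costB costC : ℕ
      chiB  : ChiLe n k H B costB
      chiC  : ChiLe n k K C costC

  data ChiLe (n k : ℕ) : (G : Subset k) → Pathset n k G → ℕ → Set where
    chi-empty : ∀ {G A c} → ∣ G ∣ ≡ 0 → ChiLe n k G A c
    chi-one   : ∀ {G A c} → ∣ G ∣ ≡ 1 → card A ≤ c → ChiLe n k G A c
    chi-split : ∀ {G A c} → 2 ≤ ∣ G ∣ → (ps : List (Piece n k G)) →
      sum (L.map (λ p → Piece.costB p + Piece.costC p) ps) ≤ c →
      -- A ⊆ ⋃_i B_i ⋈ C_i
      All (λ x → Any (λ p → (restrict (verts (Piece.H p)) x ∈ₗ elems (Piece.B p))
                          × (restrict (verts (Piece.K p)) x ∈ₗ elems (Piece.C p))) ps)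
          (elems A) →
      ChiLe n k G A c

{-# OPTIONS --safe #-}
-- Write r ≈ ñ^(1/2).  By induction on decompositions one shows: if G has a run of edges of length about 8^i whose inner
-- vertices avoid X, and t components disjoint from X and from that run, then with the vertices of X fixed every G-pathset
-- of cost c has density at most c / r^(2t + i).  For a piece B ⋈ C the density is at most that of B times that of C with the
-- vertices of B fixed, and smallness makes the latter at most r^(-2s), where s counts the components of C that miss B.
-- Hence either B and C together have more components than G, and shorter runs or gaps of B suffice, or both contain nearly
-- all of the run.  In the latter case, if C costs at least r^(i-2) then smallness alone is enough.  Otherwise C is cheap, and
-- one descends in the decomposition of B until the run has shrunk to a quarter: the long part of C outside of it
-- then has density at most 1/r, which makes up for the loss of one factor r in the shortened run.
module Submission where

open import Defs
open import Data.Bool using (Bool; true; false; not; _∧_; _∨_; if_then_else_)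
open import Data.Bool.Properties using (∨-zeroʳ; ∨-comm)
open import Data.Empty using (⊥; ⊥-elim)
open import Data.Fin using (Fin; zero; suc; toℕ; inject₁; fromℕ<)
open import Data.Fin.Properties using (toℕ-inject₁; toℕ<n; toℕ-fromℕ<) renaming (_≟_ to _≟F_)
open import Data.Fin.Subset using (Subset; ⊤; _∈_; _⊆_; _⊂_; _∪_; _∩_; ∁; ∣_∣; Nonempty)
open import Data.Fin.Subset.Properties using (p⊂q⇒∣p∣<∣q∣; x∈p∪q⁻; ∪-comm; ∣⊤∣≡n)
open import Data.List as L using (List; length; filter; []; _∷_)
open import Data.List.Membership.Propositional using () renaming (_∈_ to _∈ₗ_)
open import Data.List.Properties using (length-filter)
open import Data.List.Relation.Unary.All using (All; []; _∷_) renaming (lookup to lookupAll)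
open import Data.List.Relation.Unary.AllPairs using ([]; _∷_)
open import Data.List.Relation.Unary.Any using (Any; here; there)
open import Data.List.Relation.Unary.Unique.Propositional using (Unique)
open import Data.Maybe using (Maybe; just; nothing; is-just)
open import Data.Nat using (ℕ; zero; suc; _+_; _*_; _^_; _∸_; _≤_; _<_; _≤ᵇ_; z≤n; s≤s; s≤s⁻¹; NonZero; >-nonZero)
open import Data.Nat.DivMod using (_/_; _%_; m≡m%n+[m/n]*n; m%n<n; m/n≤m)
import Data.Nat.ListAction as LA
open import Data.Nat.Properties
open import Algebra.Properties.Semiring.Sum +-*-semiring
  using (sum; sum-cong-≗; ∑-comm; *-distribˡ-sum; *-distribʳ-sum)
open import Data.Nat.Solver using (module +-*-Solver)
open import Data.Product using (Σ; ∃-syntax; _×_; _,_; proj₁; proj₂)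
open import Data.Sum using (_⊎_; inj₁; inj₂; [_,_]′)
open import Data.Unit using (tt)
open import Data.Vec using (Vec; []; _∷_; lookup; tabulate; zipWith; map; replicate)
open import Data.Vec.Properties using (lookup∘tabulate; []=⇒lookup; lookup⇒[]=)
open import Relation.Binary.Definitions using (tri<; tri≈; tri>)
open import Relation.Binary.PropositionalEquality
open import Relation.Nullary using (yes; no; does)

-- In a join the cost can be charged to one factor only, since costs add while densities multiply;
-- the other factor must be bounded free of charge, with all vertices of the first fixed. Smallness
-- is such a bound, but it sees only whole components that miss the first factor, and so says
-- nothing if both factors fill nearly the whole run. The other source is a cheap factor, whose cost
-- is absorbed by a power of r (`bound-cancel`); yet the vertices of its partner cover its run as
-- well. Hence the descent: the partner is replaced by a descendant too short to cover it. Fixed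
-- vertices also become ends of runs, so the induction has to include tied ends. Each doubles the
-- required length: a run around the middle edge that keeps only one of two tied ends has half the
-- length and meets half the requirement. The ratio 8 comes from the case where both factors fill
-- the run: an interval of length 2T, less than 2T beside it on either side and gaps of total length
-- T do not fill 8T. To stay within the integers, r satisfies r^(2Q) at most n^(Q - 1), where 2^Q <
-- k; then r^2 is at most ñ.

-- A set of edges or of vertices of the infinite path: edge i joins the vertices i and suc i.
Line : Set
Line = ℕ → Bool

infix 4 _≼_
record _≼_ (X Y : Line) : Set where
  constructor incl
  field include : ∀ v → X v ≡ true → Y v ≡ true
open _≼_ public

infixr 6 _⊔ˡ_
_⊔ˡ_ : Line → Line → Line
(X ⊔ˡ Y) v = X v ∨ Y v

shift : Line → Line
shift X v = X (suc v)

-- Conditional averages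

sum-mono : ∀ {n} {f g : Fin n → ℕ} → (∀ i → f i ≤ g i) → sum f ≤ sum g
sum-mono {zero}  f≤g = z≤n
sum-mono {suc n} f≤g = +-mono-≤ (f≤g zero) (sum-mono (λ i → f≤g (suc i)))

sum-const : ∀ n c → sum {n} (λ _ → c) ≡ n * c
sum-const zero    c = refl
sum-const (suc n) c = cong (c +_) (sum-const n c)

module _ {n : ℕ} where

  -- mass X P z / n ^ m is the average of P over the assignments agreeing with z on X.
  mass : ∀ {m} → Line → (Vec (Fin n) m → ℕ) → Vec (Fin n) m → ℕ
  mass X P []       = P []
  mass X P (z ∷ zs) = if X 0 then n * mass (shift X) (λ x → P (z ∷ x)) zs
                             else sum (λ a → mass (shift X) (λ x → P (a ∷ x)) zs)

  mass-mono : ∀ {m} X {P Q : Vec (Fin n) m → ℕ} → (∀ x → P x ≤ Q x) →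
              ∀ z → mass X P z ≤ mass X Q z
  mass-mono X P≤Q []       = P≤Q []
  mass-mono X P≤Q (z ∷ zs) with X 0
  ... | true  = *-monoʳ-≤ n (mass-mono (shift X) (λ x → P≤Q (z ∷ x)) zs)
  ... | false = sum-mono (λ a → mass-mono (shift X) (λ x → P≤Q (a ∷ x)) zs)

  mass-cong : ∀ {m} X {P Q : Vec (Fin n) m → ℕ} → (∀ x → P x ≡ Q x) →
              ∀ z → mass X P z ≡ mass X Q z
  mass-cong X P≡Q z = ≤-antisym (mass-mono X (λ x → ≤-reflexive (P≡Q x)) z)
                                (mass-mono X (λ x → ≤-reflexive (sym (P≡Q x))) z)

  mass-sum : ∀ {m l} X (f : Fin l → Vec (Fin n) m → ℕ) z →
             mass X (λ x → sum (λ a → f a x)) z ≡ sum (λ a → mass X (f a) z)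
  mass-sum X f []       = refl
  mass-sum X f (z ∷ zs) with X 0
  ... | true  = trans (cong (n *_) (mass-sum (shift X) (λ a x → f a (z ∷ x)) zs))
                      (*-distribˡ-sum n (λ a → mass (shift X) (λ x → f a (z ∷ x)) zs))
  ... | false = trans (sum-cong-≗ (λ b → mass-sum (shift X) (λ a x → f a (b ∷ x)) zs))
                      (∑-comm (λ b a → mass (shift X) (λ x → f a (b ∷ x)) zs))

  mass-const : ∀ {m} X c (z : Vec (Fin n) m) → mass X (λ _ → c) z ≡ n ^ m * c
  mass-const X c []       = sym (+-identityʳ c)
  mass-const {suc m} X c (z ∷ zs) with X 0
  ... | true  = trans (cong (n *_) (mass-const (shift X) c zs)) (sym (*-assoc n (n ^ m) c))
  ... | false = trans (sum-cong-≗ {n} (λ _ → mass-const (shift X) c zs))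
                      (trans (sum-const n _) (sym (*-assoc n (n ^ m) c)))

  mass-+ : ∀ {m} X (P Q : Vec (Fin n) m → ℕ) z →
           mass X (λ x → P x + Q x) z ≡ mass X P z + mass X Q z
  mass-+ X P Q z = begin
    mass X (λ x → P x + Q x) z        ≡⟨ mass-cong X (λ x → cong (P x +_) (sym (+-identityʳ (Q x)))) z ⟩
    mass X (λ x → sum (λ a → f a x)) z ≡⟨ mass-sum X f z ⟩
    mass X P z + (mass X Q z + 0)      ≡⟨ cong (mass X P z +_) (+-identityʳ _) ⟩
    mass X P z + mass X Q z ∎
    where
      open ≡-Reasoning
      f : Fin 2 → _ → ℕ
      f zero    = P
      f (suc _) = Q

  mass-* : ∀ {m} X c (P : Vec (Fin n) m → ℕ) z → mass X (λ x → c * P x) z ≡ c * mass X P z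
  mass-* {m} X zero P z = trans (mass-const X 0 z) (*-zeroʳ (n ^ m))
  mass-* X (suc c) P z = trans (mass-+ X P (λ x → c * P x) z) (cong (mass X P z +_) (mass-* X c P z))

  record DependsOn {m} (Y : Line) (P : Vec (Fin n) m → ℕ) : Set where
    constructor dependsOn
    field agree⇒≡ : ∀ x y → (∀ i → Y (toℕ i) ≡ true → lookup x i ≡ lookup y i) → P x ≡ P y
  open DependsOn public

  private
    tail-depends : ∀ {m} Y {P : Vec (Fin n) (suc m) → ℕ} → DependsOn Y P →
                   ∀ a → DependsOn (shift Y) (λ x → P (a ∷ x))
    tail-depends {m} Y {P} dep a = dependsOn (λ x y eq → agree⇒≡ dep (a ∷ x) (a ∷ y) (agree x y eq))
      where
        agree : ∀ (x y : Vec (Fin n) m) → (∀ i → Y (suc (toℕ i)) ≡ true → lookup x i ≡ lookup y i) →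
                ∀ i → Y (toℕ i) ≡ true → lookup (a ∷ x) i ≡ lookup (a ∷ y) i
        agree x y eq zero    _ = refl
        agree x y eq (suc i) e = eq i e

    head-irrelevant : ∀ {m} Y {P : Vec (Fin n) (suc m) → ℕ} → DependsOn Y P →
                      Y 0 ≡ false → ∀ a b x → P (a ∷ x) ≡ P (b ∷ x)
    head-irrelevant Y dep Y0 a b x = agree⇒≡ dep (a ∷ x) (b ∷ x) agree
      where
        agree : ∀ i → Y (toℕ i) ≡ true → lookup (a ∷ x) i ≡ lookup (b ∷ x) i
        agree zero    e with trans (sym Y0) e
        ... | ()
        agree (suc i) _ = refl

  -- For fixed values on `Y` the factor `P` is constant, so `Q` is averaged first and its uniform
  -- bound pulled out. The factor `s` keeps the induction in one form: a head in `Y` multiplies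
  -- `mass Y Q` by n, and this n moves into `s`; a head outside `Y` is summed into `Q`.
  mass-product : ∀ {m} X Y (P Q : Vec (Fin n) m → ℕ) s M → X ≼ Y → DependsOn Y P →
                 (∀ z → s * mass Y Q z ≤ M) →
                 ∀ z → s * n ^ m * mass X (λ x → P x * Q x) z ≤ mass X P z * M
  mass-product X Y P Q s M X≼Y dep bd [] = begin
    s * 1 * (P [] * Q []) ≡⟨ solve 3 (λ s p q → s :* con 1 :* (p :* q) := p :* (s :* q)) refl s (P []) (Q []) ⟩
    P [] * (s * Q [])     ≤⟨ *-monoʳ-≤ (P []) (bd []) ⟩
    P [] * M ∎
    where
      open ≤-Reasoning
      open +-*-Solver
  mass-product {suc m} X Y P Q s M X≼Y dep bd (z ∷ zs) with X 0 in X0 | Y 0 in Y0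
  ... | true | false with trans (sym (include X≼Y 0 X0)) Y0
  ...   | ()
  mass-product {suc m} X Y P Q s M X≼Y dep bd (z ∷ zs) | true | true = begin
    s * (n * n ^ m) * (n * μPQ)   ≡⟨ solve 4 (λ s n k μ → s :* (n :* k) :* (n :* μ) := n :* (s :* n :* k :* μ)) refl s n (n ^ m) μPQ ⟩
    n * (s * n * n ^ m * μPQ)     ≤⟨ *-monoʳ-≤ n (mass-product (shift X) (shift Y) (λ x → P (z ∷ x)) (λ x → Q (z ∷ x)) (s * n) M
                                       (incl (λ v → include X≼Y (suc v))) (tail-depends Y {P} dep z) bd′ zs) ⟩
    n * (μP * M)                  ≡⟨ sym (*-assoc n μP M) ⟩
    n * μP * M ∎
    where
      open ≤-Reasoning
      open +-*-Solver
      μPQ = mass (shift X) (λ x → P (z ∷ x) * Q (z ∷ x)) zs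
      μP = mass (shift X) (λ x → P (z ∷ x)) zs
      bd′ : ∀ ys → s * n * mass (shift Y) (λ x → Q (z ∷ x)) ys ≤ M
      bd′ ys with bd (z ∷ ys)
      ... | h rewrite Y0 = ≤-trans (≤-reflexive (*-assoc s n _)) h
  mass-product {suc m} X Y P Q s M X≼Y dep bd (z ∷ zs) | false | true = begin
    s * (n * n ^ m) * sum μPQ          ≡⟨ *-distribˡ-sum (s * (n * n ^ m)) μPQ ⟩
    sum (λ a → s * (n * n ^ m) * μPQ a) ≤⟨ sum-mono step ⟩
    sum (λ a → μP a * M)               ≡⟨ sym (*-distribʳ-sum M μP) ⟩
    sum μP * M ∎
    where
      open ≤-Reasoning
      μPQ = λ a → mass (shift X) (λ x → P (a ∷ x) * Q (a ∷ x)) zs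
      μP = λ a → mass (shift X) (λ x → P (a ∷ x)) zs
      bd′ : ∀ a ys → s * n * mass (shift Y) (λ x → Q (a ∷ x)) ys ≤ M
      bd′ a ys with bd (a ∷ ys)
      ... | h rewrite Y0 = ≤-trans (≤-reflexive (*-assoc s n _)) h
      step : ∀ a → s * (n * n ^ m) * μPQ a ≤ μP a * M
      step a = ≤-trans (≤-reflexive (cong (_* μPQ a) (sym (*-assoc s n (n ^ m)))))
                 (mass-product (shift X) (shift Y) (λ x → P (a ∷ x)) (λ x → Q (a ∷ x)) (s * n) M
                    (incl (λ v → include X≼Y (suc v))) (tail-depends Y {P} dep a) (bd′ a) zs)
  mass-product {suc m} X Y P Q s M X≼Y dep bd (z ∷ zs) | false | false = begin
    s * (n * n ^ m) * sum (λ a → mass (shift X) (λ x → P (a ∷ x) * Q (a ∷ x)) zs)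
      ≡⟨ cong (s * (n * n ^ m) *_) eqPQ ⟩
    s * (n * n ^ m) * μPQ      ≡⟨ solve 4 (λ s n k μ → s :* (n :* k) :* μ := n :* (s :* k :* μ)) refl s n (n ^ m) μPQ ⟩
    n * (s * n ^ m * μPQ)      ≤⟨ *-monoʳ-≤ n (mass-product (shift X) (shift Y) P′ Q′ s M
                                     (incl (λ v → include X≼Y (suc v))) (tail-depends Y {P} dep z) bd′ zs) ⟩
    n * (mass (shift X) P′ zs * M) ≡⟨ sym (*-assoc n _ M) ⟩
    n * mass (shift X) P′ zs * M   ≡⟨ cong (_* M) (sym eqP) ⟩
    sum (λ a → mass (shift X) (λ x → P (a ∷ x)) zs) * M ∎
    where
      open ≤-Reasoning
      open +-*-Solver
      P′ = λ x → P (z ∷ x)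
      Q′ = λ x → sum (λ a → Q (a ∷ x))
      μPQ = mass (shift X) (λ x → P′ x * Q′ x) zs
      P≡ : ∀ a x → P (a ∷ x) ≡ P′ x
      P≡ a = head-irrelevant Y {P} dep Y0 a z
      eqPQ : sum (λ a → mass (shift X) (λ x → P (a ∷ x) * Q (a ∷ x)) zs) ≡ μPQ
      eqPQ = trans (sym (mass-sum (shift X) (λ a x → P (a ∷ x) * Q (a ∷ x)) zs))
               (mass-cong (shift X) (λ x → trans (sum-cong-≗ (λ a → cong (_* Q (a ∷ x)) (P≡ a x)))
                                                 (sym (*-distribˡ-sum (P′ x) (λ a → Q (a ∷ x))))) zs)
      eqP : sum (λ a → mass (shift X) (λ x → P (a ∷ x)) zs) ≡ n * mass (shift X) P′ zs
      eqP = trans (sum-cong-≗ (λ a → mass-cong (shift X) (P≡ a) zs)) (sum-const n _)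
      bd′ : ∀ ys → s * mass (shift Y) Q′ ys ≤ M
      bd′ ys with bd (z ∷ ys)
      ... | h rewrite Y0 = ≤-trans (≤-reflexive (cong (s *_) (mass-sum (shift Y) (λ a x → Q (a ∷ x)) ys))) h

-- Runs and components on the path

true≢false : ∀ {b} → b ≡ true → b ≡ false → ⊥
true≢false refl ()

∨-false : ∀ {a b} → a ≡ false → b ≡ false → a ∨ b ≡ false
∨-false refl refl = refl

∨-trueˡ : ∀ {a b} → a ≡ true → a ∨ b ≡ true
∨-trueˡ refl = refl

∨-trueʳ : ∀ {a b} → b ≡ true → a ∨ b ≡ true
∨-trueʳ {a} refl = ∨-zeroʳ a

≼-refl : ∀ {X} → X ≼ X
≼-refl = incl (λ v e → e)

≼-trans : ∀ {X Y Z} → X ≼ Y → Y ≼ Z → X ≼ Z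
≼-trans p q = incl (λ v e → include q v (include p v e))

≼-⊔ˡ : ∀ {X Y} → X ≼ X ⊔ˡ Y
≼-⊔ˡ = incl (λ v e → ∨-trueˡ e)

≼-⊔ʳ : ∀ {X Y} → Y ≼ X ⊔ˡ Y
≼-⊔ʳ {X} = incl (λ v e → ∨-trueʳ {X v} e)

≼-false : ∀ {X Y} → X ≼ Y → ∀ v → Y v ≡ false → X v ≡ false
≼-false {X} X≼Y v e with X v in eq
... | false = refl
... | true  = ⊥-elim (true≢false (include X≼Y v eq) e)

before : Line → Line
before G zero    = false
before G (suc v) = G v

ends : Line → Line
ends G v = before G v ∨ G v

before-mono : ∀ {G H} → G ≼ H → before G ≼ before H
before-mono {G} {H} G≼H = incl mono
  where
    mono : ∀ v → before G v ≡ true → before H v ≡ true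
    mono (suc v) e = include G≼H v e

ends-mono : ∀ {G H} → G ≼ H → ends G ≼ ends H
ends-mono {G} {H} G≼H = incl mono
  where
    mono : ∀ v → ends G v ≡ true → ends H v ≡ true
    mono v e with before G v in eq
    ... | true  = ∨-trueˡ (include (before-mono G≼H) v eq)
    ... | false = ∨-trueʳ {before H v} (include G≼H v e)

record Covers (A B C : Line) : Set where
  constructor covers
  field cover : ∀ i → A i ≡ B i ∨ C i

-- The last index is 2 when the end is tied to X and 1 when it is free, i.e. when G stops there outside X.
data LeftEnd (G X : Line) (u : ℕ) : ℕ → Set where
  free : X u ≡ false → before G u ≡ false → LeftEnd G X u 1
  tied : X u ≡ true → LeftEnd G X u 2

data RightEnd (G X : Line) (w : ℕ) : ℕ → Set where
  free : X w ≡ false → G w ≡ false → RightEnd G X w 1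
  tied : X w ≡ true → RightEnd G X w 2

record Run (G X : Line) (u w a b : ℕ) : Set where
  constructor run
  field
    nonempty : u < w
    edges    : ∀ i → u ≤ i → i < w → G i ≡ true
    inner    : ∀ v → u < v → v < w → X v ≡ false
    left     : LeftEnd G X u a
    right    : RightEnd G X w b

Component : Line → Line → ℕ → ℕ → Set
Component G X u w = Run G X u w 1 1

component-avoids : ∀ {G X u w} → Component G X u w → ∀ v → u ≤ v → v ≤ w → X v ≡ false
component-avoids {u = u} {w} (run _ _ inn (free Xu _) (free Xw _)) v u≤v v≤w with m≤n⇒m<n∨m≡n u≤v | m≤n⇒m<n∨m≡n v≤w
... | inj₂ refl | _         = Xu
... | inj₁ _    | inj₂ refl = Xw
... | inj₁ u<v  | inj₁ v<w  = inn v u<v v<w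

component-restrict : ∀ {G X X′ u w} → X′ ≼ X → Component G X u w → Component G X′ u w
component-restrict X′≼X (run ne es inn (free Xu Gu) (free Xw Gw)) =
  run ne es (λ v p q → ≼-false X′≼X v (inn v p q)) (free (≼-false X′≼X _ Xu) Gu) (free (≼-false X′≼X _ Xw) Gw)

left≤2 : ∀ {G X u a} → LeftEnd G X u a → a ≤ 2
left≤2 (free _ _) = s≤s z≤n
left≤2 (tied _)   = ≤-refl

right≤2 : ∀ {G X w b} → RightEnd G X w b → b ≤ 2
right≤2 (free _ _) = s≤s z≤n
right≤2 (tied _)   = ≤-refl

data Comps (G X : Line) : ℕ → ℕ → ℕ → Set where
  []   : ∀ {lo hi} → Comps G X lo hi 0
  cons : ∀ {lo hi u w t} → lo ≤ u → w < hi → Component G X u w →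
         Comps G X (suc w) hi t → Comps G X lo hi (suc t)

comps-weaken : ∀ {G X X′ lo lo′ hi hi′ t} → X′ ≼ X → lo′ ≤ lo → hi ≤ hi′ →
               Comps G X lo hi t → Comps G X′ lo′ hi′ t
comps-weaken X′≼X l h []              = []
comps-weaken X′≼X l h (cons p q c cs) =
  cons (≤-trans l p) (<-≤-trans q h) (component-restrict X′≼X c) (comps-weaken X′≼X ≤-refl h cs)

comps-append : ∀ {G X lo mid hi t t′} → lo ≤ mid → mid ≤ hi →
               Comps G X lo mid t → Comps G X mid hi t′ → Comps G X lo hi (t + t′)
comps-append l h []              ds = comps-weaken ≼-refl l ≤-refl ds
comps-append l h (cons p q c cs) ds = cons p (<-≤-trans q h) c (comps-append q h cs ds)

comps-take : ∀ {G X lo hi t} s → s ≤ t → Comps G X lo hi t → Comps G X lo hi s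
comps-take zero    _       _               = []
comps-take (suc s) (s≤s p) (cons l h c cs) = cons l h c (comps-take s p cs)

single : ∀ {G X lo hi u w} → lo ≤ u → w < hi → Component G X u w → Comps G X lo hi 1
single p q c = cons p q c []

findEdge : ∀ (G : Line) u d → (∃[ i ] u ≤ i × i < u + d × G i ≡ true) ⊎ (∀ i → u ≤ i → i < u + d → G i ≡ false)
findEdge G u zero = inj₂ (λ i p q → ⊥-elim (<-irrefl refl (<-≤-trans q (≤-trans (≤-reflexive (+-identityʳ u)) p))))
findEdge G u (suc d) with findEdge G u d | G (u + d) in eq
... | inj₁ (i , p , q , e) | _ = inj₁ (i , p , <-≤-trans q (+-monoʳ-≤ u (n≤1+n d)) , e)
... | inj₂ none | true  = inj₁ (u + d , m≤m+n u d , +-monoʳ-< u (n<1+n d) , eq)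
... | inj₂ none | false = inj₂ all
  where
    all : ∀ i → u ≤ i → i < u + suc d → G i ≡ false
    all i p q with m≤n⇒m<n∨m≡n (s≤s⁻¹ (≤-trans q (≤-reflexive (+-suc u d))))
    ... | inj₁ i<   = none i p i<
    ... | inj₂ refl = eq

findEdge≤ : ∀ (G : Line) {u w} → u ≤ w → (∃[ i ] u ≤ i × i < w × G i ≡ true) ⊎ (∀ i → u ≤ i → i < w → G i ≡ false)
findEdge≤ G {u} {w} u≤w = subst (λ w → (∃[ i ] u ≤ i × i < w × G i ≡ true) ⊎ (∀ i → u ≤ i → i < w → G i ≡ false))
                                (m+[n∸m]≡n u≤w) (findEdge G u (w ∸ u))

extendLeft : ∀ (G : Line) u d → G (u + d) ≡ true →
             ∃[ r ] u ≤ r × r ≤ u + d × (∀ i → r ≤ i → i ≤ u + d → G i ≡ true) × (r ≡ u ⊎ (u < r × before G r ≡ false))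
extendLeft G u zero e = u , ≤-refl , m≤m+n u 0 , all , inj₁ refl
  where
    all : ∀ i → u ≤ i → i ≤ u + 0 → G i ≡ true
    all i p q with ≤-antisym q (≤-trans (≤-reflexive (+-identityʳ u)) p)
    ... | refl = e
extendLeft G u (suc d) e with G (u + d) in eq
... | false = u + suc d , m≤m+n u _ , ≤-refl , all , inj₂ (m<m+n u (s≤s z≤n) , trans (cong (before G) (+-suc u d)) eq)
  where
    all : ∀ i → u + suc d ≤ i → i ≤ u + suc d → G i ≡ true
    all i p q with ≤-antisym p q
    ... | refl = e
... | true with extendLeft G u d eq
...   | r , u≤r , r≤ , es , l = r , u≤r , ≤-trans r≤ (+-monoʳ-≤ u (n≤1+n d)) , all , l
  where
    all : ∀ i → r ≤ i → i ≤ u + suc d → G i ≡ true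
    all i p q with m≤n⇒m<n∨m≡n q
    ... | inj₂ refl = e
    ... | inj₁ q′   = es i p (s≤s⁻¹ (≤-trans q′ (≤-reflexive (+-suc u d))))

extendRight : ∀ (G : Line) p d → G p ≡ true →
              ∃[ r ] p < r × r ≤ p + suc d × (∀ i → p ≤ i → i < r → G i ≡ true) × (r ≡ p + suc d ⊎ (r < p + suc d × G r ≡ false))
extendRight G p zero e = suc p , ≤-refl , ≤-reflexive (sym (+-comm p 1)) , all , inj₁ (sym (+-comm p 1))
  where
    all : ∀ i → p ≤ i → i < suc p → G i ≡ true
    all i l h with ≤-antisym (s≤s⁻¹ h) l
    ... | refl = e
extendRight G p (suc d) e with extendRight G p d e
... | r , p<r , r≤ , es , inj₂ (r< , Gr) = r , p<r , ≤-trans r≤ (+-monoʳ-≤ p (n≤1+n _)) , es , inj₂ (<-≤-trans r< (+-monoʳ-≤ p (n≤1+n _)) , Gr)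
... | r , p<r , r≤ , es , inj₁ refl with G (p + suc d) in eq
...   | false = p + suc d , p<r , +-monoʳ-≤ p (n≤1+n _) , es , inj₂ (+-monoʳ-< p (n<1+n _) , eq)
...   | true  = p + suc (suc d) , m<m+n p (s≤s z≤n) , ≤-refl , all , inj₁ refl
  where
    all : ∀ i → p ≤ i → i < p + suc (suc d) → G i ≡ true
    all i l h with m≤n⇒m<n∨m≡n (s≤s⁻¹ (≤-trans h (≤-reflexive (+-suc p (suc d)))))
    ... | inj₁ h′   = es i l h′
    ... | inj₂ refl = eq

-- An end strictly inside the window is an end of `B` itself and avoids `X`, so it is free; an end
-- on the border of the window keeps its kind, because `B` has no edge that `A` lacks.
runAround : ∀ {A B X u w a b} → B ≼ A → Run A X u w a b → ∀ p → u ≤ p → p < w → B p ≡ true →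
            ∃[ r ] ∃[ r′ ] ∃[ a′ ] ∃[ b′ ] u ≤ r × r ≤ p × p < r′ × r′ ≤ w × Run B X r r′ a′ b′ ×
              (r ≡ u × a′ ≡ a ⊎ u < r × a′ ≡ 1) × (r′ ≡ w × b′ ≡ b ⊎ r′ < w × b′ ≡ 1)
runAround {A} {B} {X} {u} {w} {a} {b} B≼A (run ne es inn le re) p u≤p p<w Bp
  with extendLeft B u (p ∸ u) (trans (cong B (m+[n∸m]≡n u≤p)) Bp) | extendRight B p (w ∸ suc p) Bp
... | r , u≤r , r≤p , esL , ll | r′ , p<r′ , r′≤w , esR , rr =
  r , r′ , proj₁ L , proj₁ R , u≤r , r≤p′ , p<r′ , r′≤w′ ,
  run (≤-<-trans r≤p′ p<r′) edges′ (λ v l h → inn v (≤-<-trans u≤r l) (<-≤-trans h r′≤w′)) (proj₁ (proj₂ L)) (proj₁ (proj₂ R)) ,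
  proj₂ (proj₂ L) , proj₂ (proj₂ R)
  where
    eqp : u + (p ∸ u) ≡ p
    eqp = m+[n∸m]≡n u≤p
    eqw : p + suc (w ∸ suc p) ≡ w
    eqw = trans (+-suc p (w ∸ suc p)) (m+[n∸m]≡n p<w)
    r≤p′ : r ≤ p
    r≤p′ = ≤-trans r≤p (≤-reflexive eqp)
    r′≤w′ : r′ ≤ w
    r′≤w′ = ≤-trans r′≤w (≤-reflexive eqw)
    edges′ : ∀ i → r ≤ i → i < r′ → B i ≡ true
    edges′ i l h with i ≤? p
    ... | yes i≤p = esL i l (≤-trans i≤p (≤-reflexive (sym eqp)))
    ... | no  i≰p = esR i (<⇒≤ (≰⇒> i≰p)) h
    lend : r ≡ u ⊎ (u < r × before B r ≡ false) → LeftEnd A X u a →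
           ∃[ a′ ] LeftEnd B X r a′ × (r ≡ u × a′ ≡ a ⊎ u < r × a′ ≡ 1)
    lend (inj₂ (u<r , Br)) _           = 1 , free (inn r u<r (≤-<-trans r≤p′ p<w)) Br , inj₂ (u<r , refl)
    lend (inj₁ refl)       (free Xu Au) = 1 , free Xu (≼-false (before-mono B≼A) u Au) , inj₁ (refl , refl)
    lend (inj₁ refl)       (tied Xu)    = 2 , tied Xu , inj₁ (refl , refl)
    rend : r′ ≡ p + suc (w ∸ suc p) ⊎ (r′ < p + suc (w ∸ suc p) × B r′ ≡ false) → RightEnd A X w b →
           ∃[ b′ ] RightEnd B X r′ b′ × (r′ ≡ w × b′ ≡ b ⊎ r′ < w × b′ ≡ 1)
    rend (inj₂ (r′< , Br)) _            = 1 , free (inn r′ (≤-<-trans u≤p p<r′) r′<w) Br , inj₂ (r′<w , refl)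
      where r′<w = <-≤-trans r′< (≤-reflexive eqw)
    rend (inj₁ refl)       (free Xw Aw) = 1 , free (trans (cong X eqw) Xw) (≼-false B≼A _ (trans (cong A eqw) Aw)) , inj₁ (eqw , refl)
    rend (inj₁ refl)       (tied Xw)    = 2 , tied (trans (cong X eqw) Xw) , inj₁ (eqw , refl)
    L = lend ll le
    R = rend rr re

-- Covers of a run by two subgraphs

covers-swap : ∀ {A B C} → Covers A B C → Covers A C B
covers-swap {A} {B} {C} cov = covers (λ i → trans (Covers.cover cov i) (∨-comm (B i) (C i)))

covers-≼ˡ : ∀ {A B C} → Covers A B C → B ≼ A
covers-≼ˡ cov = incl (λ v e → trans (Covers.cover cov v) (∨-trueˡ e))

covers-≼ʳ : ∀ {A B C} → Covers A B C → C ≼ A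
covers-≼ʳ {B = B} cov = incl (λ v e → trans (Covers.cover cov v) (∨-trueʳ {B v} e))

-- Maximality lies in `endˡ` and `endʳ`: an end inside the window touches an edge of `B`, hence
-- becomes tied once the vertices of `B` are fixed.
record Gap (B : Line) (u w r r′ : ℕ) : Set where
  constructor gap
  field
    u≤r   : u ≤ r
    r<r′  : r < r′
    r′≤w  : r′ ≤ w
    empty : ∀ i → r ≤ i → i < r′ → B i ≡ false
    endˡ  : r ≡ u ⊎ before B r ≡ true
    endʳ  : r′ ≡ w ⊎ B r′ ≡ true

-- `C` must have every edge that `B` lacks. No inner vertex of the gap belongs to `B`, so fixing the
-- vertices of `B` ties at most the two ends.
gap-run : ∀ {A B C X u w a b r r′} → Covers A B C → Run A X u w a b → Gap B u w r r′ →
          ∃[ a′ ] ∃[ b′ ] Run C (X ⊔ˡ ends B) r r′ a′ b′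
gap-run {A} {B} {C} {X} {u} {w} {a} {b} {r} {r′} cov (run ne es inn le re) (gap u≤r r<r′ r′≤w emp el er) =
  proj₁ (lend el le) , proj₁ (rend er re) , run r<r′ edges′ inner′ (proj₂ (lend el le)) (proj₂ (rend er re))
  where
    edges′ : ∀ i → r ≤ i → i < r′ → C i ≡ true
    edges′ i l h = trans (sym (trans (Covers.cover cov i) (cong (_∨ C i) (emp i l h)))) (es i (≤-trans u≤r l) (<-≤-trans h r′≤w))
    before-gap : ∀ v → r < v → v ≤ r′ → before B v ≡ false
    before-gap (suc v) l h = emp v (s≤s⁻¹ l) h
    inner′ : ∀ v → r < v → v < r′ → (X ⊔ˡ ends B) v ≡ false
    inner′ v l h = ∨-false (inn v (≤-<-trans u≤r l) (<-≤-trans h r′≤w))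
                     (∨-false (before-gap v l (<⇒≤ h)) (emp v (<⇒≤ l) h))
    lend : r ≡ u ⊎ before B r ≡ true → LeftEnd A X u a → ∃[ a′ ] LeftEnd C (X ⊔ˡ ends B) r a′
    lend (inj₂ Br)   _            = 2 , tied (∨-trueʳ {X r} (∨-trueˡ Br))
    lend (inj₁ refl) (tied Xu)    = 2 , tied (∨-trueˡ Xu)
    lend (inj₁ refl) (free Xu Au) = 1 , free (∨-false Xu (∨-false (≼-false (before-mono (covers-≼ˡ cov)) u Au) (emp r ≤-refl r<r′)))
                                             (≼-false (before-mono (covers-≼ʳ cov)) u Au)
    rend : r′ ≡ w ⊎ B r′ ≡ true → RightEnd A X w b → ∃[ b′ ] RightEnd C (X ⊔ˡ ends B) r′ b′
    rend (inj₂ Br)   _            = 2 , tied (∨-trueʳ {X r′} (∨-trueʳ {before B r′} Br))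
    rend (inj₁ refl) (tied Xw)    = 2 , tied (∨-trueˡ Xw)
    rend (inj₁ refl) (free Xw Aw) = 1 , free (∨-false Xw (∨-false (before-gap r′ r<r′ ≤-refl) (≼-false (covers-≼ˡ cov) w Aw)))
                                             (≼-false (covers-≼ʳ cov) w Aw)

-- If `B` has an edge in the component, the maximal run around it has two free ends. If not, `C` has
-- all of its edges, and no vertex of it belongs to `B`, since `A` has no edge leaving it.
component-∪ : ∀ {A B C X u w} → Covers A B C → Component A X u w →
              (∃[ r ] ∃[ r′ ] u ≤ r × r′ ≤ w × Component B X r r′) ⊎ Component C (X ⊔ˡ ends B) u w
component-∪ {A} {B} {C} {X} {u} {w} cov R@(run ne es inn le re) with findEdge≤ B (<⇒≤ ne)
... | inj₁ (p , u≤p , p<w , Bp) with runAround (covers-≼ˡ cov) R p u≤p p<w Bp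
...   | r , r′ , _ , _ , u≤r , _ , _ , r′≤w , S , l , h = inj₁ (r , r′ , u≤r , r′≤w , freed l h)
  where
    freed : _ → _ → Component B X r r′
    freed (inj₁ (_ , refl)) (inj₁ (_ , refl)) = S
    freed (inj₁ (_ , refl)) (inj₂ (_ , refl)) = S
    freed (inj₂ (_ , refl)) (inj₁ (_ , refl)) = S
    freed (inj₂ (_ , refl)) (inj₂ (_ , refl)) = S
component-∪ {A} {B} {C} {X} {u} {w} cov R@(run ne es inn (free Xu Au) (free Xw Aw)) | inj₂ none
  with gap-run {a = 1} {b = 1} cov R (gap ≤-refl ne ≤-refl none (inj₁ refl) (inj₁ refl))
... | _ , _ , run ne′ es′ inn′ _ _ = inj₂ (run ne′ es′ inn′
        (free (∨-false Xu (∨-false (≼-false (before-mono (covers-≼ˡ cov)) u Au) (none u ≤-refl ne)))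
              (≼-false (before-mono (covers-≼ʳ cov)) u Au))
        (free (∨-false Xw (∨-false (lastB w ne none) (≼-false (covers-≼ˡ cov) w Aw)))
              (≼-false (covers-≼ʳ cov) w Aw)))
  where
    lastB : ∀ w → u < w → (∀ i → u ≤ i → i < w → B i ≡ false) → before B w ≡ false
    lastB (suc w) l none = none w (s≤s⁻¹ l) ≤-refl

-- Every component of A contains a component of B or is itself a component of C that misses B.
comps-∪ : ∀ {A B C X lo hi t} → Covers A B C → Comps A X lo hi t →
          ∃[ t₁ ] ∃[ t₂ ] t ≡ t₁ + t₂ × Comps B X lo hi t₁ × Comps C (X ⊔ˡ ends B) lo hi t₂
comps-∪ cov [] = 0 , 0 , refl , [] , []
comps-∪ cov (cons l h c cs) with comps-∪ cov cs | component-∪ cov c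
... | t₁ , t₂ , refl , ds , es | inj₁ (r , r′ , u≤r , r′≤w , d) =
  suc t₁ , t₂ , refl ,
  cons (≤-trans l u≤r) (≤-<-trans r′≤w h) d (comps-weaken ≼-refl (s≤s r′≤w) ≤-refl ds) ,
  comps-weaken ≼-refl (≤-trans (≤-trans l (<⇒≤ (Run.nonempty c))) (n≤1+n _)) ≤-refl es
... | t₁ , t₂ , refl , ds , es | inj₂ d =
  t₁ , suc t₂ , sym (+-suc t₁ t₂) ,
  comps-weaken ≼-refl (≤-trans (≤-trans l (<⇒≤ (Run.nonempty c))) (n≤1+n _)) ≤-refl ds ,
  cons l h d es

-- Both borders of a component lack an edge, so a run that meets it cannot leave it; and a component
-- avoids `X`, so such a run has no tied end.
component-run : ∀ {G X p q r s a b} → Component G X p q → Run G X r s a b →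
                q < r ⊎ s < p ⊎ (r ≤ q × s ≤ q × a ≡ 1 × b ≡ 1)
component-run {G} {X} {p} {q} {r} {s} c@(run p<q _ _ (free _ Gp) (free _ Gq)) (run r<s es _ le re)
  with q <? r | s <? p
... | yes q<r | _       = inj₁ q<r
... | no _    | yes s<p = inj₂ (inj₁ s<p)
... | no q≮r  | no s≮p  = inj₂ (inj₂ (≮⇒≥ q≮r , s≤q , lfree le , rfree re))
  where
    s≤q : s ≤ q
    s≤q with s ≤? q
    ... | yes s≤q = s≤q
    ... | no  s≰q = ⊥-elim (true≢false (es q (≮⇒≥ q≮r) (≰⇒> s≰q)) Gq)
    p≤r : p ≤ r
    p≤r with p ≤? r
    ... | yes p≤r = p≤r
    ... | no  p≰r = ⊥-elim (impossible p (≰⇒> p≰r) (≮⇒≥ s≮p) Gp)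
      where
        impossible : ∀ p → r < p → p ≤ s → before G p ≡ false → ⊥
        impossible (suc p) l h e = true≢false (es p (s≤s⁻¹ l) h) e
    lfree : ∀ {a} → LeftEnd G X r a → a ≡ 1
    lfree (free _ _) = refl
    lfree (tied Xr)  = ⊥-elim (true≢false Xr (component-avoids c r p≤r (≮⇒≥ q≮r)))
    rfree : ∀ {b} → RightEnd G X s b → b ≡ 1
    rfree (free _ _) = refl
    rfree (tied Xs)  = ⊥-elim (true≢false Xs (component-avoids c s (≤-trans p≤r (<⇒≤ r<s)) s≤q))

-- At most one listed component meets the run, and none does if the run is tied. This difference
-- decides how strong a claim about the run has to be.
comps-split : ∀ {G X lo hi e r s a b} → Comps G X lo hi e → Run G X r s a b → lo ≤ r →
              ∃[ e₁ ] ∃[ e₂ ] Comps G X lo r e₁ × Comps G X (suc s) hi e₂ ×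
                (e ≤ e₁ + e₂ ⊎ (a ≡ 1 × b ≡ 1 × e ≤ suc (e₁ + e₂)))
comps-split [] R lo≤r = 0 , 0 , [] , [] , inj₁ z≤n
comps-split (cons l h c cs) R lo≤r with component-run c R
... | inj₂ (inj₁ s<p) = 0 , _ , [] , cons s<p h c cs , inj₁ ≤-refl
... | inj₂ (inj₂ (_ , s≤q , a≡1 , b≡1)) =
  0 , _ , [] , comps-weaken ≼-refl (s≤s s≤q) ≤-refl cs , inj₂ (a≡1 , b≡1 , ≤-refl)
... | inj₁ q<r with comps-split cs R q<r
...   | e₁ , e₂ , ds , es , inj₁ e≤ = suc e₁ , e₂ , cons l q<r c ds , es , inj₁ (s≤s e≤)
...   | e₁ , e₂ , ds , es , inj₂ (a≡1 , b≡1 , e≤) = suc e₁ , e₂ , cons l q<r c ds , es , inj₂ (a≡1 , b≡1 , s≤s e≤)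

-- Components get their own threshold because a long component is already counted with weight 2: the
-- claim applied to it has to be stronger by 2 than the one for a tied run or a gap, and therefore
-- asks for more length.
data LongPart (B X : Line) (u w T U : ℕ) : Set where
  longComponent : ∀ {r r′} → u ≤ r → r′ ≤ w → Component B X r r′ → r + T ≤ r′ → LongPart B X u w T U
  longTied      : ∀ {r r′ a b} → u ≤ r → r′ ≤ w → Run B X r r′ a b → 2 ≤ a * b → r + U ≤ r′ → LongPart B X u w T U
  longGap       : ∀ {r r′} → Gap B u w r r′ → r + U ≤ r′ → LongPart B X u w T U

-- A run splits into the e components of B in it, the at most e + 1 gaps of B and at most two tied runs of B.
module _ {A B X : Line} {u w a b : ℕ} (B≼A : B ≼ A) (R : Run A X u w a b) (T U : ℕ) where

  private
    Edges : ℕ → ℕ → Bool → Set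
    Edges s j c = ∀ i → s ≤ i → i < j → B i ≡ c

    RunStart GapStart : ℕ → Set
    RunStart s = s ≡ u ⊎ u < s × before B s ≡ false
    GapStart s = s ≡ u ⊎ before B s ≡ true

    -- The multiples of `U` count what lies before the current part and is not a component: before a
    -- gap at most `e` gaps and one run tied at the left end, before a run at most one gap more.
    data State (j : ℕ) : Set where
      inRun : ∀ {s e} → s < j → Edges s j true → RunStart s → Comps B X u s e →
              s ≤ u + (e * T + (2 + e) * U) → State j
      inGap : ∀ {s e} → s < j → Edges s j false → u ≤ s → GapStart s → Comps B X u (suc s) e →
              s ≤ u + (e * T + (1 + e) * U) → State j

    extend : ∀ {s j c} → Edges s j c → B j ≡ c → Edges s (suc j) c
    extend es Bj i l h with m≤n⇒m<n∨m≡n (s≤s⁻¹ h)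
    ... | inj₁ h′   = es i l h′
    ... | inj₂ refl = Bj

    only : ∀ {j c} → B j ≡ c → Edges j (suc j) c
    only Bj i l h with ≤-antisym (s≤s⁻¹ h) l
    ... | refl = Bj

    addU : ∀ {j s} x y → j ≤ s + U → s ≤ u + (x + y) → j ≤ u + (x + (U + y))
    addU {j} {s} x y p q = begin
      j               ≤⟨ p ⟩
      s + U           ≤⟨ +-monoˡ-≤ U q ⟩
      u + (x + y) + U ≡⟨ solve 4 (λ u x y U → u :+ (x :+ y) :+ U := u :+ (x :+ (U :+ y))) refl u x y U ⟩
      u + (x + (U + y)) ∎
      where
        open ≤-Reasoning
        open +-*-Solver

    addT : ∀ {j s} x y → j ≤ s + T → s ≤ u + (x + y) → j ≤ u + (T + x + y)
    addT {j} {s} x y p q = begin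
      j               ≤⟨ p ⟩
      s + T           ≤⟨ +-monoˡ-≤ T q ⟩
      u + (x + y) + T ≡⟨ solve 4 (λ u x y T → u :+ (x :+ y) :+ T := u :+ (T :+ x :+ y)) refl u x y T ⟩
      u + (T + x + y) ∎
      where
        open ≤-Reasoning
        open +-*-Solver

    start≤ : ∀ {s} → RunStart s → u ≤ s
    start≤ (inj₁ refl)      = ≤-refl
    start≤ (inj₂ (u<s , _)) = <⇒≤ u<s

    startEnd : ∀ {s} → s < w → RunStart s → LeftEnd B X s 1 ⊎ (s ≡ u × LeftEnd B X s 2)
    startEnd s<w (inj₂ (u<s , Bs)) = inj₁ (free (Run.inner R _ u<s s<w) Bs)
    startEnd s<w (inj₁ refl) with Run.left R
    ... | free Xu Au = inj₁ (free Xu (≼-false (before-mono B≼A) u Au))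
    ... | tied Xu    = inj₂ (refl , tied Xu)

    close : ∀ {s j a b} → s < j → j ≤ w → Edges s j true → u ≤ s → LeftEnd B X s a → RightEnd B X j b → Run B X s j a b
    close s<j j≤w es u≤s le re =
      run s<j es (λ v l h → Run.inner R v (≤-<-trans u≤s l) (<-≤-trans h j≤w)) le re

    Closed : ℕ → Set
    Closed j = LongPart B X u w T U ⊎ ∃[ e ] Comps B X u (suc j) e × j ≤ u + (e * T + (1 + e) * U)

    closeFree : ∀ {s j e} → s < j → j ≤ w → Edges s j true → RunStart s → Comps B X u s e →
                s ≤ u + (e * T + (2 + e) * U) → RightEnd B X j 1 → Closed j
    closeFree {s} {j} {e} s<j j≤w es st cs le re with startEnd (<-≤-trans s<j j≤w) st
    ... | inj₁ free-end with s + T ≤? j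
    ...   | yes long = inj₁ (longComponent (start≤ st) j≤w (close s<j j≤w es (start≤ st) free-end re) long)
    ...   | no short = inj₂ (suc e , subst (Comps B X u (suc j)) (+-comm e 1)
                               (comps-append (start≤ st) (≤-trans (<⇒≤ s<j) (n≤1+n j)) cs
                                  (single ≤-refl (n<1+n j) (close s<j j≤w es (start≤ st) free-end re))) ,
                             addT (e * T) ((2 + e) * U) (<⇒≤ (≰⇒> short)) le)
    closeFree {s} {j} {e} s<j j≤w es st cs le re | inj₂ (refl , tied-end) with s + U ≤? j
    ...   | yes long = inj₁ (longTied ≤-refl j≤w (close s<j j≤w es ≤-refl tied-end re) ≤-refl long)
    ...   | no short = inj₂ (e , comps-weaken ≼-refl ≤-refl (≤-trans (<⇒≤ s<j) (n≤1+n j)) cs ,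
                             addU (e * T) (e * U) (<⇒≤ (≰⇒> short)) (m≤m+n u _))

    closeTied : ∀ {s e} → s < w → Edges s w true → RunStart s → Comps B X u s e → RightEnd B X w 2 →
                LongPart B X u w T U ⊎ w ≤ s + U
    closeTied {s} s<w es st cs re with s + U ≤? w
    ... | no short = inj₂ (<⇒≤ (≰⇒> short))
    ... | yes long with startEnd s<w st
    ...   | inj₁ le       = inj₁ (longTied (start≤ st) ≤-refl (close s<w ≤-refl es (start≤ st) le re) ≤-refl long)
    ...   | inj₂ (_ , le) = inj₁ (longTied (start≤ st) ≤-refl (close s<w ≤-refl es (start≤ st) le re) (s≤s (s≤s z≤n)) long)

    start : State (suc u)
    start with B u in Bu
    ... | true  = inRun ≤-refl (only Bu) (inj₁ refl) [] (m≤m+n u _)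
    ... | false = inGap ≤-refl (only Bu) ≤-refl (inj₁ refl) [] (m≤m+n u _)

    step : ∀ {j} → u < j → j < w → State j → LongPart B X u w T U ⊎ State (suc j)
    step {j} u<j j<w (inRun s<j es st cs le) with B j in Bj
    ... | true  = inj₂ (inRun (<-trans s<j ≤-refl) (extend es Bj) st cs le)
    ... | false with closeFree s<j (<⇒≤ j<w) es st cs le (free (Run.inner R j u<j j<w) Bj)
    ...   | inj₁ long = inj₁ long
    ...   | inj₂ (e , cs′ , le′) = inj₂ (inGap ≤-refl (only Bj) (<⇒≤ u<j) (inj₂ (lastEdge s<j es)) cs′ le′)
      where
        lastEdge : ∀ {s j} → s < j → Edges s j true → before B j ≡ true
        lastEdge {j = suc j} s<j es = es j (s≤s⁻¹ s<j) ≤-refl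
    step {j} u<j j<w (inGap {s} {e} s<j es u≤s st cs le) with B j in Bj
    ... | false = inj₂ (inGap (<-trans s<j ≤-refl) (extend es Bj) u≤s st cs le)
    ... | true with s + U ≤? j
    ...   | yes long = inj₁ (longGap (gap u≤s s<j (<⇒≤ j<w) es st (inj₂ Bj)) long)
    ...   | no short = inj₂ (inRun ≤-refl (only Bj) (inj₂ (u<j , lastEdge s<j es)) (comps-weaken ≼-refl ≤-refl s<j cs)
                               (addU (e * T) ((1 + e) * U) (<⇒≤ (≰⇒> short)) le))
      where
        lastEdge : ∀ {s j} → s < j → Edges s j false → before B j ≡ false
        lastEdge {j = suc j} s<j es = es j (s≤s⁻¹ s<j) ≤-refl

    walk : ∀ d → suc u + d ≤ w → LongPart B X u w T U ⊎ State (suc u + d)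
    walk zero    h = inj₂ (subst State (sym (+-identityʳ (suc u))) start)
    walk (suc d) h with walk d (≤-trans (+-monoʳ-≤ (suc u) (n≤1+n d)) h)
    ... | inj₁ long = inj₁ long
    ... | inj₂ st with step (m≤m+n (suc u) d) (≤-trans (≤-reflexive (sym (+-suc (suc u) d))) h) st
    ...   | inj₁ long = inj₁ long
    ...   | inj₂ st′  = inj₂ (subst State (sym (+-suc (suc u) d)) st′)

    Scanned : Set
    Scanned = LongPart B X u w T U ⊎ ∃[ e ] Comps B X u (suc w) e × w ≤ u + (e * T + (3 + e) * U)

    moreU : ∀ {e} c → w ≤ u + (e * T + c * U) → c ≤ 3 + e → w ≤ u + (e * T + (3 + e) * U)
    moreU {e} c le h = ≤-trans le (+-monoʳ-≤ u (+-monoʳ-≤ (e * T) (*-monoˡ-≤ U h)))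

    finish : State w → Scanned
    finish (inRun {s} {e} s<w es st cs le) with Run.right R
    ... | tied Xw with closeTied s<w es st cs (tied Xw)
    ...   | inj₁ long = inj₁ long
    ...   | inj₂ w≤ = inj₂ (e , comps-weaken ≼-refl ≤-refl (≤-trans (<⇒≤ s<w) (n≤1+n w)) cs , addU (e * T) ((2 + e) * U) w≤ le)
    finish (inRun {s} {e} s<w es st cs le) | free Xw Aw
      with closeFree s<w ≤-refl es st cs le (free Xw (≼-false B≼A w Aw))
    ...   | inj₁ long = inj₁ long
    ...   | inj₂ (e′ , cs′ , le′) = inj₂ (e′ , cs′ , moreU {e′} (1 + e′) le′ (+-monoˡ-≤ e′ {1} {3} (s≤s z≤n)))
    finish (inGap {s} {e} s<w es u≤s st cs le) with s + U ≤? w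
    ... | yes long = inj₁ (longGap (gap u≤s s<w ≤-refl es st (inj₁ refl)) long)
    ... | no short = inj₂ (e , comps-weaken ≼-refl ≤-refl (≤-trans s<w (n≤1+n w)) cs ,
                           moreU {e} (2 + e) (addU (e * T) ((1 + e) * U) (<⇒≤ (≰⇒> short)) le) (n≤1+n _))

  scan : LongPart B X u w T U ⊎ ∃[ e ] Comps B X u (suc w) e × w ≤ u + (e * T + (3 + e) * U)
  scan with walk (w ∸ suc u) (≤-reflexive eq)
    where
      eq : suc u + (w ∸ suc u) ≡ w
      eq = m+[n∸m]≡n (Run.nonempty R)
  ... | inj₁ long = inj₁ long
  ... | inj₂ st   = finish (subst State (m+[n∸m]≡n (Run.nonempty R)) st)

-- Density bounds

depends-mono : ∀ {n m X Y} {P : Vec (Fin n) m → ℕ} → X ≼ Y → DependsOn X P → DependsOn Y P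
depends-mono X≼Y dep = dependsOn (λ x y eq → agree⇒≡ dep x y (λ i e → eq i (include X≼Y _ e)))

depends-* : ∀ {n m X} {P Q : Vec (Fin n) m → ℕ} → DependsOn X P → DependsOn X Q → DependsOn X (λ x → P x * Q x)
depends-* dP dQ = dependsOn (λ x y eq → cong₂ _*_ (agree⇒≡ dP x y eq) (agree⇒≡ dQ x y eq))

Ω : ℕ → ℕ → Set
Ω n m = Vec (Fin n) m

module _ (n r m : ℕ) where

  -- Given any values on X, the density of P is at most c / r ^ F.
  record Bound (P : Ω n m → ℕ) (c : ℕ) (X : Line) (F : ℕ) : Set where
    constructor bounded
    field bound : ∀ z → mass X P z * r ^ F ≤ c * n ^ m

  -- All that the argument retains of a small pathset with a cost. Since r ^ 2 stands for ñ, `small`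
  -- is smallness for a union of `t` components, in a form that allows any fixed set `X` avoided by
  -- them.
  record Node : Set where
    field
      graph   : Line
      weight  : Ω n m → ℕ
      cost    : ℕ
      depends : DependsOn (ends graph) weight
      small   : ∀ {X lo hi t} → Comps graph X lo hi t → Bound weight 1 X (2 * t)

  -- Decompositions with functions in place of pathsets: a join becomes a product, a union a sum,
  -- and the covering becomes the pointwise inequality in `node`. The bound in a leaf is in terms of
  -- n itself, since a single edge with two unfixed ends has n ^ 2 possible values.
  data Forest (G : Line) : (Ω n m → ℕ) → ℕ → Set

  data Tree : Line → (Ω n m → ℕ) → ℕ → Set where
    leaf : ∀ {G P c} e → (∀ i → G i ≡ true → i ≡ e) →
           (∀ {X} → X e ≡ false → X (suc e) ≡ false → ∀ z → mass X P z * n ^ 2 ≤ c * n ^ m) → Tree G P c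
    node : ∀ {G P P′ c c′} → (∀ x → P x ≤ P′ x) → c′ ≤ c → Forest G P′ c′ → Tree G P c

  data Forest G where
    []   : Forest G (λ _ → 0) 0
    join : ∀ {P c} (B C : Node) → Covers G (Node.graph B) (Node.graph C) →
           Tree (Node.graph B) (Node.weight B) (Node.cost B) →
           Tree (Node.graph C) (Node.weight C) (Node.cost C) →
           Forest G P c →
           Forest G (λ x → Node.weight B x * Node.weight C x + P x) (Node.cost B + Node.cost C + c)

  -- Every component beside the run contributes r ^ 2, the run itself r ^ I provided that it is long for its number of tied ends.
  Claim : ℕ → ℕ → Line → (Ω n m → ℕ) → ℕ → Set
  Claim T I G P c = ∀ {X u w a b tL tR h} → Run G X u w a b → u + a * b * T ≤ w →
                    Comps G X 0 u tL → Comps G X (suc w) h tR → Bound P c X (2 * (tL + tR) + I)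

  ClaimAt : ℕ → ℕ → Node → Set
  ClaimAt T I B = Claim T I (Node.graph B) (Node.weight B) (Node.cost B)

  Joint : Node → Node → Line → ℕ → Set
  Joint B C X F = Bound (λ x → Node.weight B x * Node.weight C x) (Node.cost B + Node.cost C) X F

module Bounds {n r m : ℕ} (n>0 : 0 < n) (r>0 : 0 < r) where

  private
    instance
      n≢0 : NonZero n
      n≢0 = >-nonZero n>0
      r≢0 : NonZero r
      r≢0 = >-nonZero r>0

  open Node

  bound-mono : ∀ {P Q c X F} → (∀ x → P x ≤ Q x) → Bound n r m Q c X F → Bound n r m P c X F
  bound-mono {F = F} P≤Q (bounded h) = bounded (λ z → ≤-trans (*-monoˡ-≤ (r ^ F) (mass-mono _ P≤Q z)) (h z))

  bound-weaken : ∀ {P c c′ X F F′} → c ≤ c′ → F′ ≤ F → Bound n r m P c X F → Bound n r m P c′ X F′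
  bound-weaken {P} c≤c′ F′≤F (bounded h) =
    bounded (λ z → ≤-trans (*-monoʳ-≤ (mass _ P z) (^-monoʳ-≤ r F′≤F)) (≤-trans (h z) (*-monoˡ-≤ (n ^ m) c≤c′)))

  bound-0 : ∀ {X F} → Bound n r m (λ _ → 0) 0 X F
  bound-0 {X} {F} = bounded (λ z → ≤-reflexive (cong (_* r ^ F) (trans (mass-const X 0 z) (*-zeroʳ (n ^ m)))))

  bound-+ : ∀ {P Q c c′ X F} → Bound n r m P c X F → Bound n r m Q c′ X F →
            Bound n r m (λ x → P x + Q x) (c + c′) X F
  bound-+ {P} {Q} {c} {c′} {X} {F} (bounded hP) (bounded hQ) = bounded λ z → begin
    mass X (λ x → P x + Q x) z * r ^ F        ≡⟨ cong (_* r ^ F) (mass-+ X P Q z) ⟩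
    (mass X P z + mass X Q z) * r ^ F         ≡⟨ *-distribʳ-+ (r ^ F) (mass X P z) (mass X Q z) ⟩
    mass X P z * r ^ F + mass X Q z * r ^ F   ≤⟨ +-mono-≤ (hP z) (hQ z) ⟩
    c * n ^ m + c′ * n ^ m                    ≡⟨ sym (*-distribʳ-+ (n ^ m) c c′) ⟩
    (c + c′) * n ^ m ∎
    where open ≤-Reasoning

  -- All joins are estimated in this way: `P` given the values on `X`, and `Q` in the worst case
  -- given the values on the larger set `Y`, which determines `P`.
  bound-product : ∀ {P Q c c′ X Y F F′} → X ≼ Y → DependsOn Y P → Bound n r m P c X F → Bound n r m Q c′ Y F′ →
                  Bound n r m (λ x → P x * Q x) (c * c′) X (F + F′)
  bound-product {P} {Q} {c} {c′} {X} {Y} {F} {F′} X≼Y dep (bounded hP) (bounded hQ) = bounded λ z →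
    *-cancelʳ-≤ _ _ (n ^ m) (begin
      μ z * r ^ (F + F′) * N              ≡⟨ cong (λ ρ → μ z * ρ * N) (^-distribˡ-+-* r F F′) ⟩
      μ z * (r ^ F * r ^ F′) * N          ≡⟨ solve 4 (λ μ ρ σ N → μ :* (ρ :* σ) :* N := σ :* N :* μ :* ρ) refl (μ z) (r ^ F) (r ^ F′) N ⟩
      r ^ F′ * N * μ z * r ^ F            ≤⟨ *-monoˡ-≤ (r ^ F) (mass-product X Y P Q (r ^ F′) (c′ * N) X≼Y dep
                                               (λ z → ≤-trans (≤-reflexive (*-comm (r ^ F′) (mass Y Q z))) (hQ z)) z) ⟩
      mass X P z * (c′ * N) * r ^ F       ≡⟨ solve 3 (λ μ d ρ → μ :* d :* ρ := μ :* ρ :* d) refl (mass X P z) (c′ * N) (r ^ F) ⟩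
      mass X P z * r ^ F * (c′ * N)       ≤⟨ *-monoˡ-≤ (c′ * N) (hP z) ⟩
      c * N * (c′ * N)                    ≡⟨ solve 3 (λ c d N → c :* N :* (d :* N) := c :* d :* N :* N) refl c c′ N ⟩
      c * c′ * N * N ∎)
    where
      open ≤-Reasoning
      open +-*-Solver
      N = n ^ m
      instance
        N≢0 : NonZero N
        N≢0 = m^n≢0 n m
      μ = mass X (λ x → P x * Q x)

  bound-one : ∀ {X} → Bound n r m (λ _ → 1) 1 X 0
  bound-one {X} = bounded (λ z → ≤-reflexive (trans (*-identityʳ _) (trans (mass-const X 1 z) (*-comm (n ^ m) 1))))

  -- An average over more coordinates is at most the worst case over the fixed ones: this is the
  -- product bound with the constant 1 as first factor.
  bound-restrict : ∀ {P c X Y F} → X ≼ Y → Bound n r m P c Y F → Bound n r m P c X F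
  bound-restrict {P} {c} X≼Y h =
    bound-weaken (≤-reflexive (*-identityˡ c)) ≤-refl
      (bound-mono (λ x → ≤-reflexive (sym (*-identityˡ (P x)))) (bound-product X≼Y (dependsOn (λ _ _ _ → refl)) bound-one h))

  -- A bound free of charge improves when a cost is allowed: this is used for an expensive second
  -- factor, whose cost supplies the powers of r that smallness lacks.
  bound-trade : ∀ {P c X F s} → r ^ s ≤ c → Bound n r m P 1 X F → Bound n r m P c X (F + s)
  bound-trade {P} {c} {X} {F} {s} h (bounded hP) = bounded λ z → begin
    mass X P z * r ^ (F + s)       ≡⟨ cong (mass X P z *_) (^-distribˡ-+-* r F s) ⟩
    mass X P z * (r ^ F * r ^ s)   ≡⟨ sym (*-assoc (mass X P z) _ _) ⟩
    mass X P z * r ^ F * r ^ s     ≤⟨ *-mono-≤ (hP z) h ⟩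
    1 * n ^ m * c                  ≡⟨ cong (_* c) (*-identityˡ (n ^ m)) ⟩
    n ^ m * c                      ≡⟨ *-comm (n ^ m) c ⟩
    c * n ^ m ∎
    where open ≤-Reasoning

  -- The converse trade, for a cheap factor: part of its exponent is given up to get rid of its
  -- cost, and what is left holds free of charge.
  bound-cancel : ∀ {P c X F s} → c ≤ r ^ s → Bound n r m P c X (F + s) → Bound n r m P 1 X F
  bound-cancel {P} {c} {X} {F} {s} h (bounded hP) = bounded λ z → *-cancelʳ-≤ _ _ (r ^ s) {{m^n≢0 r s}} (begin
    mass X P z * r ^ F * r ^ s     ≡⟨ *-assoc (mass X P z) _ _ ⟩
    mass X P z * (r ^ F * r ^ s)   ≡⟨ cong (mass X P z *_) (sym (^-distribˡ-+-* r F s)) ⟩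
    mass X P z * r ^ (F + s)       ≤⟨ hP z ⟩
    c * n ^ m                      ≤⟨ *-monoˡ-≤ (n ^ m) h ⟩
    r ^ s * n ^ m                  ≡⟨ *-comm (r ^ s) (n ^ m) ⟩
    n ^ m * r ^ s                  ≡⟨ cong (_* r ^ s) (sym (*-identityˡ (n ^ m))) ⟩
    1 * n ^ m * r ^ s ∎)
    where open ≤-Reasoning

  small-pair : ∀ (B : Node n r m) {X lo u v hi tL tR} → Comps (graph B) X lo u tL → Comps (graph B) X v hi tR →
               lo ≤ u → u ≤ v → Bound n r m (weight B) 1 X (2 * (tL + tR))
  small-pair B {v = v} {hi = hi} csL csR l h =
    small B {hi = hi + v} (comps-append (≤-trans l h) (m≤n+m v hi)
      (comps-weaken ≼-refl ≤-refl h csL) (comps-weaken ≼-refl ≤-refl (m≤m+n hi v) csR))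

  joint-swap : ∀ {B C X F} → Joint n r m C B X F → Joint n r m B C X F
  joint-swap {B} {C} h = bound-weaken (≤-reflexive (+-comm (cost C) (cost B))) ≤-refl
                           (bound-mono (λ x → ≤-reflexive (*-comm (weight B x) (weight C x))) h)

  joint-left : ∀ {B C X F F′} → Bound n r m (weight B) (cost B) X F → Bound n r m (weight C) 1 (X ⊔ˡ ends (graph B)) F′ →
               Joint n r m B C X (F + F′)
  joint-left {B} {C} {X} hB hC =
    bound-weaken (≤-trans (≤-reflexive (*-identityʳ (cost B))) (m≤m+n (cost B) (cost C))) ≤-refl
      (bound-product ≼-⊔ˡ (depends-mono (≼-⊔ʳ {X}) (depends B)) hB hC)

  -- Charging the cost to `C` leaves only smallness for `B`. This is the form for gaps of `B`, where
  -- the long run belongs to `C`.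
  joint-right : ∀ {B C X F F′} → Bound n r m (weight B) 1 X F → Bound n r m (weight C) (cost C) (X ⊔ˡ ends (graph B)) F′ →
                Joint n r m B C X (F + F′)
  joint-right {B} {C} {X} hB hC =
    bound-weaken (≤-trans (≤-reflexive (*-identityˡ (cost C))) (m≤n+m (cost C) (cost B))) ≤-refl
      (bound-product ≼-⊔ˡ (depends-mono (≼-⊔ʳ {X}) (depends B)) hB hC)

  -- The components of `A` beside the run are split once and for all: `L₁ + R₁` of them contain
  -- components of `B`, and `L₂ + R₂` are components of `C` that miss `B`. Each is worth 2 in either
  -- case, so `Target F` only asks the window between `u` and `w` for the remaining `F`.
  module Window {A : Line} (B C : Node n r m) (cov : Covers A (graph B) (graph C))
                {X : Line} {u w a b : ℕ} (R : Run A X u w a b)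
                {tL tR h : ℕ} (csL : Comps A X 0 u tL) (csR : Comps A X (suc w) h tR) where

    private
      L₁ = proj₁ (comps-∪ cov csL)
      L₂ = proj₁ (proj₂ (comps-∪ cov csL))
      R₁ = proj₁ (comps-∪ cov csR)
      R₂ = proj₁ (proj₂ (comps-∪ cov csR))
      L≡ : tL ≡ L₁ + L₂
      L≡ = proj₁ (proj₂ (proj₂ (comps-∪ cov csL)))
      R≡ : tR ≡ R₁ + R₂
      R≡ = proj₁ (proj₂ (proj₂ (comps-∪ cov csR)))
      BL = proj₁ (proj₂ (proj₂ (proj₂ (comps-∪ cov csL))))
      CL = proj₂ (proj₂ (proj₂ (proj₂ (comps-∪ cov csL))))
      BR = proj₁ (proj₂ (proj₂ (proj₂ (comps-∪ cov csR))))
      CR = proj₂ (proj₂ (proj₂ (proj₂ (comps-∪ cov csR))))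
      u<w = Run.nonempty R

      exponent : ∀ e d → 2 * (tL + tR) + (2 * e + d) ≡ 2 * (L₁ + R₁ + e) + d + 2 * (L₂ + R₂)
      exponent e d =
        trans (cong₂ (λ a b → 2 * (a + b) + (2 * e + d)) L≡ R≡)
              (solve 6 (λ a b c f e d → con 2 :* ((a :+ b) :+ (c :+ f)) :+ (con 2 :* e :+ d) :=
                                        con 2 :* (a :+ c :+ e) :+ d :+ con 2 :* (b :+ f)) refl L₁ L₂ R₁ R₂ e d)
        where open +-*-Solver
      u≤sw : u ≤ suc w
      u≤sw = ≤-trans (<⇒≤ u<w) (n≤1+n w)

    Target : ℕ → Set
    Target = λ F → Joint n r m B C X (2 * (tL + tR) + F)

    target-weaken : ∀ {F F′} → F′ ≤ F → Target F → Target F′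
    target-weaken h = bound-weaken ≤-refl (+-monoʳ-≤ (2 * (tL + tR)) h)

    runTarget : ∀ {T d e₁ e₂ p q a′ b′} → ClaimAt n r m T d B → u ≤ p → q ≤ w → Run (graph B) X p q a′ b′ →
                p + a′ * b′ * T ≤ q → Comps (graph B) X u p e₁ → Comps (graph B) X (suc q) (suc w) e₂ →
                Target (2 * (e₁ + e₂) + d)
    runTarget {T} {d} {e₁} {e₂} {p} {q} claim u≤p q≤w S long cs₁ cs₂ =
      bound-weaken ≤-refl (≤-reflexive (trans (exponent (e₁ + e₂) d) (cong (λ k → 2 * k + d + 2 * (L₂ + R₂)) regroup)))
        (joint-left {B} {C} {F = 2 * (L₁ + e₁ + (e₂ + R₁)) + d} {F′ = 2 * (L₂ + R₂)}
          (claim S long (comps-append z≤n u≤p BL cs₁)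
            (comps-append {hi = h + suc w} (s≤s q≤w) (m≤n+m (suc w) h) cs₂ (comps-weaken ≼-refl ≤-refl (m≤m+n h (suc w)) BR)))
          (small-pair C CL CR z≤n u≤sw))
      where
        open +-*-Solver
        regroup : L₁ + R₁ + (e₁ + e₂) ≡ L₁ + e₁ + (e₂ + R₁)
        regroup = solve 4 (λ a c e f → a :+ c :+ (e :+ f) := a :+ e :+ (f :+ c)) refl L₁ R₁ e₁ e₂

    runTarget₀ : ∀ {T d p q a′ b′} → ClaimAt n r m T d B → u ≤ p → q ≤ w → Run (graph B) X p q a′ b′ →
                 p + a′ * b′ * T ≤ q → Target d
    runTarget₀ claim u≤p q≤w S long = runTarget claim u≤p q≤w S long [] []

    -- The long component may be one of the `e` counted ones. Then only `e` - 1 remain beside it,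
    -- and the 2 in `2 + d` makes up for the lost one.
    componentTarget : ∀ {T d e p q} → ClaimAt n r m T (2 + d) B → u ≤ p → q ≤ w → Component (graph B) X p q →
                      p + T ≤ q → Comps (graph B) X u (suc w) e → Target (2 * e + d)
    componentTarget {T} {d} {e} {p} {q} claim u≤p q≤w S long cs with comps-split cs S u≤p
    ... | e₁ , e₂ , cs₁ , cs₂ , le =
      target-weaken (enough le) (runTarget claim u≤p q≤w S (≤-trans (≤-reflexive (cong (p +_) (*-identityˡ T))) long) cs₁ cs₂)
      where
        e≤ : e ≤ suc (e₁ + e₂) → 2 * e + d ≤ 2 * (e₁ + e₂) + (2 + d)
        e≤ le = ≤-trans (+-monoˡ-≤ d (*-monoʳ-≤ 2 le))
                  (≤-reflexive (solve 2 (λ e d → con 2 :* (con 1 :+ e) :+ d := con 2 :* e :+ (con 2 :+ d)) refl (e₁ + e₂) d))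
          where open +-*-Solver
        enough : e ≤ e₁ + e₂ ⊎ _ → 2 * e + d ≤ 2 * (e₁ + e₂) + (2 + d)
        enough (inj₁ le)           = e≤ (≤-trans le (n≤1+n _))
        enough (inj₂ (_ , _ , le)) = e≤ le

    -- A tied run is not among the components, so all `e` remain beside it. The factor 4 is the
    -- largest possible value of `a′ * b′`.
    tiedTarget : ∀ {T d e p q a′ b′} → ClaimAt n r m T d B → u ≤ p → q ≤ w → Run (graph B) X p q a′ b′ →
                 2 ≤ a′ * b′ → p + 4 * T ≤ q → Comps (graph B) X u (suc w) e → Target (2 * e + d)
    tiedTarget {T} {d} {e} {p} {q} {a′} {b′} claim u≤p q≤w S two long cs with comps-split cs S u≤p
    ... | e₁ , e₂ , cs₁ , cs₂ , inj₁ le =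
      target-weaken (+-monoˡ-≤ d (*-monoʳ-≤ 2 le))
        (runTarget claim u≤p q≤w S
          (≤-trans (+-monoʳ-≤ p (*-monoˡ-≤ T (*-mono-≤ (left≤2 (Run.left S)) (right≤2 (Run.right S))))) long) cs₁ cs₂)
    ... | e₁ , e₂ , cs₁ , cs₂ , inj₂ (refl , refl , _) = ⊥-elim (<-irrefl refl two)

    -- With the vertices of `B` fixed, `C` has a run over the whole gap, possibly tied at both ends,
    -- which explains the 4. The cost goes to `C`, and `B` pays for its `e` components by smallness.
    gapTarget : ∀ {T d e p q} → ClaimAt n r m T d C → Gap (graph B) u w p q → p + 4 * T ≤ q →
                Comps (graph B) X u (suc w) e → Target (2 * e + d)
    gapTarget {T} {d} {e} {p} {q} claim g long cs with gap-run cov R g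
    ... | a′ , b′ , S =
      bound-weaken ≤-refl (≤-reflexive (trans (exponent e d) regroup))
        (joint-right {B} {C} {F = 2 * (L₁ + e + R₁)} {F′ = 2 * (L₂ + R₂) + d}
          (small-pair B (comps-append z≤n u≤sw BL cs) BR z≤n ≤-refl)
          (claim S (≤-trans (+-monoʳ-≤ p (*-monoˡ-≤ T (*-mono-≤ (left≤2 (Run.left S)) (right≤2 (Run.right S))))) long)
            (comps-weaken ≼-refl ≤-refl (Gap.u≤r g) CL)
            (comps-weaken ≼-refl (s≤s (Gap.r′≤w g)) ≤-refl CR)))
      where
        open +-*-Solver
        regroup : 2 * (L₁ + R₁ + e) + d + 2 * (L₂ + R₂) ≡ 2 * (L₁ + e + R₁) + (2 * (L₂ + R₂) + d)
        regroup = solve 5 (λ a c e d s → con 2 :* (a :+ c :+ e) :+ d :+ con 2 :* s := con 2 :* (a :+ e :+ c) :+ (con 2 :* s :+ d))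
                    refl L₁ R₁ e d (L₂ + R₂)

    -- Smallness alone, hence the cost 1: one component of `B` in the window is worth 2, whatever
    -- `C` does there.
    bothSmall : ∀ {p q} → u ≤ p → q ≤ w → Component (graph B) X p q →
                Bound n r m (λ x → weight B x * weight C x) 1 X (2 * (tL + tR) + 2)
    bothSmall {p} {q} u≤p q≤w S =
      bound-weaken ≤-refl (≤-reflexive (trans (exponent 1 0) regroup))
        (bound-product ≼-⊔ˡ (depends-mono (≼-⊔ʳ {X}) (depends B))
          (small-pair B (comps-append z≤n u≤sw BL (single u≤p (s≤s q≤w) S)) BR z≤n ≤-refl)
          (small-pair C CL CR z≤n u≤sw))
      where
        open +-*-Solver
        regroup : 2 * (L₁ + R₁ + 1) + 0 + 2 * (L₂ + R₂) ≡ 2 * (L₁ + 1 + R₁) + 2 * (L₂ + R₂)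
        regroup = solve 3 (λ a c s → con 2 :* (a :+ c :+ con 1) :+ con 0 :+ con 2 :* s := con 2 :* (a :+ con 1 :+ c) :+ con 2 :* s)
                    refl L₁ R₁ (L₂ + R₂)

-- Long runs

-- Eight times the length is worth one factor r, that is half a power of ñ: this is the exponent (1/6) log k.
thr : ℕ → ℕ
thr L = 8 ^ (L ∸ 2)

8^>0 : ∀ d → 0 < 8 ^ d
8^>0 d = m^n>0 8 d

scale-≤ : ∀ {a b} q → a ≤ b → a * q ≤ b * q
scale-≤ q a≤b = *-monoˡ-≤ q a≤b

scale-< : ∀ {a b q} → 0 < q → a < b → a * q < b * q
scale-< {a} {b} {suc q} _ a<b = *-monoˡ-< (suc q) a<b

RunInside : (B X : Line) → (u w T : ℕ) → Set
RunInside B X u w T = ∃[ r ] ∃[ r′ ] ∃[ a ] ∃[ b ] u ≤ r × r′ ≤ w × Run B X r r′ a b × r + a * b * T ≤ r′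

ComponentInside : (B X : Line) → (u w : ℕ) → Set
ComponentInside B X u w = ∃[ r ] ∃[ r′ ] u ≤ r × r′ ≤ w × Component B X r r′

-- p is the last edge of the first half if both ends are tied, and otherwise it lies next to a free end.
pick : ∀ {A X u w a b T} → Run A X u w a b → 0 < T → u + a * b * T ≤ w →
       ∃[ p ] u ≤ p × p < w × (∀ {B} → B ≼ A → B p ≡ true → RunInside B X u w T ⊎ ComponentInside B X u w)
pick {A} {X} {u} {w} {T = T} R@(run u<w es inn (free Xu Au) (free Xw Aw)) T>0 long = u , ≤-refl , u<w , choose
  where
    choose : ∀ {B} → B ≼ A → B u ≡ true → RunInside B X u w T ⊎ ComponentInside B X u w
    choose B≼A Bp with runAround B≼A R u ≤-refl u<w Bp
    ... | r , r′ , _ , _ , u≤r , _ , _ , r′≤w , S , inj₁ (_ , refl) , inj₁ (_ , refl) = inj₂ (r , r′ , u≤r , r′≤w , S)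
    ... | r , r′ , _ , _ , u≤r , _ , _ , r′≤w , S , inj₁ (_ , refl) , inj₂ (_ , refl) = inj₂ (r , r′ , u≤r , r′≤w , S)
    ... | r , r′ , _ , _ , u≤r , _ , _ , r′≤w , S , inj₂ (_ , refl) , inj₁ (_ , refl) = inj₂ (r , r′ , u≤r , r′≤w , S)
    ... | r , r′ , _ , _ , u≤r , _ , _ , r′≤w , S , inj₂ (_ , refl) , inj₂ (_ , refl) = inj₂ (r , r′ , u≤r , r′≤w , S)
pick {A} {X} {u} {w} {T = T} R@(run u<w es inn (free Xu Au) (tied Xw)) T>0 long = u , ≤-refl , u<w , choose
  where
    choose : ∀ {B} → B ≼ A → B u ≡ true → RunInside B X u w T ⊎ ComponentInside B X u w
    choose B≼A Bp with runAround B≼A R u ≤-refl u<w Bp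
    ... | r , r′ , _ , _ , u≤r , r≤u , _ , r′≤w , S , inj₂ (u<r , _) , _ = ⊥-elim (<-irrefl refl (<-≤-trans u<r r≤u))
    ... | r , r′ , _ , _ , u≤r , _ , _ , r′≤w , S , inj₁ (refl , refl) , inj₁ (refl , refl) = inj₁ (r , r′ , _ , _ , u≤r , r′≤w , S , long)
    ... | r , r′ , _ , _ , u≤r , _ , _ , r′≤w , S , inj₁ (_ , refl) , inj₂ (_ , refl) = inj₂ (r , r′ , u≤r , r′≤w , S)
pick {A} {X} {u} {suc w} {T = T} R@(run u<w es inn (tied Xu) (free Xw Aw)) T>0 long = w , s≤s⁻¹ u<w , ≤-refl , choose
  where
    choose : ∀ {B} → B ≼ A → B w ≡ true → RunInside B X u (suc w) T ⊎ ComponentInside B X u (suc w)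
    choose B≼A Bp with runAround B≼A R w (s≤s⁻¹ u<w) ≤-refl Bp
    ... | r , r′ , _ , _ , u≤r , _ , w<r′ , r′≤w , S , _ , inj₂ (r′<w , _) = ⊥-elim (<-irrefl refl (<-≤-trans w<r′ (s≤s⁻¹ r′<w)))
    ... | r , r′ , _ , _ , u≤r , _ , _ , r′≤w , S , inj₁ (refl , refl) , inj₁ (refl , refl) = inj₁ (r , r′ , _ , _ , u≤r , r′≤w , S , long)
    ... | r , r′ , _ , _ , u≤r , _ , _ , r′≤w , S , inj₂ (_ , refl) , inj₁ (_ , refl) = inj₂ (r , r′ , u≤r , r′≤w , S)
pick {A} {X} {u} {w} {T = suc t} R@(run u<w es inn (tied Xu) (tied Xw)) T>0 long = p , m≤m+n u _ , p<w , choose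
  where
    open +-*-Solver
    T = suc t
    p = u + (T + t)
    sp : suc p ≡ u + 2 * 1 * T
    sp = solve 2 (λ u t → con 1 :+ (u :+ (con 1 :+ t :+ t)) := u :+ con 2 :* con 1 :* (con 1 :+ t)) refl u t
    p<w : suc p ≤ w
    p<w = ≤-trans (≤-trans (≤-reflexive sp) (+-monoʳ-≤ u (*-monoˡ-≤ T {2} {4} (s≤s (s≤s z≤n))))) long
    choose : ∀ {B} → B ≼ A → B p ≡ true → RunInside B X u w T ⊎ ComponentInside B X u w
    choose B≼A Bp with runAround B≼A R p (m≤m+n u _) p<w Bp
    ... | r , r′ , _ , _ , u≤r , _ , _ , r′≤w , S , inj₂ (_ , refl) , inj₂ (_ , refl) = inj₂ (r , r′ , u≤r , r′≤w , S)
    ... | r , r′ , _ , _ , u≤r , _ , _ , r′≤w , S , inj₁ (refl , refl) , inj₁ (refl , refl) = inj₁ (r , r′ , _ , _ , u≤r , r′≤w , S , long)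
    ... | r , r′ , _ , _ , u≤r , _ , p<r′ , r′≤w , S , inj₁ (refl , refl) , inj₂ (_ , refl) =
      inj₁ (r , r′ , _ , _ , u≤r , r′≤w , S , ≤-trans (≤-reflexive (sym sp)) p<r′)
    ... | r , r′ , _ , _ , u≤r , r≤p , _ , r′≤w , S , inj₂ (_ , refl) , inj₁ (refl , refl) =
      inj₁ (r , r′ , _ , _ , u≤r , r′≤w , S , (begin
        r + 1 * 2 * T           ≤⟨ +-monoˡ-≤ _ (≤-trans r≤p (n≤1+n p)) ⟩
        suc p + 1 * 2 * T       ≡⟨ cong (_+ 1 * 2 * T) sp ⟩
        u + 2 * 1 * T + 1 * 2 * T ≡⟨ solve 2 (λ u T → u :+ con 2 :* con 1 :* T :+ con 1 :* con 2 :* T := u :+ con 2 :* con 2 :* T) refl u T ⟩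
        u + 2 * 2 * T           ≤⟨ long ⟩
        w ∎))
      where open ≤-Reasoning

-- The shape that escapes counting: a single component that fills the window up to gaps too short
-- for a claim about the other factor.
record Lone (B X : Line) (u w g : ℕ) : Set where
  constructor lone
  field
    {from to} : ℕ
    u≤from    : u ≤ from
    to≤w      : to ≤ w
    component : Component B X from to
    emptyˡ    : ∀ i → u ≤ i → i < from → B i ≡ false
    emptyʳ    : ∀ i → to ≤ i → i < w → B i ≡ false
    gapˡ      : from ≤ u + g
    gapʳ      : w ≤ to + g

runAround-component : ∀ {A B X u w} → B ≼ A → Component A X u w → ∀ p → u ≤ p → p < w → B p ≡ true →
                      ∃[ r ] ∃[ r′ ] u ≤ r × r ≤ p × p < r′ × r′ ≤ w × Component B X r r′
runAround-component B≼A R p u≤p p<w Bp with runAround B≼A R p u≤p p<w Bp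
... | r , r′ , _ , _ , l , l′ , h , h′ , S , inj₁ (_ , refl) , inj₁ (_ , refl) = r , r′ , l , l′ , h , h′ , S
... | r , r′ , _ , _ , l , l′ , h , h′ , S , inj₁ (_ , refl) , inj₂ (_ , refl) = r , r′ , l , l′ , h , h′ , S
... | r , r′ , _ , _ , l , l′ , h , h′ , S , inj₂ (_ , refl) , inj₁ (_ , refl) = r , r′ , l , l′ , h , h′ , S
... | r , r′ , _ , _ , l , l′ , h , h′ , S , inj₂ (_ , refl) , inj₂ (_ , refl) = r , r′ , l , l′ , h , h′ , S

module Steps {n r m : ℕ} (n>0 : 0 < n) (r>0 : 0 < r) where

  open Bounds {n} {r} {m} n>0 r>0
  open Node

  Upto : ℕ → Node n r m → Set
  Upto I B = ∀ L → L ≤ I → ClaimAt n r m (thr L) L B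

  module Looping {A : Line} (B C : Node n r m) (cov : Covers A (graph B) (graph C))
                 {X : Line} {u w a b : ℕ} (R : Run A X u w a b)
                 {tL tR h : ℕ} (csL : Comps A X 0 u tL) (csR : Comps A X (suc w) h tR)
                 (baseB : ClaimAt n r m 1 4 B) where

    open Window B C cov R csL csR

    -- The base claim already applies to a single edge, so one of the components is worth 4 in place
    -- of 2.
    baseTarget : ∀ {e} → Comps (graph B) X u (suc w) (suc e) → Target (2 * suc e + 2)
    baseTarget cs@(cons u≤p q<sw S _) =
      componentTarget baseB u≤p (s≤s⁻¹ q<sw) S (≤-trans (≤-reflexive (+-comm _ 1)) (Run.nonempty S)) cs

    stage : ∀ {T U e d} → ClaimAt n r m T (2 + d) B → ClaimAt n r m U d B → ClaimAt n r m U d C →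
            Comps (graph B) X u (suc w) e →
            Target (2 * e + d) ⊎ ∃[ e′ ] Comps (graph B) X u (suc w) e′ × w ≤ u + (e′ * T + (3 + e′) * (4 * U))
    stage {T} {U} claimT claimB claimC cs with scan (covers-≼ˡ cov) R T (4 * U)
    ... | inj₁ (longComponent l h S long) = inj₁ (componentTarget claimT l h S long cs)
    ... | inj₁ (longTied l h S two long)  = inj₁ (tiedTarget claimB l h S two long cs)
    ... | inj₁ (longGap g long)           = inj₁ (gapTarget claimC g long cs)
    ... | inj₂ more                       = inj₂ more

    private
      -- With q = 8 ^ (1 + d), components shorter than 64 q and gaps and tied runs shorter than 4 q,
      -- at most `suc e` components would account for a length of (80 + 68 e) q only, whereas the
      -- window has (320 + 128 e) q. So the scan has found a further component.
      refine : ∀ d e → Upto (5 + d) B → Upto (5 + d) C → Comps (graph B) X u (suc w) (suc e) →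
               u + (2 * suc e + 3) * 8 ^ (3 + d) ≤ w → Target (2 * suc e + (3 + d)) ⊎ Comps (graph B) X u (suc w) (2 + e)
      refine d e upB upC cs long
        with stage (upB (5 + d) ≤-refl) (upB (3 + d) (m≤n+m (3 + d) 2)) (upC (3 + d) (m≤n+m (3 + d) 2)) cs
      ... | inj₁ done = inj₁ done
      ... | inj₂ (e′ , cs′ , short) with e′ ≤? suc e
      ...   | no e′≰ = inj₂ (comps-take (2 + e) (≰⇒> e′≰) cs′)
      ...   | yes e′≤ = ⊥-elim (<-irrefl refl (≤-<-trans short (<-≤-trans (+-monoʳ-< u smaller) long)))
        where
          q = 8 ^ suc d
          open ≤-Reasoning
          open +-*-Solver
          smaller : e′ * 8 ^ (3 + d) + (3 + e′) * (4 * q) < (2 * suc e + 3) * 8 ^ (3 + d)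
          smaller = begin-strict
            e′ * 8 ^ (3 + d) + (3 + e′) * (4 * q)          ≤⟨ +-mono-≤ (*-monoˡ-≤ (8 ^ (3 + d)) e′≤) (*-monoˡ-≤ (4 * q) (+-monoʳ-≤ 3 e′≤)) ⟩
            suc e * (8 * (8 * q)) + (3 + suc e) * (4 * q)  ≡⟨ solve 2 (λ e q → (con 1 :+ e) :* (con 8 :* (con 8 :* q)) :+ (con 4 :+ e) :* (con 4 :* q)
                                                                 := (con 80 :+ con 68 :* e) :* q) refl e q ⟩
            (80 + 68 * e) * q
              <⟨ scale-< (8^>0 (suc d)) (+-mono-<-≤ {80} {320} (≤ᵇ⇒≤ 81 320 tt) (*-monoˡ-≤ e {68} {128} (≤ᵇ⇒≤ 68 128 tt))) ⟩
            (320 + 128 * e) * q                            ≡⟨ solve 2 (λ e q → (con 320 :+ con 128 :* e) :* q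
                                                                 := (con 2 :* (con 1 :+ e) :+ con 3) :* (con 8 :* (con 8 :* q))) refl e q ⟩
            (2 * suc e + 3) * (8 * (8 * q)) ∎

    -- If all parts are shorter than 8 ^ d, counting them gives one more component, which pays for parts shorter by a factor 64.
    loop : ∀ d e → Upto (2 + d) B → Upto (2 + d) C → Comps (graph B) X u (suc w) (suc e) →
           u + (2 * suc e + 3) * 8 ^ d ≤ w → Target (2 * suc e + d)
    -- Up to `d` = 2 the surplus of `baseTarget` is enough, so the recursion may go down by two
    -- levels at a time.
    loop 0 e upB upC cs long = target-weaken (+-monoʳ-≤ (2 * suc e) z≤n) (baseTarget cs)
    loop 1 e upB upC cs long = target-weaken (+-monoʳ-≤ (2 * suc e) (s≤s z≤n)) (baseTarget cs)
    loop 2 e upB upC cs long = baseTarget cs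
    loop (suc (suc (suc d))) e upB upC cs long = 
      [ (λ done → done)
      , (λ cs′ → target-weaken exponent≤
                   (loop (suc d) (suc e) (λ L l → upB L (≤-trans l (m≤n+m (3 + d) 2))) (λ L l → upC L (≤-trans l (m≤n+m (3 + d) 2)))
                     cs′ (≤-trans (+-monoʳ-≤ u shorter) long)))
      ]′ (refine d e upB upC cs long)
      where
        q = 8 ^ suc d
        open +-*-Solver
        shorter : (2 * (2 + e) + 3) * q ≤ (2 * suc e + 3) * (8 * (8 * q))
        shorter = ≤-trans (≤-reflexive (solve 2 (λ e q → (con 2 :* (con 2 :+ e) :+ con 3) :* q := (con 7 :+ con 2 :* e) :* q) refl e q))
                  (≤-trans (scale-≤ q (+-mono-≤ {7} {320} (≤ᵇ⇒≤ 7 320 tt) (*-monoˡ-≤ e {2} {128} (≤ᵇ⇒≤ 2 128 tt))))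
                    (≤-reflexive (solve 2 (λ e q → (con 320 :+ con 128 :* e) :* q := (con 2 :* (con 1 :+ e) :+ con 3) :* (con 8 :* (con 8 :* q))) refl e q)))
        exponent≤ : 2 * suc e + (3 + d) ≤ 2 * suc (suc e) + suc d
        exponent≤ = ≤-reflexive (solve 2 (λ e d → con 2 :* (con 1 :+ e) :+ (con 3 :+ d) := con 2 :* (con 2 :+ e) :+ (con 1 :+ d)) refl e d)

    -- A tied window has at least double length. A long component inside it is settled by the claim
    -- of the same level for the child `B`. Otherwise one component below 64 q and four gaps or tied
    -- runs below 4 q fill at most 80 q out of 128 q, so there is a second component, and `loop`
    -- takes over two levels lower.
    tiedLoop : ∀ y → ClaimAt n r m (thr (5 + y)) (5 + y) B → Upto (3 + y) B → Upto (3 + y) C →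
               Comps (graph B) X u (suc w) 1 → u + 2 * 8 ^ (3 + y) ≤ w → Target (5 + y)
    tiedLoop y claim upB upC cs long with stage claim (upB (3 + y) ≤-refl) (upC (3 + y) ≤-refl) cs
    ... | inj₁ done = done
    ... | inj₂ (e′ , cs′ , short) with e′ ≤? 1
    ...   | yes e′≤ = ⊥-elim (<-irrefl refl (≤-<-trans short (<-≤-trans (+-monoʳ-< u smaller) long)))
      where
        q = 8 ^ suc y
        open ≤-Reasoning
        open +-*-Solver
        smaller : e′ * 8 ^ (3 + y) + (3 + e′) * (4 * q) < 2 * 8 ^ (3 + y)
        smaller = begin-strict
          e′ * 8 ^ (3 + y) + (3 + e′) * (4 * q)   ≤⟨ +-mono-≤ (*-monoˡ-≤ (8 ^ (3 + y)) e′≤) (*-monoˡ-≤ (4 * q) (+-monoʳ-≤ 3 e′≤)) ⟩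
          1 * (8 * (8 * q)) + (3 + 1) * (4 * q)   ≡⟨ solve 1 (λ q → con 1 :* (con 8 :* (con 8 :* q)) :+ con 4 :* (con 4 :* q) := con 80 :* q) refl q ⟩
          80 * q                                  <⟨ scale-< (8^>0 (suc y)) (≤ᵇ⇒≤ 81 128 tt) ⟩
          128 * q                                 ≡⟨ solve 1 (λ q → con 128 :* q := con 2 :* (con 8 :* (con 8 :* q))) refl q ⟩
          2 * (8 * (8 * q)) ∎
    ...   | no e′≰ = loop (suc y) 1 upB upC (comps-take 2 (≰⇒> e′≰) cs′) (≤-trans (+-monoʳ-≤ u shorter) long)
      where
        q = 8 ^ suc y
        open +-*-Solver
        shorter : 7 * q ≤ 2 * (8 * (8 * q))
        shorter = ≤-trans (scale-≤ q (≤ᵇ⇒≤ 7 128 tt)) (≤-reflexive (solve 1 (λ q → con 128 :* q := con 2 :* (con 8 :* (con 8 :* q))) refl q))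

left≥1 : ∀ {G X u a} → LeftEnd G X u a → 1 ≤ a
left≥1 (free _ _) = ≤-refl
left≥1 (tied _)   = s≤s z≤n

right≥1 : ∀ {G X w b} → RightEnd G X w b → 1 ≤ b
right≥1 (free _ _) = ≤-refl
right≥1 (tied _)   = s≤s z≤n

comps-none : ∀ {G X lo hi t} → Comps G X lo hi t → (∀ p → lo ≤ p → p < hi → G p ≡ false) → t ≡ 0
comps-none []              none = refl
comps-none (cons l h c cs) none =
  ⊥-elim (true≢false (Run.edges c _ ≤-refl (Run.nonempty c)) (none _ l (<-trans (Run.nonempty c) h)))

one-edge : ∀ {G e X u w a b} → (∀ i → G i ≡ true → i ≡ e) → Run G X u w a b → u ≡ e × w ≡ suc u
one-edge {u = u} {w} only R = u≡e , w≡
  where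
    es = Run.edges R
    u<w = Run.nonempty R
    u≡e = only u (es u ≤-refl u<w)
    w≡ : w ≡ suc u
    w≡ with m≤n⇒m<n∨m≡n u<w
    ... | inj₂ eq   = sym eq
    ... | inj₁ su<w = ⊥-elim (1+n≢n (trans (only (suc u) (es (suc u) (n≤1+n u) su<w)) (sym u≡e)))

component-left : ∀ {G X p q r s} → Component G X p q → Component G X r s → ∀ i → p ≤ i → i < q → i < r → q < r
component-left {G} {X} {p} {q} {r} {s} (run _ es _ _ (free Xq Gq)) (run r<s es′ _ (free _ Gr) _) i p≤i i<q i<r
  with <-cmp q r
... | tri< q<r _ _ = q<r
... | tri≈ _ refl _ = ⊥-elim (true≢false (es′ q ≤-refl r<s) Gq)
... | tri> _ _ r<q = ⊥-elim (cut r i<r r<q Gr)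
  where
    cut : ∀ r → i < r → r < q → before G r ≡ false → ⊥
    cut (suc r) l h e = true≢false (es r (≤-trans p≤i (s≤s⁻¹ l)) (<-trans (n<1+n r) h)) e

none-lone : ∀ {A B C X u w g} → Covers A B C → Component A X u w → (∀ i → u ≤ i → i < w → B i ≡ false) → Lone C X u w g
none-lone {u = u} {w} {g} cov R none with component-∪ cov R
... | inj₁ (r , r′ , u≤r , r′≤w , S) =
  ⊥-elim (true≢false (Run.edges S r ≤-refl (Run.nonempty S)) (none r u≤r (<-≤-trans (Run.nonempty S) r′≤w)))
... | inj₂ S = lone ≤-refl ≤-refl (component-restrict ≼-⊔ˡ S)
                 (λ i l h → ⊥-elim (<-irrefl refl (≤-<-trans l h))) (λ i l h → ⊥-elim (<-irrefl refl (≤-<-trans l h)))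
                 (m≤m+n u g) (m≤m+n w g)

-- Base level and dichotomy for a piece

module Claims {n r m : ℕ} (n>0 : 0 < n) (r>0 : 0 < r) where

  open Bounds {n} {r} {m} n>0 r>0
  open Steps {n} {r} {m} n>0 r>0
  open Node

  module Base (r²≤n : r * r ≤ n) where

    basePiece : ∀ {A X u w a b tL tR h} (B C : Node n r m) → Covers A (graph B) (graph C) →
                ClaimAt n r m 1 4 B → ClaimAt n r m 1 4 C → Run A X u w a b → u + a * b * 1 ≤ w →
                Comps A X 0 u tL → Comps A X (suc w) h tR → Joint n r m B C X (2 * (tL + tR) + 4)
    basePiece {A} {X} {u} {w} B C cov claimB claimC R long csL csR with pick R (s≤s z≤n) long
    ... | p , u≤p , p<w , choose with graph B p in Bp
    ...   | true with choose (covers-≼ˡ cov) Bp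
    ...     | inj₁ (_ , _ , _ , _ , l , h , S , long′) = Window.runTarget₀ B C cov R csL csR claimB l h S long′
    ...     | inj₂ (_ , _ , l , h , S) =
      Window.runTarget₀ B C cov R csL csR claimB l h S (≤-trans (≤-reflexive (+-comm _ 1)) (Run.nonempty S))
    basePiece {A} {X} {u} {w} B C cov claimB claimC R long csL csR | p , u≤p , p<w , choose | false
      with choose (covers-≼ʳ cov) (trans (sym (trans (Covers.cover cov p) (cong (_∨ graph C p) Bp))) (Run.edges R p u≤p p<w))
    ... | inj₁ (_ , _ , _ , _ , l , h , S , long′) =
      joint-swap {B} {C} (Window.runTarget₀ C B (covers-swap cov) R csL csR claimC l h S long′)
    ... | inj₂ (_ , _ , l , h , S) =
      joint-swap {B} {C} (Window.runTarget₀ C B (covers-swap cov) R csL csR claimC l h S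
                            (≤-trans (≤-reflexive (+-comm _ 1)) (Run.nonempty S)))

    -- The starting exponent 4 is r ^ 4 ≤ n ^ 2. A run of length at least `a * b` that is a single
    -- edge has two free ends, so the bound of a leaf applies. A node inherits the claim because
    -- `pick` finds in one factor either a run meeting the same requirement or a component, which
    -- always meets it.
    baseTree : ∀ {G P c} → Tree n r m G P c → Claim n r m 1 4 G P c

    baseForest : ∀ {G P c X u w a b tL tR h} → Forest n r m G P c → Run G X u w a b → u + a * b * 1 ≤ w →
                 Comps G X 0 u tL → Comps G X (suc w) h tR → Bound n r m P c X (2 * (tL + tR) + 4)

    baseTree (leaf {G} {P} {c} e only cost≤) {X} {u} {w} {tL = tL} {tR} R long csL csR with one-edge only R
    ... | refl , refl with Run.left R | Run.right R
    ...   | tied _ | re = 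
      ⊥-elim (<-irrefl refl (<-≤-trans (+-monoʳ-< u (*-mono-≤ (*-mono-≤ {2} ≤-refl (right≥1 re)) ≤-refl))
        (≤-trans long (≤-reflexive (+-comm 1 u)))))
    ...   | free _ _ | tied _ = ⊥-elim (<-irrefl refl (<-≤-trans (+-monoʳ-< u {1} (s≤s (s≤s z≤n))) (≤-trans long (≤-reflexive (+-comm 1 u)))))
    ...   | free Xu _ | free Xw _ = subst (λ t → Bound n r m P c X (2 * t + 4)) (sym (cong₂ _+_ tL≡0 tR≡0)) (bounded bd)
      where
        none : ∀ p → p < u ⊎ suc u ≤ p → G p ≡ false
        none p away with G p in Gp
        ... | false = refl
        ... | true with only p Gp | away
        ...   | refl | inj₁ p<p = ⊥-elim (<-irrefl refl p<p)
        ...   | refl | inj₂ p<p = ⊥-elim (<-irrefl refl p<p)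
        tL≡0 : tL ≡ 0
        tL≡0 = comps-none csL (λ p _ h → none p (inj₁ h))
        tR≡0 : tR ≡ 0
        tR≡0 = comps-none csR (λ p l _ → none p (inj₂ (≤-trans (n≤1+n _) l)))
        r⁴≤n² : r ^ 4 ≤ n ^ 2
        r⁴≤n² = begin
          r ^ 4           ≡⟨ solve 1 (λ r → r :^ 4 := (r :* r) :* (r :* r)) refl r ⟩
          r * r * (r * r) ≤⟨ *-mono-≤ r²≤n r²≤n ⟩
          n * n           ≡⟨ solve 1 (λ n → n :* n := n :^ 2) refl n ⟩
          n ^ 2 ∎
          where
            open ≤-Reasoning
            open +-*-Solver
        bd : ∀ z → mass X P z * r ^ 4 ≤ c * n ^ m
        bd z = ≤-trans (*-monoʳ-≤ (mass X P z) r⁴≤n²) (cost≤ Xu Xw z)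
    baseTree (node P≤ c≤ F) R long csL csR = bound-mono P≤ (bound-weaken c≤ ≤-refl (baseForest F R long csL csR))

    baseForest []                      R long csL csR = bound-0
    baseForest (join B C cov tB tC F) R long csL csR =
      bound-+ (basePiece B C cov (baseTree tB) (baseTree tC) R long csL csR) (baseForest F R long csL csR)

  -- A gap of this length has room for a run with two tied ends at level `3 + y`, while two shorter
  -- ones take less than 8 ^ (2 + y) together.
  gapSize : ℕ → ℕ
  gapSize y = 4 * 8 ^ (1 + y)

  module Dichotomy {A : Line} (B C : Node n r m) (cov : Covers A (graph B) (graph C))
                   {X : Line} {u w : ℕ} (R : Component A X u w)
                   {tL tR h : ℕ} (csL : Comps A X 0 u tL) (csR : Comps A X (suc w) h tR)
                   (baseB : ClaimAt n r m 1 4 B) (y : ℕ) (upB : Upto (3 + y) B) (upC : Upto (3 + y) C)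
                   (long : u + 8 ^ (2 + y) ≤ w) where

    open Window B C cov R csL csR
    open Looping B C cov R csL csR baseB

    private
      two : Comps (graph B) X u (suc w) 2 → Target (5 + y)
      two cs = loop (1 + y) 1 upB upC cs (≤-trans (+-monoʳ-≤ u (scale-≤ (8 ^ (1 + y)) (≤ᵇ⇒≤ 7 8 tt))) long)

    -- Two components are worth 4 and `loop` adds `1 + y`, for which 7 of the 8 units 8 ^ (1 + y)
    -- suffice. One component beside a wide gap is worth 2, and the gap adds `3 + y` through `C`.
    -- What remains is no component, or one with narrow gaps on both sides.
    dichotomy : Target (5 + y) ⊎ (∀ i → u ≤ i → i < w → graph B i ≡ false) ⊎ Lone (graph B) X u w (gapSize y)
    dichotomy with findEdge≤ (graph B) (<⇒≤ (Run.nonempty R))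
    ... | inj₂ none = inj₂ (inj₁ none)
    ... | inj₁ (p , u≤p , p<w , Bp) with runAround-component (covers-≼ˡ cov) R p u≤p p<w Bp
    ...   | r₀ , r₁ , u≤r₀ , _ , _ , r₁≤w , S with findEdge≤ (graph B) u≤r₀ | findEdge≤ (graph B) r₁≤w
    ...     | inj₁ (i , u≤i , i<r₀ , Bi) | _ with runAround-component (covers-≼ˡ cov) R i u≤i (<-trans i<r₀ (<-≤-trans (Run.nonempty S) r₁≤w)) Bi
    ...       | s₀ , s₁ , u≤s₀ , s₀≤i , i<s₁ , s₁≤w , S′ =
      inj₁ (two (cons u≤s₀ (s≤s s₁≤w) S′ (single (component-left S′ S i s₀≤i i<s₁ i<r₀) (s≤s r₁≤w) S)))
    dichotomy | inj₁ (p , u≤p , p<w , Bp) | r₀ , r₁ , u≤r₀ , _ , _ , r₁≤w , S | inj₂ noneˡ | inj₁ (i , r₁≤i , i<w , Bi)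
      with runAround-component (covers-≼ˡ cov) R i (≤-trans u≤r₀ (≤-trans (<⇒≤ (Run.nonempty S)) r₁≤i)) i<w Bi
    ... | s₀ , s₁ , u≤s₀ , s₀≤i , i<s₁ , s₁≤w , S′ = inj₁ (two (cons u≤r₀ (s≤s r₁≤w) S (single r₁<s₀ (s≤s s₁≤w) S′)))
      where
        r₁<s₀ : r₁ < s₀
        r₁<s₀ with component-run S S′
        ... | inj₁ r₁<s₀ = r₁<s₀
        ... | inj₂ (inj₁ s₁<r₀) = ⊥-elim (<-irrefl refl (<-≤-trans i<s₁ (≤-trans (<⇒≤ s₁<r₀) (≤-trans (<⇒≤ (Run.nonempty S)) r₁≤i))))
        ... | inj₂ (inj₂ (_ , s₁≤r₁ , _)) = ⊥-elim (<-irrefl refl (<-≤-trans i<s₁ (≤-trans s₁≤r₁ r₁≤i)))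
    dichotomy | inj₁ (p , u≤p , p<w , Bp) | r₀ , r₁ , u≤r₀ , _ , _ , r₁≤w , S | inj₂ noneˡ | inj₂ noneʳ
      with u + gapSize y ≤? r₀ | r₁ + gapSize y ≤? w
    ... | yes wide | _ = inj₁ (gapTarget (upC (3 + y) ≤-refl)
            (gap ≤-refl (<-≤-trans (m<m+n u (scale-< {0} {4} (8^>0 (1 + y)) (s≤s z≤n))) wide) (≤-trans (<⇒≤ (Run.nonempty S)) r₁≤w)
                 noneˡ (inj₁ refl) (inj₂ (Run.edges S r₀ ≤-refl (Run.nonempty S)))) wide
            (single u≤r₀ (s≤s r₁≤w) S))
    ... | no _ | yes wide = inj₁ (gapTarget (upC (3 + y) ≤-refl)
            (gap (≤-trans u≤r₀ (<⇒≤ (Run.nonempty S))) (<-≤-trans (m<m+n r₁ (scale-< {0} {4} (8^>0 (1 + y)) (s≤s z≤n))) wide) ≤-refl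
                 noneʳ (inj₂ (lastEdge (Run.nonempty S) (Run.edges S))) (inj₁ refl)) wide
            (single u≤r₀ (s≤s r₁≤w) S))
      where
        lastEdge : ∀ {r₁} → r₀ < r₁ → (∀ i → r₀ ≤ i → i < r₁ → graph B i ≡ true) → before (graph B) r₁ ≡ true
        lastEdge {suc r₁} l es = es r₁ (s≤s⁻¹ l) ≤-refl
    ... | no narrowˡ | no narrowʳ = inj₂ (inj₂ (lone u≤r₀ r₁≤w S noneˡ noneʳ (<⇒≤ (≰⇒> narrowˡ)) (<⇒≤ (≰⇒> narrowʳ))))

-- Descent

-- In the window `G` is this component and nothing else; `stopˡ` and `stopʳ` exclude edges that
-- enter from outside. Hence fixing the vertices of `G` fixes just the interval from `p` to `q` of
-- the window.
record Inside (G X : Line) (u w p q : ℕ) : Set where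
  constructor inside
  field
    u≤p    : u ≤ p
    q≤w    : q ≤ w
    comp   : Component G X p q
    noneˡ  : ∀ i → u ≤ i → i < p → G i ≡ false
    noneʳ  : ∀ i → q ≤ i → i < w → G i ≡ false
    stopˡ  : before G u ≡ false
    stopʳ  : G w ≡ false

inside-lone : ∀ {G D X u w p q g} → D ≼ G → Inside G X u w p q → (L : Lone D X p q g) →
              Inside D X u w (Lone.from L) (Lone.to L)
inside-lone {G} {D} {u = u} {w} {p} {q} D≼G (inside u≤p q≤w c nl nr sl sr) (lone p≤r s≤q S el er _ _) =
  inside (≤-trans u≤p p≤r) (≤-trans s≤q q≤w) S nl′ nr′ (≼-false (before-mono D≼G) u sl) (≼-false D≼G w sr)
  where
    nl′ : ∀ i → u ≤ i → i < _ → D i ≡ false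
    nl′ i l h with i <? p
    ... | yes i<p = ≼-false D≼G i (nl i l i<p)
    ... | no  i≮p = el i (≮⇒≥ i≮p) h
    nr′ : ∀ i → _ ≤ i → i < w → D i ≡ false
    nr′ i l h with i <? q
    ... | yes i<q = er i l i<q
    ... | no  i≮q = ≼-false D≼G i (nr i (≮⇒≥ i≮q) h)

covers-⊔ : ∀ {G K} → Covers (G ⊔ˡ K) G K
covers-⊔ = covers (λ i → refl)

-- In the descent the carried graph `K` stays with the child that is followed, so the components of
-- `J` are divided between `B ⊔ˡ K` and the sibling `C`.
covers-move : ∀ {J G K B C} → Covers J G K → Covers G B C → Covers J (B ⊔ˡ K) C
covers-move {J} {G} {K} {B} {C} cJ cG = covers λ i → trans (Covers.cover cJ i) (trans (cong (_∨ K i) (Covers.cover cG i)) (swap (B i) (C i) (K i)))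
  where
    swap : ∀ b c k → (b ∨ c) ∨ k ≡ (b ∨ k) ∨ c
    swap true  _     _     = refl
    swap false true  true  = refl
    swap false true  false = refl
    swap false false true  = refl
    swap false false false = refl

module Top {n r m : ℕ} (n>0 : 0 < n) (r>0 : 0 < r) (r²≤n : r * r ≤ n) where

  open Bounds {n} {r} {m} n>0 r>0
  open Steps {n} {r} {m} n>0 r>0
  open Claims {n} {r} {m} n>0 r>0
  open Base r²≤n
  open Node

  Exactly Below : ℕ → Set
  Exactly L = ∀ {G P c} → Tree n r m G P c → Claim n r m (thr L) L G P c
  Below I = ∀ L → L ≤ I → Exactly L

  upto : ∀ {I} (B : Node n r m) → Tree n r m (graph B) (weight B) (cost B) → Below (suc I) → Upto I B
  upto B tB low L l = low L (≤-trans l (n≤1+n _)) tB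

  -- `Y` stands for `X` together with the vertices of the descendant at which the descent stops: in
  -- the window it is confined to a short interval. The bound is free of charge and beats smallness
  -- by one factor r.
  Slices : ℕ → Line → (Ω n m → ℕ) → Line → ℕ → ℕ → Set
  Slices y K ρ X u w = ∀ {Y p q tL tR h} → X ≼ Y → u ≤ p → p < q → q ≤ w → q ≤ p + 2 * 8 ^ (2 + y) →
    Y p ≡ true → Y q ≡ true → (∀ v → u ≤ v → v < p → Y v ≡ false) → (∀ v → q < v → v ≤ w → Y v ≡ false) →
    Comps K Y 0 u tL → Comps K Y (suc w) h tR → Bound n r m ρ 1 Y (2 * (tL + tR) + 1)

  module Descent {K : Line} {ρ : Ω n m → ℕ} (ρ-depends : DependsOn (ends K) ρ)
                 (ρ-small : ∀ {Y tL tR u v h} → u ≤ v → Comps K Y 0 u tL → Comps K Y v h tR → Bound n r m ρ 1 Y (2 * (tL + tR)))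
                 {X : Line} {u w : ℕ} (X-free : ∀ v → u ≤ v → v ≤ w → X v ≡ false)
                 (y : ℕ) (low : Below (4 + y)) (slices : Slices y K ρ X u w) where

    private
      θ = 2 * 8 ^ (2 + y)

    -- The carried weight `ρ` multiplies every weight on the way down, but only the cost of `P` is
    -- charged. The counted components are those of the current union `J`; components lost on the
    -- way are paid for by the siblings.
    Goal : Line → (Ω n m → ℕ) → ℕ → Set
    Goal G P c = ∀ {J p q tL tR h} → Covers J G K → Inside G X u w p q → p + 8 ^ (2 + y) ≤ q →
                 Comps J X 0 u tL → Comps J X (suc w) h tR → Bound n r m (λ x → P x * ρ x) c X (2 * (tL + tR) + (5 + y))

    GoalAt : Node n r m → Set
    GoalAt B = Goal (graph B) (weight B) (cost B)

    regroup : ∀ a b c d i j → 2 * ((a + c) + (b + d)) + (i + j) ≡ (2 * (a + b) + i) + (2 * (c + d) + j)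
    regroup = solve 6 (λ a b c d i j → con 2 :* ((a :+ c) :+ (b :+ d)) :+ (i :+ j) := (con 2 :* (a :+ b) :+ i) :+ (con 2 :* (c :+ d) :+ j)) refl
      where open +-*-Solver

    regroup₀ : ∀ a b c d → 2 * ((a + c) + (b + d)) + (5 + y) ≡ (2 * (a + b) + (5 + y)) + 2 * (c + d)
    regroup₀ a b c d = solve 5 (λ a b c d i → con 2 :* ((a :+ c) :+ (b :+ d)) :+ i := (con 2 :* (a :+ b) :+ i) :+ con 2 :* (c :+ d)) refl a b c d (5 + y)
      where open +-*-Solver

    -- The run is still long enough for level `4 + y`, and short enough for `slices`, which supplies
    -- the one factor r that is missing.
    stop : ∀ {G P c} → Tree n r m G P c → DependsOn (ends G) P → ∀ {J p q tL tR h} → Covers J G K → Inside G X u w p q →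
           p + 8 ^ (2 + y) ≤ q → q ≤ p + θ → Comps J X 0 u tL → Comps J X (suc w) h tR →
           Bound n r m (λ x → P x * ρ x) c X (2 * (tL + tR) + (5 + y))
    stop {G} {P} {c} t dep {p = p} {q} cov (inside u≤p q≤w S nl nr sl sr) long short csL csR with comps-∪ cov csL | comps-∪ cov csR
    ... | a , c₁ , refl , as , cs | b , d , refl , bs , ds =
      bound-weaken (≤-reflexive (*-identityʳ c)) (≤-reflexive (trans (cong (2 * ((a + c₁) + (b + d)) +_) (+-comm 1 (4 + y))) (regroup a b c₁ d (4 + y) 1)))
        (bound-product ≼-⊔ˡ (depends-mono (≼-⊔ʳ {X}) dep)
          (low (4 + y) ≤-refl t S (≤-trans (≤-reflexive (cong (p +_) (*-identityˡ (8 ^ (2 + y))))) long)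
            (comps-weaken ≼-refl ≤-refl u≤p as) (comps-weaken ≼-refl (s≤s q≤w) ≤-refl bs))
          (slices ≼-⊔ˡ u≤p (Run.nonempty S) q≤w short
            (∨-trueʳ {X p} (∨-trueʳ {before G p} (Run.edges S p ≤-refl (Run.nonempty S))))
            (∨-trueʳ {X q} (∨-trueˡ (lastEdge (Run.nonempty S) (Run.edges S))))
            (λ v l h → ∨-false (X-free v l (<⇒≤ (<-trans h p<w))) (∨-false (beforeˡ v l h) (nl v l h)))
            (λ v l h → ∨-false (X-free v (≤-trans u≤p (≤-trans (<⇒≤ (Run.nonempty S)) (<⇒≤ l))) h) (∨-false (beforeʳ v l h) (atʳ v l h)))
            cs ds))
      where
        p<w : p < w
        p<w = <-≤-trans (Run.nonempty S) q≤w
        lastEdge : ∀ {q} → p < q → (∀ i → p ≤ i → i < q → G i ≡ true) → before G q ≡ true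
        lastEdge {suc q} l es = es q (s≤s⁻¹ l) ≤-refl
        beforeˡ : ∀ v → u ≤ v → v < p → before G v ≡ false
        beforeˡ v l h with m≤n⇒m<n∨m≡n l
        ... | inj₂ refl = sl
        beforeˡ (suc v) l h | inj₁ u<v = nl v (s≤s⁻¹ u<v) (<-trans (n<1+n v) h)
        beforeʳ : ∀ v → q < v → v ≤ w → before G v ≡ false
        beforeʳ (suc v) l h = nr v (s≤s⁻¹ l) h
        atʳ : ∀ v → q < v → v ≤ w → G v ≡ false
        atʳ v l h with m≤n⇒m<n∨m≡n h
        ... | inj₂ refl = sr
        ... | inj₁ v<w  = nr v (<⇒≤ l) v<w

    -- If the two children alone reach `5 + y`, the carried factor only has to pay for the
    -- components that miss `G`, and smallness does that.
    win : ∀ (B C : Node n r m) {G a b c d h} → Covers G (graph B) (graph C) → u ≤ suc w →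
          Joint n r m B C X (2 * (a + b) + (5 + y)) →
          Comps K (X ⊔ˡ ends G) 0 u c → Comps K (X ⊔ˡ ends G) (suc w) h d →
          Bound n r m (λ x → weight B x * weight C x * ρ x) (cost B + cost C) X (2 * ((a + c) + (b + d)) + (5 + y))
    win B C {G} {a} {b} {c} {d} covG u≤w joint cs ds =
      bound-weaken (≤-reflexive (*-identityʳ _)) (≤-reflexive (regroup₀ a b c d))
        (bound-product ≼-⊔ˡ
          (depends-* (depends-mono (≼-trans (ends-mono (covers-≼ˡ covG)) (≼-⊔ʳ {X})) (depends B))
                     (depends-mono (≼-trans (ends-mono (covers-≼ʳ covG)) (≼-⊔ʳ {X})) (depends C)))
          joint (ρ-small u≤w cs ds))

    -- The cost goes to the followed child, together with the carried factor. The sibling is bounded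
    -- last, with the vertices of both fixed, and pays by smallness for the components that miss
    -- them.
    follow : ∀ (B C : Node n r m) {G J p q tL tR h} → Covers J G K → Covers G (graph B) (graph C) → GoalAt B →
             Inside G X u w p q → p + θ < q → Lone (graph B) X p q (gapSize y) →
             Comps J X 0 u tL → Comps J X (suc w) h tR →
             Bound n r m (λ x → weight B x * weight C x * ρ x) (cost B + cost C) X (2 * (tL + tR) + (5 + y))
    follow B C {G} {p = p} {q} covJ covG goal I long L csL csR
      with comps-∪ (covers-move covJ covG) csL | comps-∪ (covers-move covJ covG) csR
    ... | a , c , refl , as , cs | b , d , refl , bs , ds =
      bound-weaken (≤-trans (≤-reflexive (*-identityʳ (cost B))) (m≤m+n (cost B) (cost C)))
        (≤-reflexive (regroup₀ a b c d))
        (bound-mono (λ x → ≤-reflexive (solve 3 (λ b c k → b :* c :* k := b :* k :* c) refl (weight B x) (weight C x) (ρ x)))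
          (bound-product ≼-⊔ˡ
            (depends-* (depends-mono (≼-trans (ends-mono (incl (λ v e → ∨-trueˡ e))) (≼-⊔ʳ {X})) (depends B))
                       (depends-mono (≼-trans (ends-mono (incl (λ v e → ∨-trueʳ {graph B v} e))) (≼-⊔ʳ {X})) ρ-depends))
            (goal covers-⊔ (inside-lone (covers-≼ˡ covG) I L) longer as bs)
            (small-pair C cs ds z≤n u≤w)))
      where
        open +-*-Solver
        open Inside I
        u≤w : u ≤ suc w
        u≤w = ≤-trans u≤p (≤-trans (<⇒≤ (Run.nonempty comp)) (≤-trans q≤w (n≤1+n w)))
        T = 8 ^ (1 + y)
        -- A step costs at most two gaps, that is 8 ^ (2 + y) or half of `θ`, so a run longer than
        -- `θ` cannot drop below the length needed by `stop`.
        longer : Lone.from L + 8 ^ (2 + y) ≤ Lone.to L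
        longer = +-cancelʳ-≤ (gapSize y) _ _ (begin
          Lone.from L + 8 * T + 4 * T  ≤⟨ +-monoˡ-≤ (4 * T) (+-monoˡ-≤ (8 * T) (Lone.gapˡ L)) ⟩
          p + 4 * T + 8 * T + 4 * T    ≡⟨ solve 2 (λ p T → p :+ con 4 :* T :+ con 8 :* T :+ con 4 :* T := p :+ con 2 :* (con 8 :* T)) refl p T ⟩
          p + 2 * (8 * T)              ≤⟨ <⇒≤ long ⟩
          q                            ≤⟨ Lone.gapʳ L ⟩
          Lone.to L + 4 * T ∎)
          where open ≤-Reasoning

    piece : ∀ (B C : Node n r m) {G J p q tL tR h} → Covers J G K → Covers G (graph B) (graph C) →
            Tree n r m (graph B) (weight B) (cost B) → Tree n r m (graph C) (weight C) (cost C) → GoalAt B → GoalAt C →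
            Inside G X u w p q → p + θ < q → Comps J X 0 u tL → Comps J X (suc w) h tR →
            Bound n r m (λ x → weight B x * weight C x * ρ x) (cost B + cost C) X (2 * (tL + tR) + (5 + y))
    piece B C {G} {p = p} {q} covJ covG tB tC goalB goalC I@(inside u≤p q≤w S _ _ _ _) long csL csR
      with comps-∪ covJ csL | comps-∪ covJ csR
    ... | a , c , refl , as , cs | b , d , refl , bs , ds
      with Dichotomy.dichotomy B C covG S (comps-weaken ≼-refl ≤-refl u≤p as) (comps-weaken ≼-refl (s≤s q≤w) ≤-refl bs)
             (baseTree tB) y (upto B tB low) (upto C tC low) long′
         | Dichotomy.dichotomy C B (covers-swap covG) S (comps-weaken ≼-refl ≤-refl u≤p as) (comps-weaken ≼-refl (s≤s q≤w) ≤-refl bs)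
             (baseTree tC) y (upto C tC low) (upto B tB low) long′
      where
        long′ : p + 8 ^ (2 + y) ≤ q
        long′ = ≤-trans (+-monoʳ-≤ p (m≤n*m (8 ^ (2 + y)) 2)) (<⇒≤ long)
    ...   | inj₁ joint | _ = win B C {a = a} {b} covG u≤w joint cs ds
      where u≤w = ≤-trans u≤p (≤-trans (<⇒≤ (Run.nonempty S)) (≤-trans q≤w (n≤1+n w)))
    ...   | inj₂ _ | inj₁ joint = win B C {a = a} {b} covG u≤w (joint-swap {B} {C} joint) cs ds
      where u≤w = ≤-trans u≤p (≤-trans (<⇒≤ (Run.nonempty S)) (≤-trans q≤w (n≤1+n w)))
    ...   | inj₂ (inj₂ L)    | inj₂ _ = follow B C covJ covG goalB I long L csL csR
    -- `B` has no edge on the run, so `C` has all of it and is the child to follow.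
    ...   | inj₂ (inj₁ none) | inj₂ _ =
      bound-weaken (≤-reflexive (+-comm (cost C) (cost B))) ≤-refl
        (bound-mono (λ x → ≤-reflexive (cong (_* ρ x) (*-comm (weight B x) (weight C x))))
          (follow C B covJ (covers-swap covG) goalC I long (none-lone covG S none) csL csR))

    descendTree : ∀ {G P c} → Tree n r m G P c → DependsOn (ends G) P → Goal G P c

    descendForest : ∀ {G P c J p q tL tR h} → Forest n r m G P c → Covers J G K → Inside G X u w p q → p + θ < q →
                    Comps J X 0 u tL → Comps J X (suc w) h tR → Bound n r m (λ x → P x * ρ x) c X (2 * (tL + tR) + (5 + y))

    descendTree t dep {p = p} {q} cov I long csL csR with q ≤? p + θ
    ... | yes short = stop t dep cov I long short csL csR
    -- A run of a leaf has length 1, below `θ`, so the descent has stopped before.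
    descendTree (leaf e only _) dep {p = p} {q} cov I long csL csR | no ¬short =
      ⊥-elim (<-irrefl refl (<-≤-trans (≰⇒> ¬short) (≤-trans (≤-reflexive (trans (proj₂ (one-edge only (Inside.comp I))) (+-comm 1 p)))
        (+-monoʳ-≤ p (*-mono-≤ {1} {2} (s≤s z≤n) (8^>0 (2 + y)))))))
    descendTree (node P≤ c≤ F) dep cov I long csL csR | no ¬short =
      bound-mono (λ x → *-monoˡ-≤ (ρ x) (P≤ x)) (bound-weaken c≤ ≤-refl (descendForest F cov I (≰⇒> ¬short) csL csR))

    descendForest []                      cov I long csL csR = bound-0
    descendForest (join {P} B C covG tB tC F) cov I long csL csR =
      bound-mono (λ x → ≤-reflexive (*-distribʳ-+ (ρ x) (weight B x * weight C x) (P x)))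
        (bound-+ (piece B C cov covG tB tC (descendTree tB (depends B)) (descendTree tC (depends C)) I long csL csR)
                 (descendForest F cov I long csL csR))

  -- A run of length 8 T, up to gaps of total length T, sticks out by 2 T on one side of any interval of length 2 T.
  lone-slices : ∀ y {K ρ c X u w} → Claim n r m (8 ^ (2 + y)) (4 + y) K ρ c → c ≤ r ^ (3 + y) → u + 8 ^ (3 + y) ≤ w →
                Lone K X u w (gapSize y) → Slices y K ρ X u w
  lone-slices y {K} {ρ} {c} {X} {u} {w} claim cheap long (lone {s} {e} u≤s e≤w S _ _ gapˡ gapʳ) {Y} {p} {q} {tL} {tR} {h}
              X≼Y u≤p p<q q≤w narrow Yp Yq Yˡ Yʳ csL csR = bound-cancel {s = 3 + y} cheap
                -- Of the exponent `4 + y` from the claim, `3 + y` cancels the cost, and one factor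
                -- r is left.
                (bound-weaken ≤-refl (≤-reflexive (solve 2 (λ t y → con 2 :* t :+ con 1 :+ (con 3 :+ y) := con 2 :* t :+ (con 4 :+ y)) refl (tL + tR) y)) side)
    where
      open +-*-Solver
      T = 8 ^ (2 + y)
      V = 8 ^ (1 + y)
      s<e : s < e
      s<e = Run.nonempty S
      apply : ∀ {p′ q′ a b} → u ≤ p′ → q′ ≤ w → Run K Y p′ q′ a b → p′ + a * b * T ≤ q′ → Bound n r m ρ c Y (2 * (tL + tR) + (4 + y))
      apply l h′ R′ long′ = claim R′ long′ (comps-weaken ≼-refl ≤-refl l csL) (comps-weaken ≼-refl (s≤s h′) ≤-refl csR)
      spread : s + 7 * T ≤ e
      spread = +-cancelʳ-≤ (4 * V) _ _ (begin
        s + 7 * (8 * V) + 4 * V        ≤⟨ +-monoˡ-≤ (4 * V) (+-monoˡ-≤ (7 * (8 * V)) gapˡ) ⟩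
        u + 4 * V + 7 * (8 * V) + 4 * V ≡⟨ solve 2 (λ u V → u :+ con 4 :* V :+ con 7 :* (con 8 :* V) :+ con 4 :* V := u :+ con 8 :* (con 8 :* V)) refl u V ⟩
        u + 8 * (8 * V)                ≤⟨ long ⟩
        w                              ≤⟨ gapʳ ⟩
        e + 4 * V ∎)
        where open ≤-Reasoning
      whole : (∀ v → s ≤ v → v ≤ e → Y v ≡ false) → Bound n r m ρ c Y (2 * (tL + tR) + (4 + y))
      whole off = apply u≤s e≤w
        (run s<e (Run.edges S) (λ v l h → off v (<⇒≤ l) (<⇒≤ h)) (startsFree (Run.left S)) (endsFree (Run.right S)))
        (≤-trans (+-monoʳ-≤ s (*-monoˡ-≤ T {1} {7} (s≤s z≤n))) spread)
        where
          startsFree : LeftEnd K X s 1 → LeftEnd K Y s 1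
          startsFree (free _ Ks) = free (off s ≤-refl (<⇒≤ s<e)) Ks
          endsFree : RightEnd K X e 1 → RightEnd K Y e 1
          endsFree (free _ Ke) = free (off e (<⇒≤ s<e) ≤-refl) Ke
      leftPart : s + 2 * T ≤ p → p ≤ e → Bound n r m ρ c Y (2 * (tL + tR) + (4 + y))
      leftPart room p≤e = apply {a = 1} {b = 2} u≤s (≤-trans p≤e e≤w)
        (run s<p (λ i l h → Run.edges S i l (<-≤-trans h p≤e)) (λ v l h → Yˡ v (≤-trans u≤s (<⇒≤ l)) h) (startsFree (Run.left S)) (tied Yp)) room
        where
          s<p : s < p
          s<p = <-≤-trans (m<m+n s (scale-< {0} {2} (8^>0 (2 + y)) (s≤s z≤n))) room
          startsFree : LeftEnd K X s 1 → LeftEnd K Y s 1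
          startsFree (free _ Ks) = free (Yˡ s u≤s s<p) Ks
      rightPart : q + 2 * T ≤ e → s ≤ q → Bound n r m ρ c Y (2 * (tL + tR) + (4 + y))
      rightPart room s≤q = apply {a = 2} {b = 1} (≤-trans u≤s s≤q) e≤w
        (run q<e (λ i l h → Run.edges S i (≤-trans s≤q l) h) (λ v l h → Yʳ v l (≤-trans (<⇒≤ h) e≤w)) (tied Yq) (endsFree (Run.right S))) room
        where
          q<e : q < e
          q<e = <-≤-trans (m<m+n q (scale-< {0} {2} (8^>0 (2 + y)) (s≤s z≤n))) room
          endsFree : RightEnd K X e 1 → RightEnd K Y e 1
          endsFree (free _ Ke) = free (Yʳ e q<e e≤w) Ke
      side : Bound n r m ρ c Y (2 * (tL + tR) + (4 + y))
      side with s + 2 * T ≤? p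
      side | yes room with p ≤? e
      ... | yes p≤e = leftPart room p≤e
      ... | no  p≰e = whole (λ v l h → Yˡ v (≤-trans u≤s l) (≤-<-trans h (≰⇒> p≰e)))
      side | no ¬room with s ≤? q
      ... | no  s≰q = whole (λ v l h → Yʳ v (<-≤-trans (≰⇒> s≰q) l) (≤-trans h e≤w))
      ... | yes s≤q = rightPart (begin
          q + 2 * T                   ≤⟨ +-monoˡ-≤ (2 * T) narrow ⟩
          p + 2 * T + 2 * T           ≤⟨ +-monoˡ-≤ (2 * T) (+-monoˡ-≤ (2 * T) (<⇒≤ (≰⇒> ¬room))) ⟩
          s + 2 * T + 2 * T + 2 * T   ≡⟨ solve 2 (λ s T → s :+ con 2 :* T :+ con 2 :* T :+ con 2 :* T := s :+ con 6 :* T) refl s T ⟩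
          s + 6 * T                   ≤⟨ +-monoʳ-≤ s (*-monoˡ-≤ T {6} {7} (≤ᵇ⇒≤ 6 7 tt)) ⟩
          s + 7 * T                   ≤⟨ spread ⟩
          e ∎) s≤q
        where open ≤-Reasoning

  -- The step to the next level

  module Step (y : ℕ) (low : Below (4 + y)) where

    HighClaim : Node n r m → Set
    HighClaim = ClaimAt n r m (8 ^ (3 + y)) (5 + y)

    private
      wide : ∀ {u w s e} → u + 8 ^ (3 + y) ≤ w → s ≤ u + 0 → w ≤ e + 0 → s + 1 * 8 ^ (3 + y) ≤ e
      wide {u} {e = e} long gapˡ gapʳ =
        ≤-trans (+-mono-≤ (≤-trans gapˡ (≤-reflexive (+-identityʳ u))) (≤-reflexive (*-identityˡ (8 ^ (3 + y)))))
                (≤-trans long (≤-trans gapʳ (≤-reflexive (+-identityʳ e))))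

    freePiece : ∀ {A X u w tL tR h} (B C : Node n r m) → Covers A (graph B) (graph C) →
                Tree n r m (graph B) (weight B) (cost B) → Tree n r m (graph C) (weight C) (cost C) → HighClaim B → HighClaim C →
                Component A X u w → u + 8 ^ (3 + y) ≤ w → Comps A X 0 u tL → Comps A X (suc w) h tR →
                Joint n r m B C X (2 * (tL + tR) + (5 + y))
    freePiece {A} {X} {u} {w} {tL} {tR} B C cov tB tC claimB claimC R long csL csR
      with Dichotomy.dichotomy B C cov R csL csR (baseTree tB) y (upto B tB low) (upto C tC low) long′
         | Dichotomy.dichotomy C B (covers-swap cov) R csL csR (baseTree tC) y (upto C tC low) (upto B tB low) long′
      where
        long′ : u + 8 ^ (2 + y) ≤ w
        long′ = ≤-trans (+-monoʳ-≤ u (m≤n*m (8 ^ (2 + y)) 8)) long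
    ... | inj₁ joint | _ = joint
    ... | inj₂ _ | inj₁ joint = joint-swap {B} {C} joint
    ... | inj₂ (inj₁ none) | inj₂ _ with none-lone {g = 0} cov R none
    ...   | lone u≤s e≤w S _ _ gapˡ gapʳ =
      joint-swap {B} {C} (Window.runTarget₀ C B (covers-swap cov) R csL csR claimC u≤s e≤w S (wide long gapˡ gapʳ))
    freePiece {A} {X} {u} {w} {tL} {tR} B C cov tB tC claimB claimC R long csL csR | inj₂ (inj₂ _) | inj₂ (inj₁ none)
      with none-lone {g = 0} (covers-swap cov) R none
    ... | lone u≤s e≤w S _ _ gapˡ gapʳ =
      Window.runTarget₀ B C cov R csL csR claimB u≤s e≤w S (wide long gapˡ gapʳ)
    freePiece {A} {X} {u} {w} {tL} {tR} B C cov tB tC claimB claimC R long csL csR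
      | inj₂ (inj₂ L@(lone {s} {e} u≤s e≤w S nl nr gapˡ gapʳ)) | inj₂ (inj₂ M) with r ^ (3 + y) ≤? cost C
    -- Smallness of both factors gives 2, and the cost of `C` supplies the other `3 + y`.
    ... | yes costly = bound-weaken (m≤n+m (cost C) (cost B)) (≤-reflexive (sym (+-assoc (2 * (tL + tR)) 2 (3 + y))))
                         (bound-trade costly (Window.bothSmall B C cov R csL csR u≤s e≤w S))
    -- `C` is cheap and becomes the carried factor of the descent through the tree of `B`.
    ... | no ¬costly = bound-weaken (m≤m+n (cost B) (cost C)) ≤-refl
        (Descent.descendTree (depends C) (λ u≤v cs ds → small-pair C cs ds z≤n u≤v) (component-avoids R) y low
          (lone-slices y (low (4 + y) ≤-refl tC) (<⇒≤ (≰⇒> ¬costly)) long M)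
          tB (depends B) cov (inside u≤s e≤w S nl nr stopˡ stopʳ) spread csL csR)
      where
        open +-*-Solver
        V = 8 ^ (1 + y)
        stopˡ : before (graph B) u ≡ false
        stopˡ with Run.left R
        ... | free _ Au = ≼-false (before-mono (covers-≼ˡ cov)) u Au
        stopʳ : graph B w ≡ false
        stopʳ with Run.right R
        ... | free _ Aw = ≼-false (covers-≼ˡ cov) w Aw
        spread : s + 8 ^ (2 + y) ≤ e
        spread = +-cancelʳ-≤ (4 * V) _ _ (begin
          s + 8 * V + 4 * V              ≤⟨ +-monoˡ-≤ (4 * V) (+-monoˡ-≤ (8 * V) gapˡ) ⟩
          u + 4 * V + 8 * V + 4 * V      ≡⟨ solve 2 (λ u V → u :+ con 4 :* V :+ con 8 :* V :+ con 4 :* V := u :+ con 16 :* V) refl u V ⟩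
          u + 16 * V                     ≤⟨ +-monoʳ-≤ u (scale-≤ V (≤ᵇ⇒≤ 16 64 tt)) ⟩
          u + 64 * V                     ≡⟨ solve 2 (λ u V → u :+ con 64 :* V := u :+ con 8 :* (con 8 :* V)) refl u V ⟩
          u + 8 * (8 * V)                ≤⟨ long ⟩
          w                              ≤⟨ gapʳ ⟩
          e + 4 * V ∎)
          where open ≤-Reasoning

    -- The descent concerns free runs only. Around the edge from `pick` one factor has either a run
    -- that qualifies for the same level or a free component; the latter counts 2 where the tied run
    -- counted nothing, and `tiedLoop` gains the rest.
    tiedPiece : ∀ {A X u w a b tL tR h} (B C : Node n r m) → Covers A (graph B) (graph C) →
                Tree n r m (graph B) (weight B) (cost B) → Tree n r m (graph C) (weight C) (cost C) → HighClaim B → HighClaim C →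
                Run A X u w a b → 2 ≤ a * b → u + a * b * 8 ^ (3 + y) ≤ w → Comps A X 0 u tL → Comps A X (suc w) h tR →
                Joint n r m B C X (2 * (tL + tR) + (5 + y))
    tiedPiece {A} {X} {u} {w} B C cov tB tC claimB claimC R two long csL csR with pick R (8^>0 (3 + y)) long
    ... | p , u≤p , p<w , choose with graph B p in Bp
    ...   | true with choose (covers-≼ˡ cov) Bp
    ...     | inj₁ (_ , _ , _ , _ , l , h , S , long′) = Window.runTarget₀ B C cov R csL csR claimB l h S long′
    ...     | inj₂ (_ , _ , l , h , S) =
      Looping.tiedLoop B C cov R csL csR (baseTree tB) y claimB (upto B tB low) (upto C tC low) (single l (s≤s h) S)
        (≤-trans (+-monoʳ-≤ u (*-monoˡ-≤ (8 ^ (3 + y)) two)) long)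
    tiedPiece {A} {X} {u} {w} B C cov tB tC claimB claimC R two long csL csR | p , u≤p , p<w , choose | false
      with choose (covers-≼ʳ cov) (trans (sym (trans (Covers.cover cov p) (cong (_∨ graph C p) Bp))) (Run.edges R p u≤p p<w))
    ... | inj₁ (_ , _ , _ , _ , l , h , S , long′) =
      joint-swap {B} {C} (Window.runTarget₀ C B (covers-swap cov) R csL csR claimC l h S long′)
    ... | inj₂ (_ , _ , l , h , S) = joint-swap {B} {C}
      (Looping.tiedLoop C B (covers-swap cov) R csL csR (baseTree tC) y claimC (upto C tC low) (upto B tB low) (single l (s≤s h) S)
        (≤-trans (+-monoʳ-≤ u (*-monoˡ-≤ (8 ^ (3 + y)) two)) long))

    highTree : ∀ {G P c} → Tree n r m G P c → Claim n r m (8 ^ (3 + y)) (5 + y) G P c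

    highForest : ∀ {G P c X u w a b tL tR h} → Forest n r m G P c → Run G X u w a b → u + a * b * 8 ^ (3 + y) ≤ w →
                 Comps G X 0 u tL → Comps G X (suc w) h tR → Bound n r m P c X (2 * (tL + tR) + (5 + y))

    highTree (leaf e only _) {u = u} R long csL csR =
      ⊥-elim (<-irrefl refl (<-≤-trans (+-monoʳ-< u {1} (*-mono-≤ (*-mono-≤ (left≥1 (Run.left R)) (right≥1 (Run.right R))) 2≤))
        (≤-trans long (≤-reflexive (trans (proj₂ (one-edge only R)) (+-comm 1 u))))))
      where
        2≤ : 2 ≤ 8 ^ (3 + y)
        2≤ = *-mono-≤ {2} {8} (s≤s (s≤s z≤n)) (8^>0 (2 + y))
    highTree (node P≤ c≤ F) R long csL csR = bound-mono P≤ (bound-weaken c≤ ≤-refl (highForest F R long csL csR))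

    highForest []                      R long csL csR = bound-0
    highForest {u = u} (join B C cov tB tC F) R long csL csR with Run.left R | Run.right R
    ... | free _ _ | free _ _ =
      bound-+ (freePiece B C cov tB tC (highTree tB) (highTree tC) R (≤-trans (+-monoʳ-≤ u (≤-reflexive (sym (*-identityˡ (8 ^ (3 + y)))))) long) csL csR)
              (highForest F R long csL csR)
    ... | free _ _ | tied _ =
      bound-+ (tiedPiece B C cov tB tC (highTree tB) (highTree tC) R ≤-refl long csL csR) (highForest F R long csL csR)
    ... | tied _ | free _ _ =
      bound-+ (tiedPiece B C cov tB tC (highTree tB) (highTree tC) R ≤-refl long csL csR) (highForest F R long csL csR)
    ... | tied _ | tied _ =
      bound-+ (tiedPiece B C cov tB tC (highTree tB) (highTree tC) R (s≤s (s≤s z≤n)) long csL csR) (highForest F R long csL csR)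

  lowLevel : ∀ L → L ≤ 4 → Exactly L
  lowLevel L L≤4 t {_} {u} {_} {a} {b} {tL} {tR} R long csL csR =
    bound-weaken ≤-refl (+-monoʳ-≤ (2 * (tL + tR)) L≤4)
      (baseTree t R (≤-trans (+-monoʳ-≤ u (*-monoʳ-≤ (a * b) (8^>0 (L ∸ 2)))) long) csL csR)

  nextLevel : ∀ I → Below I → Exactly (suc I)
  nextLevel 0 low = lowLevel 1 (≤ᵇ⇒≤ 1 4 tt)
  nextLevel 1 low = lowLevel 2 (≤ᵇ⇒≤ 2 4 tt)
  nextLevel 2 low = lowLevel 3 (≤ᵇ⇒≤ 3 4 tt)
  nextLevel 3 low = lowLevel 4 (≤ᵇ⇒≤ 4 4 tt)
  nextLevel (suc (suc (suc (suc y)))) low = Step.highTree y low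

  below : ∀ I → Below I
  below zero    L L≤I = lowLevel L (≤-trans L≤I z≤n)
  below (suc I) L L≤I with m≤n⇒m<n∨m≡n L≤I
  ... | inj₁ L<sI = below I L (s≤s⁻¹ L<sI)
  ... | inj₂ refl = nextLevel I (below I)

  claim : ∀ L → Exactly L
  claim L = below L L ≤-refl

-- Encoding of pathsets

line : ∀ {k} → Subset k → Line
line []      _       = false
line (b ∷ G) zero    = b
line (b ∷ G) (suc i) = line G i

line-lookup : ∀ {k} (G : Subset k) i → line G (toℕ i) ≡ lookup G i
line-lookup (b ∷ G) zero    = refl
line-lookup (b ∷ G) (suc i) = line-lookup G i

line-true : ∀ {k} (G : Subset k) v → line G v ≡ true → Σ (Fin k) (λ i → toℕ i ≡ v)
line-true (b ∷ G) zero    e = zero , refl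
line-true (b ∷ G) (suc v) e with line-true G v e
... | i , refl = suc i , refl

line-∪ : ∀ {k} (H K : Subset k) v → line (H ∪ K) v ≡ line H v ∨ line K v
line-∪ []      []      v       = refl
line-∪ (a ∷ H) (b ∷ K) zero    = refl
line-∪ (a ∷ H) (b ∷ K) (suc v) = line-∪ H K v

⊆⇒≼ : ∀ {k} {H G : Subset k} → H ⊆ G → line H ≼ line G
⊆⇒≼ {H = H} {G} H⊆G = incl include′
  where
    include′ : ∀ v → line H v ≡ true → line G v ≡ true
    include′ v e with line-true H v e
    ... | i , refl = trans (line-lookup G i) ([]=⇒lookup (H⊆G (lookup⇒[]= i H (trans (sym (line-lookup H i)) e))))

lookup-verts : ∀ {k} (G : Subset k) j → lookup (verts G) j ≡ ends (line G) (toℕ j)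
lookup-verts G j = trans (lookup∘tabulate (λ j → leftE G j ∨ rightE G j) j) (cong₂ _∨_ (left-before j) (right-at G j))
  where
    left-before : ∀ j → leftE G j ≡ before (line G) (toℕ j)
    left-before zero    = refl
    left-before (suc i) = sym (line-lookup G i)
    right-at : ∀ {k} (G : Subset k) (j : Fin (suc k)) → rightE G j ≡ line G (toℕ j)
    right-at []      _       = refl
    right-at (b ∷ G) zero    = refl
    right-at (b ∷ G) (suc j) = right-at G j

line-verts : ∀ {k} (G : Subset k) v → line (verts G) v ≡ true → ends (line G) v ≡ true
line-verts G v e with line-true (verts G) v e
... | j , refl = trans (sym (lookup-verts G j)) (trans (sym (line-lookup (verts G) j)) e)

card>0 : ∀ {k} (S : Subset k) u → line S u ≡ true → 1 ≤ ∣ S ∣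
card>0 (true ∷ S)  _       e = s≤s z≤n
card>0 (false ∷ S) (suc u) e = card>0 S u e

card>1 : ∀ {k} (S : Subset k) u → line S u ≡ true → line S (suc u) ≡ true → 2 ≤ ∣ S ∣
card>1 (true ∷ S)  u       e e′ = s≤s (card>0 S u e′)
card>1 (false ∷ S) (suc u) e e′ = card>1 S u e e′

card≡0 : ∀ {k} (S : Subset k) → ∣ S ∣ ≡ 0 → ∀ u → line S u ≡ false
card≡0 S eq u with line S u in Su
... | false = refl
... | true  with ≤-trans (card>0 S u Su) (≤-reflexive eq)
...   | ()

card≡1 : ∀ {k} (S : Subset k) → ∣ S ∣ ≡ 1 → ∃[ e ] line S e ≡ true × (∀ i → line S i ≡ true → i ≡ e)
card≡1 (true ∷ S) eq = 0 , refl , only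
  where
    only : ∀ i → line (true ∷ S) i ≡ true → i ≡ 0
    only zero    _  = refl
    only (suc i) Si = ⊥-elim (true≢false Si (card≡0 S (suc-injective eq) i))
card≡1 (false ∷ S) eq with card≡1 S eq
... | e , Se , only = suc e , Se , only′
  where
    only′ : ∀ i → line (false ∷ S) i ≡ true → i ≡ suc e
    only′ (suc i) Si = cong suc (only i Si)

-- First edges of components, listed so as to follow the recursion of `compsAux`: `prev` tells
-- whether the edge just before index 0 is present, in which case index 0 starts nothing.
data Starts (prev : Bool) (g : Line) : ℕ → ℕ → Set where
  []   : ∀ {lo} → Starts prev g lo 0
  cons : ∀ {lo t} u → lo ≤ u → g u ≡ true → (∀ i → suc i ≡ u → g i ≡ false) → (u ≡ 0 → prev ≡ false) →
         Starts prev g (suc u) t → Starts prev g lo (suc t)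

starts-shift : ∀ {k prev b lo t} {G : Subset k} → Starts prev (line (b ∷ G)) (suc lo) t → Starts b (line G) lo t
starts-shift [] = []
starts-shift {G = G} (cons (suc u) l gu pred prev′ ss) =
  cons u (s≤s⁻¹ l) gu (λ i e → pred (suc i) (cong suc e)) (λ e → pred 0 (cong suc (sym e))) (starts-shift ss)

starts≤comps : ∀ {k} prev (G : Subset k) {lo t} → Starts prev (line G) lo t → t ≤ compsAux prev G
starts≤comps prev G           []                   = z≤n
starts≤comps prev []          (cons u _ () _ _ _)
starts≤comps prev (true ∷ G)  (cons zero _ _ _ p ss) with p refl
... | refl = s≤s (starts≤comps true G (starts-shift ss))
starts≤comps prev (true ∷ G)  (cons (suc u) _ gu pred p ss) =
  ≤-trans (starts≤comps true G {0} (starts-shift (cons (suc u) (s≤s z≤n) gu pred p ss))) (m≤n+m _ (if prev then 0 else 1))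
starts≤comps prev (false ∷ G) (cons (suc u) _ gu pred p ss) =
  starts≤comps false G {0} (starts-shift (cons (suc u) (s≤s z≤n) gu pred p ss))

between : ℕ → ℕ → Line
between u w v = (u ≤ᵇ v) ∧ (v ≤ᵇ w)

between-true : ∀ {u w v} → u ≤ v → v ≤ w → between u w v ≡ true
between-true {u} {w} {v} l h with u ≤ᵇ v in e | v ≤ᵇ w in e′
... | true  | true  = refl
... | true  | false = ⊥-elim (subst Data.Bool.T e′ (≤⇒≤ᵇ h))
... | false | _     = ⊥-elim (subst Data.Bool.T e (≤⇒≤ᵇ l))

between-bounds : ∀ {u w v} → between u w v ≡ true → u ≤ v × v ≤ w
between-bounds {u} {w} {v} e with u ≤ᵇ v in l | v ≤ᵇ w in h
... | true | true = ≤ᵇ⇒≤ u v (subst Data.Bool.T (sym l) _) , ≤ᵇ⇒≤ v w (subst Data.Bool.T (sym h) _)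

covered : ∀ {G X lo hi t} → Comps G X lo hi t → Line
covered []                            = λ _ → false
covered (cons {u = u} {w} _ _ _ cs) v = between u w v ∨ covered cs v

-- These are the demands of smallness on the vertex set of the listed components: it lies in the
-- vertex set of the graph and is closed under adjacency. That it avoids `X` allows fixing all
-- vertices outside it.
covered-inside : ∀ {G X lo hi t} (cs : Comps G X lo hi t) v → covered cs v ≡ true →
                 X v ≡ false × ends G v ≡ true × (G v ≡ true → covered cs (suc v) ≡ true) ×
                 (∀ i → suc i ≡ v → G i ≡ true → covered cs i ≡ true)
covered-inside {G} {X} (cons {u = u} {w} _ _ c@(run u<w es _ (free _ Gu) (free _ Gw)) cs) v e with between u w v in bt
... | false with covered-inside cs v e
...   | Xv , Gv , next , prev = Xv , Gv , (λ g → ∨-trueʳ {between u w (suc v)} (next g)) , (λ i p g → ∨-trueʳ {between u w i} (prev i p g))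
covered-inside {G} {X} (cons {u = u} {w} _ _ c@(run u<w es _ (free _ Gu) (free _ Gw)) cs) v e | true with between-bounds {u} {w} {v} bt
... | u≤v , v≤w = component-avoids c v u≤v v≤w , vertex , next , prev
  where
    lastEdge : ∀ {w} → u < w → (∀ i → u ≤ i → i < w → G i ≡ true) → before G w ≡ true
    lastEdge {suc w} l es = es w (s≤s⁻¹ l) ≤-refl
    vertex : ends G v ≡ true
    vertex with m≤n⇒m<n∨m≡n v≤w
    ... | inj₁ v<w  = ∨-trueʳ {before G v} (es v u≤v v<w)
    ... | inj₂ refl = ∨-trueˡ (lastEdge u<w es)
    next : G v ≡ true → between u w (suc v) ∨ covered cs (suc v) ≡ true
    next g with m≤n⇒m<n∨m≡n v≤w
    ... | inj₁ v<w  = ∨-trueˡ (between-true (≤-trans u≤v (n≤1+n v)) v<w)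
    ... | inj₂ refl = ⊥-elim (true≢false g Gw)
    prev : ∀ i → suc i ≡ v → G i ≡ true → between u w i ∨ covered cs i ≡ true
    prev i refl g with m≤n⇒m<n∨m≡n u≤v
    ... | inj₁ u<v  = ∨-trueˡ (between-true (s≤s⁻¹ u<v) (≤-trans (n≤1+n i) v≤w))
    ... | inj₂ refl = ⊥-elim (true≢false g Gu)

covered-starts : ∀ {G g X lo hi t} (cs : Comps G X lo hi t) → (∀ v → G v ≡ true → covered cs v ≡ true → covered cs (suc v) ≡ true → g v ≡ true) →
                 (∀ v → G v ≡ false → g v ≡ false) → Starts false g lo t
covered-starts [] on off = []
covered-starts {G} (cons {u = u} {w} l _ (run u<w es _ (free _ Gu) _) cs) on off =
  cons u l (on u (es u ≤-refl u<w) (∨-trueˡ (between-true ≤-refl (<⇒≤ u<w))) (∨-trueˡ (between-true (n≤1+n u) u<w)))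
    (λ { i refl → off i Gu }) (λ _ → refl)
    (weaken (covered-starts cs (λ v g c c′ → on v g (∨-trueʳ {between u w v} c) (∨-trueʳ {between u w (suc v)} c′)) off))
  where
    weaken : ∀ {t} → Starts false _ (suc w) t → Starts false _ (suc u) t
    weaken [] = []
    weaken (cons v l gv pred p ss) = cons v (≤-trans (s≤s (<⇒≤ u<w)) l) gv pred p ss

sum-≥ : ∀ {n} (f : Fin n → ℕ) i → f i ≤ sum f
sum-≥ f zero    = m≤m+n (f zero) _
sum-≥ f (suc i) = ≤-trans (sum-≥ (λ j → f (suc j)) i) (m≤n+m _ (f zero))

sum-0 : ∀ {n} {f : Fin n → ℕ} → (∀ i → f i ≡ 0) → sum f ≡ 0
sum-0 {zero}  f≡0 = refl
sum-0 {suc n} f≡0 = cong₂ _+_ (f≡0 zero) (sum-0 (λ i → f≡0 (suc i)))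

off : ∀ {m} → Subset m → Line
off S v = not (line S v)

module _ {n : ℕ} where

  agree : Bool → Fin n → Maybe (Fin n) → ℕ
  agree true  a (just b) = if does (a ≟F b) then 1 else 0
  agree true  a nothing  = 0
  agree false a (just b) = 0
  agree false a nothing  = 1

  -- Indicator that `y` encodes the restriction of `x` to `V`, written as a product over the
  -- coordinates so that `mass` factors along the vector.
  match : ∀ {m} → Subset m → Vec (Fin n) m → Vec (Maybe (Fin n)) m → ℕ
  match []      []      []      = 1
  match (v ∷ V) (a ∷ x) (b ∷ y) = agree v a b * match V x y

  _↾_ : ∀ {m} → Vec (Maybe (Fin n)) m → Subset m → Vec (Maybe (Fin n)) m
  y ↾ V = zipWith (λ b a → if b then a else nothing) V y

  agree≤1 : ∀ v a b → agree v a b ≤ 1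
  agree≤1 true a (just b) with does (a ≟F b)
  ... | true  = ≤-refl
  ... | false = z≤n
  agree≤1 true  a nothing  = z≤n
  agree≤1 false a (just b) = z≤n
  agree≤1 false a nothing  = ≤-refl

  agree-self : ∀ v a → agree v a (if v then just a else nothing) ≡ 1
  agree-self false a = refl
  agree-self true  a with a ≟F a
  ... | yes _   = refl
  ... | no  a≢a = ⊥-elim (a≢a refl)

  agree-sound : ∀ v a b → agree v a b ≡ 0 ⊎ b ≡ (if v then just a else nothing)
  agree-sound true a (just b) with a ≟F b
  ... | yes refl = inj₂ refl
  ... | no _     = inj₁ refl
  agree-sound true  a nothing  = inj₁ refl
  agree-sound false a (just b) = inj₁ refl
  agree-sound false a nothing  = inj₂ refl

  match≤1 : ∀ {m} (V : Subset m) x y → match V x y ≤ 1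
  match≤1 []      []      []      = ≤-refl
  match≤1 (v ∷ V) (a ∷ x) (b ∷ y) = *-mono-≤ (agree≤1 v a b) (match≤1 V x y)

  match-self : ∀ {m} (V : Subset m) x → match V x (map just x ↾ V) ≡ 1
  match-self []      []      = refl
  match-self (v ∷ V) (a ∷ x) = cong₂ _*_ (agree-self v a) (match-self V x)

  match-sound : ∀ {m} (V : Subset m) x y → match V x y ≡ 0 ⊎ y ≡ map just x ↾ V
  match-sound []      []      []      = inj₂ refl
  match-sound (v ∷ V) (a ∷ x) (b ∷ y) with agree-sound v a b | match-sound V x y
  ... | inj₁ e | _      = inj₁ (cong (_* match V x y) e)
  ... | inj₂ _ | inj₁ e = inj₁ (trans (cong (agree v a b *_) e) (*-zeroʳ (agree v a b)))
  ... | inj₂ p | inj₂ q = inj₂ (cong₂ _∷_ p q)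

  match-depends : ∀ {m} (V : Subset m) x x′ y → (∀ i → lookup V i ≡ true → lookup x i ≡ lookup x′ i) → match V x y ≡ match V x′ y
  match-depends []      []      []        []      eq = refl
  match-depends (v ∷ V) (a ∷ x) (a′ ∷ x′) (b ∷ y) eq = cong₂ _*_ (head-eq v b (eq zero)) (match-depends V x x′ y (λ i → eq (suc i)))
    where
      head-eq : ∀ v b → (v ≡ true → a ≡ a′) → agree v a b ≡ agree v a′ b
      head-eq true  b        p = cong (λ a → agree true a b) (p refl)
      head-eq false (just _) p = refl
      head-eq false nothing  p = refl

  ∑-agree : ∀ b → sum (λ a → agree true a b) ≤ 1
  ∑-agree nothing  = ≤-trans (≤-reflexive (sum-0 {n} (λ _ → refl))) z≤n
  ∑-agree (just b) = ones b
    where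
      eqs : ∀ {l} → Fin l → Fin l → ℕ
      eqs b a = if does (a ≟F b) then 1 else 0
      suc-eq : ∀ {l} (b a : Fin l) → eqs (suc b) (suc a) ≡ eqs b a
      suc-eq b a with a ≟F b
      ... | yes _ = refl
      ... | no _  = refl
      ones : ∀ {l} (b : Fin l) → sum (eqs b) ≤ 1
      ones {suc l} zero = ≤-reflexive (cong suc (sum-0 {l} {λ i → eqs zero (suc i)} (λ i → refl)))
      ones (suc b) = ≤-trans (≤-reflexive (sum-cong-≗ (suc-eq b))) (ones b)

  -- `y` prescribes each averaged coordinate in `S`, so each of them contributes at most 1/n, and
  -- the fixed ones at most 1.
  match-mass : ∀ {m} (V S : Subset m) y z → (∀ i → lookup S i ≡ true → lookup V i ≡ true) →
               mass (off S) (λ x → match V x y) z * n ^ ∣ S ∣ ≤ n ^ m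
  match-mass []      []           []      []      S⊆V = ≤-refl
  match-mass {suc m} (v ∷ V) (true ∷ S) (b ∷ y) (z ∷ zs) S⊆V with S⊆V zero refl
  ... | refl = begin
    sum (λ a → mass (off S) (λ x → agree true a b * match V x y) zs) * (n * n ^ ∣ S ∣)
      ≡⟨ cong (_* (n * n ^ ∣ S ∣)) (trans (sum-cong-≗ (λ a → mass-* (off S) (agree true a b) (λ x → match V x y) zs))
                                           (sym (*-distribʳ-sum μ (λ a → agree true a b)))) ⟩
    sum (λ a → agree true a b) * μ * (n * n ^ ∣ S ∣)  ≤⟨ *-monoˡ-≤ (n * n ^ ∣ S ∣) (*-monoˡ-≤ μ (∑-agree b)) ⟩
    1 * μ * (n * n ^ ∣ S ∣)                         ≡⟨ solve 3 (λ μ n s → con 1 :* μ :* (n :* s) := n :* (μ :* s)) refl μ n (n ^ ∣ S ∣) ⟩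
    n * (μ * n ^ ∣ S ∣)                             ≤⟨ *-monoʳ-≤ n (match-mass V S y zs (λ i → S⊆V (suc i))) ⟩
    n * n ^ m ∎
    where
      open ≤-Reasoning
      open +-*-Solver
      μ = mass (off S) (λ x → match V x y) zs
  match-mass {suc m} (v ∷ V) (false ∷ S) (b ∷ y) (z ∷ zs) S⊆V = begin
    n * mass (off S) (λ x → agree v z b * match V x y) zs * n ^ ∣ S ∣ ≡⟨ cong (λ t → n * t * n ^ ∣ S ∣) (mass-* (off S) (agree v z b) (λ x → match V x y) zs) ⟩
    n * (agree v z b * μ) * n ^ ∣ S ∣    ≤⟨ *-monoˡ-≤ (n ^ ∣ S ∣) (*-monoʳ-≤ n (*-monoˡ-≤ μ (agree≤1 v z b))) ⟩
    n * (1 * μ) * n ^ ∣ S ∣              ≡⟨ solve 3 (λ μ n s → n :* (con 1 :* μ) :* s := n :* (μ :* s)) refl μ n (n ^ ∣ S ∣) ⟩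
    n * (μ * n ^ ∣ S ∣)                  ≤⟨ *-monoʳ-≤ n (match-mass V S y zs (λ i → S⊆V (suc i))) ⟩
    n * n ^ m ∎
    where
      open ≤-Reasoning
      open +-*-Solver
      μ = mass (off S) (λ x → match V x y) zs

  private
    factor : ∀ {m} (V S : Subset m) y zs c → mass (off S) (λ x → c * match V x y) zs ≡ c * mass (off S) (λ x → match V x y) zs
    factor V S y zs c = mass-* (off S) c (λ x → match V x y) zs

    factor-0ʳ : ∀ {m} (V S : Subset m) y zs c → mass (off S) (λ x → match V x y) zs ≡ 0 →
                mass (off S) (λ x → c * match V x y) zs ≡ 0
    factor-0ʳ V S y zs c e = trans (factor V S y zs c) (trans (cong (c *_) e) (*-zeroʳ c))

  match-mass-0 : ∀ {m} (V S : Subset m) y z →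
                 mass (off S) (λ x → match V x y) z ≡ 0 ⊎ y ↾ (V ∩ ∁ S) ≡ map just z ↾ (V ∩ ∁ S)
  match-mass-0 []      []           []      []      = inj₂ refl
  match-mass-0 (v ∷ V) (true ∷ S) (b ∷ y) (z ∷ zs) with match-mass-0 V S y zs
  ... | inj₁ e = inj₁ (sum-0 (λ a → factor-0ʳ V S y zs (agree v a b) e))
  ... | inj₂ e = inj₂ (cong₂ _∷_ (nothing≡ v) e)
    where
      nothing≡ : ∀ v → (if v ∧ false then b else nothing) ≡ (if v ∧ false then just z else nothing)
      nothing≡ true  = refl
      nothing≡ false = refl
  match-mass-0 (v ∷ V) (false ∷ S) (b ∷ y) (z ∷ zs) with match-mass-0 V S y zs | agree-sound v z b
  ... | inj₁ e | _ = inj₁ (trans (cong (n *_) (factor-0ʳ V S y zs (agree v z b) e)) (*-zeroʳ n))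
  ... | inj₂ _ | inj₁ e = 
    inj₁ (trans (cong (n *_) (trans (factor V S y zs (agree v z b)) (cong (_* mass (off S) (λ x → match V x y) zs) e)))
                (*-zeroʳ n))
  ... | inj₂ e | inj₂ b≡ = inj₂ (cong₂ _∷_ (same v b≡) e)
    where
      same : ∀ v → b ≡ (if v then just z else nothing) → (if v ∧ true then b else nothing) ≡ (if v ∧ true then just z else nothing)
      same true  p = p
      same false p = refl

  match-total : ∀ {m} (V : Subset m) y (z : Vec (Fin n) m) → map is-just y ≡ V → 1 ≤ mass (λ _ → false) (λ x → match V x y) z
  match-total []      []      []      _ = ≤-refl
  match-total (v ∷ V) (b ∷ y) (z ∷ zs) refl = ≤-trans (found b) (sum-≥ (λ a → mass (λ _ → false) (λ x → agree v a b * match V x y) zs) (point b))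
    where
      -- Any value agrees at a coordinate outside `V`; the entry of `z` serves as a default.
      point : Maybe (Fin n) → Fin n
      point (just b) = b
      point nothing  = z
      agrees : ∀ b → agree (is-just b) (point b) b ≡ 1
      agrees (just b) = agree-self true b
      agrees nothing  = refl
      found : ∀ b → 1 ≤ mass (λ _ → false) (λ x → agree (is-just b) (point b) b * match V x y) zs
      found b = ≤-trans (match-total V y zs refl) (≤-reflexive (sym (trans (mass-* (λ _ → false) (agree (is-just b) (point b) b) (λ x → match V x y) zs)
                  (trans (cong (_* mass (λ _ → false) (λ x → match V x y) zs) (agrees b)) (*-identityˡ _)))))

  ↾-↾ : ∀ {m} (V W : Subset m) y → (∀ i → lookup V i ≡ true → lookup W i ≡ true) → (y ↾ W) ↾ V ≡ y ↾ V
  ↾-↾ []          []          []      V⊆W = refl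
  ↾-↾ (true ∷ V)  (w ∷ W) (b ∷ y) V⊆W with V⊆W zero refl
  ... | refl = cong (b ∷_) (↾-↾ V W y (λ i → V⊆W (suc i)))
  ↾-↾ (false ∷ V) (w ∷ W) (b ∷ y) V⊆W = cong (nothing ∷_) (↾-↾ V W y (λ i → V⊆W (suc i)))

  -- The indicator function of the cylinder over a list of distinct assignments to V.
  cylinder : ∀ {m} → Subset m → List (Vec (Maybe (Fin n)) m) → Vec (Fin n) m → ℕ
  cylinder V []       x = 0
  cylinder V (y ∷ ys) x = match V x y + cylinder V ys x

  cylinder-depends : ∀ {m} (V : Subset m) ys x x′ → (∀ i → lookup V i ≡ true → lookup x i ≡ lookup x′ i) → cylinder V ys x ≡ cylinder V ys x′
  cylinder-depends V []       x x′ eq = refl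
  cylinder-depends V (y ∷ ys) x x′ eq = cong₂ _+_ (match-depends V x x′ y eq) (cylinder-depends V ys x x′ eq)

  cylinder-sound : ∀ {m} (V : Subset m) ys x → cylinder V ys x ≡ 0 ⊎ map just x ↾ V ∈ₗ ys
  cylinder-sound V []       x = inj₁ refl
  cylinder-sound V (y ∷ ys) x with match-sound V x y | cylinder-sound V ys x
  ... | inj₂ e | _       = inj₂ (here (sym e))
  ... | inj₁ _ | inj₂ y∈ = inj₂ (there y∈)
  ... | inj₁ e | inj₁ e′ = inj₁ (cong₂ _+_ e e′)

  cylinder-complete : ∀ {m} (V : Subset m) ys x → map just x ↾ V ∈ₗ ys → 1 ≤ cylinder V ys x
  cylinder-complete V (y ∷ ys) x (here e)   = ≤-trans (≤-reflexive (sym (trans (cong (match V x) (sym e)) (match-self V x)))) (m≤m+n _ _)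
  cylinder-complete V (y ∷ ys) x (there y∈) = ≤-trans (cylinder-complete V ys x y∈) (m≤n+m _ _)

  cylinder≤1 : ∀ {m} (V : Subset m) ys x → Unique ys → cylinder V ys x ≤ 1
  cylinder≤1 V []       x _           = z≤n
  cylinder≤1 V (y ∷ ys) x (y∉ys ∷ us) with match-sound V x y | cylinder-sound V ys x
  ... | inj₁ e | _       = ≤-trans (≤-reflexive (cong (_+ cylinder V ys x) e)) (cylinder≤1 V ys x us)
  ... | inj₂ _ | inj₁ e  = ≤-trans (≤-reflexive (trans (cong (match V x y +_) e) (+-identityʳ _))) (match≤1 V x y)
  ... | inj₂ e | inj₂ y∈ = ⊥-elim (lookupAll y∉ys y∈ e)

  -- Only members of the fiber over the restriction of `z` have positive mass by `match-mass-0`, and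
  -- each has density at most n ^ (- ∣S∣).
  cylinder-mass : ∀ {k} (V S : Subset (suc k)) (ys : List (Asg n k)) z → (∀ i → lookup S i ≡ true → lookup V i ≡ true) →
                  mass (off S) (cylinder V ys) z * n ^ ∣ S ∣
                    ≤ length (filter (λ y → restrict (V ∩ ∁ S) y ≟A restrict (V ∩ ∁ S) (map just z)) ys) * n ^ suc k
  cylinder-mass {k} V S []       z S⊆V = ≤-reflexive (cong (_* n ^ ∣ S ∣) (trans (mass-const (off S) 0 z) (*-zeroʳ (n ^ suc k))))
  cylinder-mass {k} V S (y ∷ ys) z S⊆V
    with restrict (V ∩ ∁ S) y ≟A restrict (V ∩ ∁ S) (map just z)
  ... | yes _ = ≤-trans (≤-reflexive (trans (cong (_* n ^ ∣ S ∣) (mass-+ (off S) (λ x → match V x y) (cylinder V ys) z)) (*-distribʳ-+ (n ^ ∣ S ∣) (mass (off S) (λ x → match V x y) z) _)))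
                  (+-mono-≤ (match-mass V S y z S⊆V) (cylinder-mass V S ys z S⊆V))
  ... | no ≢ with match-mass-0 V S y z
  ...   | inj₂ eq = ⊥-elim (≢ eq)
  ...   | inj₁ e  = ≤-trans (≤-reflexive (cong (_* n ^ ∣ S ∣) (trans (mass-+ (off S) (λ x → match V x y) (cylinder V ys) z) (cong (_+ mass (off S) (cylinder V ys) z) e))))
                      (cylinder-mass V S ys z S⊆V)

  cylinder-total : ∀ {m} (V : Subset m) ys (z : Vec (Fin n) m) → All (λ y → map is-just y ≡ V) ys →
                   length ys ≤ mass (λ _ → false) (cylinder V ys) z
  cylinder-total V []       z _          = z≤n
  cylinder-total V (y ∷ ys) z (e ∷ es) =
    ≤-trans (+-mono-≤ (match-total V y z e) (cylinder-total V ys z es))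
            (≤-reflexive (sym (mass-+ (λ _ → false) (λ x → match V x y) (cylinder V ys) z)))

-- Pathsets as nodes, decompositions as trees

power-cancel : ∀ q {a b} → a ^ suc q ≤ b ^ suc q → a ≤ b
power-cancel q {a} {b} h with a ≤? b
... | yes a≤b = a≤b
... | no  a≰b = ⊥-elim (<-irrefl refl (<-≤-trans (^-monoˡ-< (suc q) (≰⇒> a≰b)) h))

m*n^p : ∀ a b p → (a * b) ^ p ≡ a ^ p * b ^ p
m*n^p a b zero    = refl
m*n^p a b (suc p) = trans (cong (a * b *_) (m*n^p a b p))
  (solve 4 (λ a b x y → a :* b :* (x :* y) := a :* x :* (b :* y)) refl a b (a ^ p) (b ^ p))
  where open +-*-Solver

module _ {n k : ℕ} (n>0 : 0 < n) where

  private
    instance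
      n≢0 : NonZero n
      n≢0 = >-nonZero n>0

  weight : ∀ {G} → Pathset n k G → Ω n (suc k) → ℕ
  weight {G} A = cylinder (verts G) (elems A)

  weight-depends : ∀ {G} (A : Pathset n k G) → DependsOn (ends (line G)) (weight A)
  weight-depends {G} A = dependsOn (λ x x′ eq →
    cylinder-depends (verts G) (elems A) x x′ (λ i Vi → eq i (trans (sym (lookup-verts G i)) Vi)))

  weight≤1 : ∀ {G} (A : Pathset n k G) x → weight A x ≤ 1
  weight≤1 {G} A x = cylinder≤1 (verts G) (elems A) x (unique A)

  weight-bound : ∀ {r G} (A : Pathset n k G) {X} → Bound n r (suc k) (weight A) 1 X 0
  weight-bound A {X} = bounded (λ z → ≤-trans (≤-reflexive (*-identityʳ _))
    (≤-trans (mass-mono X (weight≤1 A) z) (≤-reflexive (trans (mass-const X 1 z) (*-comm (n ^ suc k) 1)))))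

  SmallBounds : ℕ → Set
  SmallBounds r = ∀ {G} (A : Pathset n k G) → Small G A →
                  ∀ {X lo hi t} → Comps (line G) X lo hi t → Bound n r (suc k) (weight A) 1 X (2 * t)

  -- Any r with r ^ 2Q ≤ n ^ (Q - 1), i.e. r² ≤ n ^ (1 - 1/Q), where 1/Q approximates 1/log k from above.
  small-bounds : ∀ {r} Q → 0 < r → 2 ^ suc Q < k → r ^ (2 * suc Q) ≤ n ^ Q → SmallBounds r
  small-bounds Q r>0 2^Q<k r≤ A sm [] = weight-bound A
  small-bounds {r} Q r>0 2^Q<k r≤ {G} A sm {X} {t = suc t₀} cs@(cons {u = u₀} {w₀} _ _ c₀ _) =
    -- Smallness is applied to the union `S` of the listed components. It bounds the density with
    -- everything outside `S` fixed, which includes `X`; the induced graph on `S` has at least the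
    -- listed number of components.
    bound-restrict X≼off (bound-weaken ≤-refl (*-monoʳ-≤ 2 t≤t′) (bounded masses))
    where
      open Bounds {n} {r} {suc k} n>0 r>0
      t = suc t₀
      S : Subset (suc k)
      S = tabulate (λ i → covered cs (toℕ i))
      at : ∀ i → lookup S i ≡ covered cs (toℕ i)
      at i = lookup∘tabulate (λ i → covered cs (toℕ i)) i
      in⇒ : ∀ {i} → i ∈ S → covered cs (toℕ i) ≡ true
      in⇒ {i} i∈S = trans (sym (at i)) ([]=⇒lookup i∈S)
      ⇒in : ∀ {i} → covered cs (toℕ i) ≡ true → i ∈ S
      ⇒in {i} e = lookup⇒[]= i S (trans (at i) e)
      S⊆V : ∀ i → lookup S i ≡ true → lookup (verts G) i ≡ true
      S⊆V i e = trans (lookup-verts G i) (proj₁ (proj₂ (covered-inside cs (toℕ i) (trans (sym (at i)) e))))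
      closed : ClosedUnder G S
      closed i i∈G = (λ l∈ → ⇒in (proj₁ (proj₂ (proj₂ (covered-inside cs (toℕ i) (trans (sym (cong (covered cs) (toℕ-inject₁ i))) (in⇒ l∈))))) Gi)) ,
                     (λ r∈ → ⇒in (trans (cong (covered cs) (toℕ-inject₁ i)) (proj₂ (proj₂ (proj₂ (covered-inside cs (suc (toℕ i)) (in⇒ r∈)))) (toℕ i) refl Gi)))
        where
          Gi : line G (toℕ i) ≡ true
          Gi = trans (line-lookup G i) ([]=⇒lookup i∈G)
      I : Subset k
      I = induced G S
      atI : ∀ i → line I (toℕ i) ≡ line G (toℕ i) ∧ (covered cs (toℕ i) ∧ covered cs (suc (toℕ i)))
      atI i = trans (line-lookup I i) (trans (lookup∘tabulate (λ i → lookup G i ∧ (lookup S (inject₁ i) ∧ lookup S (suc i))) i)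
        (cong₂ _∧_ (sym (line-lookup G i)) (cong₂ _∧_ (trans (at (inject₁ i)) (cong (covered cs) (toℕ-inject₁ i))) (at (suc i)))))
      onI : ∀ v → line G v ≡ true → covered cs v ≡ true → covered cs (suc v) ≡ true → line I v ≡ true
      onI v Gv c c′ with line-true G v Gv
      ... | i , refl = trans (atI i) (cong₂ _∧_ Gv (cong₂ _∧_ c c′))
      offI : ∀ v → line G v ≡ false → line I v ≡ false
      offI v Gv with line I v in Iv
      ... | false = refl
      ... | true with line-true I v Iv
      ...   | i , refl = ⊥-elim (true≢false Iv (trans (atI i) (cong (_∧ (covered cs (toℕ i) ∧ covered cs (suc (toℕ i)))) Gv)))
      t′ = comps I
      t≤t′ : t ≤ t′
      t≤t′ = starts≤comps false I (covered-starts cs onI offI)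
      start-vertex : ∃[ i ] toℕ i ≡ u₀
      start-vertex = inject₁ (proj₁ e₀) , trans (toℕ-inject₁ (proj₁ e₀)) (proj₂ e₀)
        where e₀ = line-true G u₀ (Run.edges c₀ u₀ ≤-refl (Run.nonempty c₀))
      nonempty : Nonempty S
      nonempty = proj₁ start-vertex , ⇒in (trans (cong (covered cs) (proj₂ start-vertex)) (∨-trueˡ (between-true ≤-refl (<⇒≤ (Run.nonempty c₀)))))
      X≼off : X ≼ off S
      X≼off = incl incl′
        where
          incl′ : ∀ v → X v ≡ true → off S v ≡ true
          incl′ v Xv with line S v in Sv
          ... | false = refl
          ... | true with line-true S v Sv
          ...   | i , refl = ⊥-elim (true≢false Xv (proj₁ (covered-inside cs (toℕ i) (trans (sym (at i)) (trans (sym (line-lookup S i)) Sv)))))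
      s = ∣ S ∣
      N = n ^ suc k
      fib : Ω n (suc k) → ℕ
      fib z = fiber A S (restrict (verts G ∩ ∁ S) (map just z))
      -- Hence p / q = `t′` / (Q + 1) is an admissible exponent in `SmallBound`.
      2^<k^ : ∀ t → 1 ≤ t → 2 ^ (t * suc Q) < k ^ t
      2^<k^ t 1≤t = ≤-trans (s≤s (≤-reflexive (trans (cong (2 ^_) (*-comm t (suc Q))) (sym (^-*-assoc 2 (suc Q) t)))))
                            (^-monoˡ-< t {{>-nonZero 1≤t}} 2^Q<k)
      fib-bound : ∀ z → fib z * r ^ (2 * t′) ≤ n ^ s
      fib-bound z = power-cancel Q (*-cancelˡ-≤ (n ^ t′) {{m^n≢0 n t′}} (begin
        n ^ t′ * (fib z * r ^ (2 * t′)) ^ suc Q                ≡⟨ cong (n ^ t′ *_) (m*n^p (fib z) (r ^ (2 * t′)) (suc Q)) ⟩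
        n ^ t′ * (fib z ^ suc Q * (r ^ (2 * t′)) ^ suc Q)
          ≡⟨ cong (λ ρ → n ^ t′ * (fib z ^ suc Q * ρ)) (trans (^-*-assoc r (2 * t′) (suc Q))
                                                                       (trans (cong (r ^_) (swap t′ Q)) (sym (^-*-assoc r (2 * suc Q) t′)))) ⟩
        n ^ t′ * (fib z ^ suc Q * (r ^ (2 * suc Q)) ^ t′)      ≤⟨ *-monoʳ-≤ (n ^ t′) (*-monoʳ-≤ (fib z ^ suc Q) (^-monoˡ-≤ t′ r≤)) ⟩
        n ^ t′ * (fib z ^ suc Q * (n ^ Q) ^ t′)
          ≡⟨ solve 3 (λ a b c → a :* (b :* c) := b :* (a :* c)) refl (n ^ t′) (fib z ^ suc Q) ((n ^ Q) ^ t′) ⟩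
        fib z ^ suc Q * (n ^ t′ * (n ^ Q) ^ t′)
          ≡⟨ cong (fib z ^ suc Q *_) (trans (sym (m*n^p n (n ^ Q) t′)) (trans (^-*-assoc n (suc Q) t′) (cong (n ^_) (*-comm (suc Q) t′)))) ⟩
        fib z ^ suc Q * n ^ (t′ * suc Q)
          ≤⟨ sm S (λ {i} i∈S → lookup⇒[]= i (verts G) (S⊆V i ([]=⇒lookup i∈S))) closed nonempty _
                t′ (suc Q) (s≤s z≤n) (2^<k^ t′ (≤-trans (s≤s z≤n) t≤t′)) ⟩
        n ^ (t′ + s * suc Q)                                   ≡⟨ trans (^-distribˡ-+-* n t′ (s * suc Q)) (cong (n ^ t′ *_) (sym (^-*-assoc n s (suc Q)))) ⟩
        n ^ t′ * (n ^ s) ^ suc Q ∎))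
        where
          open ≤-Reasoning
          open +-*-Solver
          swap : ∀ t q → 2 * t * suc q ≡ 2 * suc q * t
          swap = solve 2 (λ t q → con 2 :* t :* (con 1 :+ q) := con 2 :* (con 1 :+ q) :* t) refl
      masses : ∀ z → mass (off S) (weight A) z * r ^ (2 * t′) ≤ 1 * N
      masses z = *-cancelˡ-≤ (n ^ s) {{m^n≢0 n s}} (begin
        n ^ s * (μ * r ^ (2 * t′))      ≡⟨ solve 3 (λ a b c → a :* (b :* c) := b :* a :* c) refl (n ^ s) μ (r ^ (2 * t′)) ⟩
        μ * n ^ s * r ^ (2 * t′)        ≤⟨ *-monoˡ-≤ (r ^ (2 * t′)) (cylinder-mass (verts G) S (elems A) z S⊆V) ⟩
        fib z * N * r ^ (2 * t′)        ≡⟨ solve 3 (λ a b c → a :* b :* c := a :* c :* b) refl (fib z) N (r ^ (2 * t′)) ⟩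
        fib z * r ^ (2 * t′) * N        ≤⟨ *-monoˡ-≤ N (fib-bound z) ⟩
        n ^ s * N                       ≡⟨ cong (n ^ s *_) (sym (*-identityˡ N)) ⟩
        n ^ s * (1 * N) ∎)
        where
          open ≤-Reasoning
          open +-*-Solver
          μ = mass (off S) (weight A) z

  -- For r = 1 smallness asks for density at most 1; this choice turns decompositions for short
  -- paths into trees.
  small-bounds-1 : SmallBounds 1
  small-bounds-1 A sm {t = t} _ = bounded (λ z → ≤-trans (≤-reflexive (cong (mass _ (weight A) z *_) (^-zeroˡ (2 * t)))) (Bound.bound (weight-bound {1} A) z))

  -- Fixing everything but the vertices of the edge leaves at most `card A` of the at least n ^ 2
  -- possible values.
  edge-bound : ∀ {G} (A : Pathset n k G) {c e} → line G e ≡ true → card A ≤ c →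
               (∀ i → line G i ≡ true → i ≡ e) →
               ∀ {X} → X e ≡ false → X (suc e) ≡ false → ∀ z → mass X (weight A) z * n ^ 2 ≤ c * n ^ suc k
  edge-bound {G} A {c} {e} Ge card≤c only {X} Xe Xe′ = Bound.bound
    (bound-restrict X≼off (bound-weaken card≤c
      (card>1 V e (vertex e (∨-trueʳ {before (line G) e} Ge) (≤-trans (n≤1+n _) e<k)) (vertex (suc e) (∨-trueˡ Ge) e<k)) (bounded masses)))
    where
      open Bounds {n} {n} {suc k} n>0 n>0
      V = verts G
      e<k : suc e < suc k
      e<k = s≤s (subst (_< k) (proj₂ (line-true G e Ge)) (toℕ<n (proj₁ (line-true G e Ge))))
      vertex : ∀ v → ends (line G) v ≡ true → v < suc k → line V v ≡ true
      vertex v ev v<k = subst (λ v → line V v ≡ true) (toℕ-fromℕ< v<k)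
        (trans (line-lookup V (fromℕ< v<k)) (trans (lookup-verts G (fromℕ< v<k)) (trans (cong (ends (line G)) (toℕ-fromℕ< v<k)) ev)))
      X≼off : X ≼ off V
      X≼off = incl incl′
        where
          no-edge : ∀ v → X v ≡ true → ends (line G) v ≡ true → ⊥
          no-edge v Xv ev with before (line G) v in Bv
          ... | false with only v ev
          ...   | refl = true≢false Xv Xe
          no-edge (suc v) Xv ev | true with only v Bv
          ...   | refl = true≢false Xv Xe′
          incl′ : ∀ v → X v ≡ true → off V v ≡ true
          incl′ v Xv with line V v in Vv
          ... | false = refl
          ... | true  = ⊥-elim (no-edge v Xv (line-verts G v Vv))
      masses : ∀ z → mass (off V) (weight A) z * n ^ ∣ V ∣ ≤ card A * n ^ suc k
      masses z = ≤-trans (cylinder-mass V V (elems A) z (λ i e → e)) (*-monoˡ-≤ (n ^ suc k) (length-filter _ (elems A)))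

  module _ {r : ℕ} (bounds : SmallBounds r) where

    asNode : ∀ {G} (A : Pathset n k G) → Small G A → ℕ → Node n r (suc k)
    asNode {G} A sm c = record { graph = line G ; weight = weight A ; cost = c ; depends = weight-depends A ; small = bounds A sm }

    pieces-weight : ∀ {G} → List (Piece n k G) → Ω n (suc k) → ℕ
    pieces-weight []       x = 0
    pieces-weight (p ∷ ps) x = weight (Piece.B p) x * weight (Piece.C p) x + pieces-weight ps x

    -- An edge of `G` outside `K` must lie in `H`. So no child is empty, and the empty pattern of
    -- cost 0 never enters a tree.
    nonempty-child : ∀ {G H K : Subset k} → K ⊂ G → H ∪ K ≡ G → 1 ≤ ∣ H ∣
    nonempty-child {G} {H} {K} (_ , i , i∈G , i∉K) H∪K≡G with x∈p∪q⁻ H K (subst (i ∈_) (sym H∪K≡G) i∈G)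
    ... | inj₁ i∈H = card>0 H (toℕ i) (trans (line-lookup H i) ([]=⇒lookup i∈H))
    ... | inj₂ i∈K = ⊥-elim (i∉K i∈K)

    Decomposes : ∀ {G} → Asg n k → Piece n k G → Set
    Decomposes x p = (restrict (verts (Piece.H p)) x ∈ₗ elems (Piece.B p)) × (restrict (verts (Piece.K p)) x ∈ₗ elems (Piece.C p))

    covered-weight : ∀ {G} (A : Pathset n k G) (ps : List (Piece n k G)) →
      All (λ x → Any (Decomposes x) ps) (elems A) →
      ∀ x → weight A x ≤ pieces-weight ps x
    covered-weight {G} A ps cov x with cylinder-sound (verts G) (elems A) x
    ... | inj₁ e  = ≤-trans (≤-reflexive e) z≤n
    ... | inj₂ y∈ = ≤-trans (weight≤1 A x) (found ps (lookupAll cov y∈))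
      where
        y = map just x ↾ verts G
        inner : ∀ {H} → H ⊆ G → restrict (verts H) y ≡ map just x ↾ verts H
        inner {H} H⊆G = ↾-↾ (verts H) (verts G) (map just x) (λ i e →
          trans (lookup-verts G i) (include (ends-mono (⊆⇒≼ H⊆G)) (toℕ i) (trans (sym (lookup-verts H i)) e)))
        found : ∀ ps → Any (Decomposes y) ps → 1 ≤ pieces-weight ps x
        found (p ∷ ps) (here (b∈ , c∈)) = ≤-trans
          (*-mono-≤ (cylinder-complete (verts H) (elems B) x (subst (_∈ₗ elems B) (inner (proj₁ H⊂G)) b∈))
                    (cylinder-complete (verts K) (elems C) x (subst (_∈ₗ elems C) (inner (proj₁ K⊂G)) c∈)))
          (m≤m+n _ _)
          where open Piece p
        found (p ∷ ps) (there any) = ≤-trans (found ps any) (m≤n+m _ _)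

    -- The number `s` bounds the edges and decreases because both children are proper subgraphs; it
    -- makes the recursion through the list of pieces structural.
    toTree : ∀ s {G} (A : Pathset n k G) c → ∣ G ∣ ≤ s → 1 ≤ ∣ G ∣ → ChiLe n k G A c → Tree n r (suc k) (line G) (weight A) c

    toForest : ∀ s {G} → ∣ G ∣ ≤ suc s → (ps : List (Piece n k G)) →
               Forest n r (suc k) (line G) (pieces-weight ps) (LA.sum (L.map (λ p → Piece.costB p + Piece.costC p) ps))

    toTree s A c G≤ G≥ (chi-empty ∣G∣≡0) = ⊥-elim (<-irrefl refl (≤-trans G≥ (≤-reflexive ∣G∣≡0)))
    toTree s {G} A c G≤ G≥ (chi-one ∣G∣≡1 card≤c) with card≡1 G ∣G∣≡1
    ... | e , Ge , only = leaf e only (edge-bound A Ge card≤c only)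
    toTree (suc s) A c G≤ G≥ (chi-split 2≤ ps sum≤c cov) = node (covered-weight A ps cov) sum≤c (toForest s G≤ ps)
    toTree zero A c G≤ G≥ (chi-split 2≤ ps sum≤c cov) = ⊥-elim (<-irrefl refl (≤-trans G≥ G≤))

    toForest s G≤ []       = []
    toForest s {G} G≤ (p ∷ ps) =
      join (asNode B Bsm costB) (asNode C Csm costC)
        (covers (λ i → trans (cong (λ G → line G i) (sym H∪K)) (line-∪ H K i)))
        (toTree s B costB (s≤s⁻¹ (≤-trans (p⊂q⇒∣p∣<∣q∣ H⊂G) G≤)) (nonempty-child K⊂G H∪K) chiB)
        (toTree s C costC (s≤s⁻¹ (≤-trans (p⊂q⇒∣p∣<∣q∣ K⊂G) G≤)) (nonempty-child H⊂G (trans (∪-comm K H) H∪K)) chiC)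
        (toForest s G≤ ps)
      where open Piece p

-- Logarithms and roots

m<2^m : ∀ m → m < 2 ^ m
m<2^m zero    = s≤s z≤n
m<2^m (suc m) = ≤-trans (+-mono-≤ (m^n>0 2 m) (m<2^m m)) (≤-reflexive (cong (2 ^ m +_) (sym (+-identityʳ (2 ^ m)))))

2^-cancel-< : ∀ {a b} → 2 ^ a < 2 ^ b → a < b
2^-cancel-< {a} {b} h with a <? b
... | yes a<b = a<b
... | no  a≮b = ⊥-elim (<-irrefl refl (<-≤-trans h (^-monoʳ-≤ 2 (≮⇒≥ a≮b))))

log₂-bracket : ∀ k → ∃[ q ] 2 ^ q < 2 + k × 2 + k ≤ 2 ^ suc q
log₂-bracket zero = 0 , ≤-refl , ≤-refl
log₂-bracket (suc k) with log₂-bracket k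
... | q , l , h with m≤n⇒m<n∨m≡n h
...   | inj₁ h′ = q , <-trans l ≤-refl , h′
...   | inj₂ eq = suc q , s≤s (≤-reflexive (sym eq)) ,
                  ≤-trans (≤-reflexive (cong suc eq)) (≤-trans (+-monoˡ-≤ (2 ^ suc q) (m^n>0 2 (suc q)))
                    (≤-reflexive (cong (2 ^ suc q +_) (sym (+-identityʳ _)))))

-- An integer root up to a factor 2: as `N` grows, `r` is kept until (2 r) ^ (1 + e) falls behind,
-- and then 2 r takes its place.
root : ∀ e N → ∃[ r ] 0 < r × r ^ suc e ≤ suc N × suc N ≤ (2 * r) ^ suc e
root e zero = 1 , ≤-refl , ≤-reflexive (^-zeroˡ (suc e)) , m^n>0 2 (suc e)
root e (suc N) with root e N
... | r , r>0 , l , h with suc (suc N) ≤? (2 * r) ^ suc e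
...   | yes h′ = r , r>0 , ≤-trans l (n≤1+n _) , h′
...   | no ¬h  = 2 * r , 2r>0 , <⇒≤ (≰⇒> ¬h) , ≤-trans (s≤s h) (^-monoˡ-< (suc e) (m<m+n (2 * r) (≤-trans 2r>0 (m≤m+n _ 0))))
  where
    2r>0 : 0 < 2 * r
    2r>0 = ≤-trans r>0 (m≤m+n r _)

root-≥1 : ∀ e N → 0 < N → ∃[ r ] 0 < r × r ^ suc e ≤ N × N ≤ (2 * r) ^ suc e
root-≥1 e (suc N) _ = root e N

line-⊤ : ∀ k i → i < k → line (⊤ {k}) i ≡ true
line-⊤ (suc k) zero    _ = refl
line-⊤ (suc k) (suc i) h = line-⊤ k i (s≤s⁻¹ h)

line-⊤-end : ∀ k → line (⊤ {k}) k ≡ false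
line-⊤-end zero    = refl
line-⊤-end (suc k) = line-⊤-end k

-- From density bounds to the final exponent

module Trivial {n r m : ℕ} (n>0 : 0 < n) where

  open Bounds {n} {n} {m} n>0 n>0
  open Node

  as-trivial : ∀ {P X} → Bound n r m P 1 X 0 → Bound n n m P 1 X 0
  as-trivial (bounded h) = bounded h

  -- Following first factors down to a leaf gives c / n ^ 2, as every second factor has density at
  -- most 1. This settles k ≤ 4, where (1/6) log k is at most 1/3.
  trivialTree : ∀ {G P c} → Tree n r m G P c → Bound n n m P c (λ _ → false) 2

  trivialForest : ∀ {G P c} → Forest n r m G P c → Bound n n m P c (λ _ → false) 2

  trivialTree (leaf e _ cost≤) = bounded (cost≤ refl refl)
  trivialTree (node P≤ c≤ F)   = bound-mono P≤ (bound-weaken c≤ ≤-refl (trivialForest F))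

  trivialForest []                    = bound-0
  trivialForest (join B C _ tB tC F) = bound-+
    (bound-weaken (≤-trans (≤-reflexive (*-identityʳ (cost B))) (m≤m+n (cost B) (cost C))) ≤-refl
      (bound-product {Y = ends (graph B)} (incl (λ v ())) (depends B) (trivialTree tB) (as-trivial (small C {lo = 0} {hi = 0} []))))
    (trivialForest F)

module _ {n k : ℕ} (n>0 : 0 < n) (2≤k : 2 ≤ k) (A : Pathset n k ⊤) {c : ℕ} (χ : ChiLe n k ⊤ A c) where

  private
    instance
      n≢0 : NonZero n
      n≢0 = >-nonZero n>0

    N = n ^ suc k

    z₀ : Vec (Fin n) (suc k)
    z₀ = replicate (suc k) (fromℕ< n>0)

    tree : ∀ {r} → SmallBounds {n} {k} n>0 r → Tree n r (suc k) (line (⊤ {k})) (weight n>0 A) c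
    tree bounds = toTree n>0 bounds k A c (≤-reflexive (∣⊤∣≡n k)) (≤-trans (≤-trans (n≤1+n 1) 2≤k) (≤-reflexive (sym (∣⊤∣≡n k)))) χ

    card≤mass : card A ≤ mass (λ _ → false) (weight n>0 A) z₀
    card≤mass = cylinder-total (verts ⊤) (elems A) z₀ (domOK A)

  card-bound-trivial : card A * n ^ 2 ≤ c * N
  card-bound-trivial = ≤-trans (*-monoˡ-≤ (n ^ 2) card≤mass)
    (Bound.bound (Trivial.trivialTree n>0 (tree (small-bounds-1 n>0))) z₀)

  -- With nothing fixed, the path itself is a free run of length k, and level `2 + L` requires 8 ^
  -- L.
  card-bound : ∀ {r} Q L → 0 < r → r ^ (2 * suc Q) ≤ n ^ Q → 2 ^ suc Q < k → 8 ^ L ≤ k → card A * r ^ (2 + L) ≤ c * N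
  card-bound {r} Q L r>0 r≤ 2^Q<k 8^L≤k = ≤-trans (*-monoˡ-≤ (r ^ (2 + L)) card≤mass)
    (Bound.bound (Top.claim n>0 r>0 r²≤n (2 + L) (tree (small-bounds n>0 Q r>0 2^Q<k r≤)) path
      (≤-trans (≤-reflexive (*-identityˡ (8 ^ L))) 8^L≤k) [] ([] {hi = 0})) z₀)
    where
      r²≤n : r * r ≤ n
      r²≤n = power-cancel Q (≤-trans (≤-reflexive (trans (cong (λ t → (r * t) ^ suc Q) (sym (*-identityʳ r))) (^-*-assoc r 2 (suc Q))))
               (≤-trans r≤ (^-monoʳ-≤ n (n≤1+n Q))))
      path : Run (line (⊤ {k})) (λ _ → false) 0 k 1 1
      path = run (≤-trans (s≤s z≤n) 2≤k) (λ i _ h → line-⊤ k i h) (λ _ _ _ → refl) (free refl refl) (free refl (line-⊤-end k))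

  module Finish (p q : ℕ) (q>0 : 0 < q) (2^6p<k^q : 2 ^ (6 * p) < k ^ q) where

    D = 2 ^ (1 * 2 ^ k)

    6p<bq : ∀ b → k ≤ 2 ^ b → 6 * p < b * q
    6p<bq b k≤2^b = 2^-cancel-< (<-≤-trans 2^6p<k^q (≤-trans (^-monoˡ-≤ q k≤2^b) (≤-reflexive (^-*-assoc 2 b q))))

    raise : ∀ {R} → n ^ p ≤ (D * R) ^ q → card A * R ≤ c * N → n ^ p * card A ^ q ≤ (c * D * N) ^ q
    raise {R} n^p≤ card≤ = begin
      n ^ p * card A ^ q          ≤⟨ *-monoˡ-≤ (card A ^ q) n^p≤ ⟩
      (D * R) ^ q * card A ^ q    ≡⟨ sym (m*n^p (D * R) (card A) q) ⟩
      (D * R * card A) ^ q        ≡⟨ cong (_^ q) (solve 3 (λ D R a → D :* R :* a := D :* (a :* R)) refl D R (card A)) ⟩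
      (D * (card A * R)) ^ q      ≤⟨ ^-monoˡ-≤ q (*-monoʳ-≤ D card≤) ⟩
      (D * (c * N)) ^ q           ≡⟨ cong (_^ q) (solve 3 (λ D c N → D :* (c :* N) := c :* D :* N) refl D c N) ⟩
      (c * D * N) ^ q ∎
      where
        open ≤-Reasoning
        open +-*-Solver

    finish-small : k ≤ 4 → n ^ p * card A ^ q ≤ (c * D * N) ^ q
    finish-small k≤4 = raise {n ^ 2}
      (≤-trans (^-monoʳ-≤ n p≤2q) (≤-trans (≤-reflexive (sym (^-*-assoc n 2 q))) (^-monoˡ-≤ q (m≤n*m (n ^ 2) D {{m^n≢0 2 (1 * 2 ^ k)}})))) card-bound-trivial
      where
        p≤2q : p ≤ 2 * q
        p≤2q = ≤-trans (m≤n*m p 6) (<⇒≤ (6p<bq 2 k≤4))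

    finish-large : ∀ x → 2 ^ (2 + x) < k → k ≤ 2 ^ (3 + x) → n ^ p * card A ^ q ≤ (c * D * N) ^ q
    finish-large x l h with root-≥1 (suc (2 * suc x)) (n ^ suc x) (m^n>0 n (suc x))
    ... | r , r>0 , r≤ , n≤ = raise {r ^ I} n^p≤ (card-bound (suc x) L r>0 (subst (λ e → r ^ e ≤ n ^ suc x) 2Q≡ r≤) l 8^L≤k)
      where
        open +-*-Solver
        -- The largest integer below log k. The root `r` satisfies r ^ (2 Q) ≤ n ^ (Q - 1), as
        -- smallness demands.
        Q = 2 + x
        L = Q / 3
        I = 2 + L
        2Q≡ : 2 + 2 * suc x ≡ 2 * Q
        2Q≡ = solve 1 (λ x → con 2 :+ con 2 :* (con 1 :+ x) := con 2 :* (con 2 :+ x)) refl x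
        8^L≤k : 8 ^ L ≤ k
        8^L≤k = ≤-trans (≤-reflexive (^-*-assoc 2 3 L)) (≤-trans (^-monoʳ-≤ 2 3L≤Q) (<⇒≤ l))
          where
            3L≤Q : 3 * L ≤ Q
            3L≤Q = ≤-trans (m≤n+m (3 * L) (Q % 3)) (≤-reflexive (trans (cong (Q % 3 +_) (*-comm 3 L)) (sym (m≡m%n+[m/n]*n Q 3))))
        Q+4≤3I : 4 + Q ≤ 3 * I
        Q+4≤3I = begin
          4 + Q                 ≡⟨ cong (4 +_) (m≡m%n+[m/n]*n Q 3) ⟩
          4 + (Q % 3 + L * 3)   ≤⟨ +-monoʳ-≤ 4 (+-monoˡ-≤ (L * 3) (s≤s⁻¹ (m%n<n Q 3))) ⟩
          4 + (2 + L * 3)       ≡⟨ solve 1 (λ L → con 4 :+ (con 2 :+ L :* con 3) := con 3 :* (con 2 :+ L)) refl L ⟩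
          3 * I ∎
          where open ≤-Reasoning
        -- The base exponent 2 in `I` pays for all rounding: log k is at most Q + 1, 3 I is at least
        -- Q + 4, and Q (Q + 1) ≤ (Q - 1) (Q + 4) for Q ≥ 2.
        exponents : p * (2 * Q) ≤ suc x * (I * q)
        exponents = *-cancelˡ-≤ 6 (begin
          6 * (p * (2 * Q))              ≡⟨ solve 2 (λ p Q → con 6 :* (p :* (con 2 :* Q)) := con 6 :* p :* (con 2 :* Q)) refl p Q ⟩
          6 * p * (2 * Q)                ≤⟨ *-monoˡ-≤ (2 * Q) (<⇒≤ (6p<bq (3 + x) h)) ⟩
          (3 + x) * q * (2 * Q)          ≡⟨ solve 2 (λ x q → (con 3 :+ x) :* q :* (con 2 :* (con 2 :+ x)) := con 2 :* q :* (x :* x :+ con 5 :* x :+ con 6)) refl x q ⟩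
          2 * q * (x * x + 5 * x + 6)    ≤⟨ *-monoʳ-≤ (2 * q) (+-monoˡ-≤ 6 (+-monoʳ-≤ (x * x) (*-monoˡ-≤ x {5} {7} (≤ᵇ⇒≤ 5 7 tt)))) ⟩
          2 * q * (x * x + 7 * x + 6)    ≡⟨ solve 2 (λ x q → con 2 :* q :* (x :* x :+ con 7 :* x :+ con 6) := con 2 :* q :* ((con 1 :+ x) :* (con 6 :+ x))) refl x q ⟩
          2 * q * (suc x * (4 + Q))      ≤⟨ *-monoʳ-≤ (2 * q) (*-monoʳ-≤ (suc x) Q+4≤3I) ⟩
          2 * q * (suc x * (3 * I))      ≡⟨ solve 3 (λ x q I → con 2 :* q :* ((con 1 :+ x) :* (con 3 :* I)) := con 6 :* ((con 1 :+ x) :* (I :* q))) refl x q I ⟩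
          6 * (suc x * (I * q)) ∎)
          where open ≤-Reasoning
        -- The integer root loses a factor 2 in each of the `I` powers of r; the denominator of the
        -- theorem absorbs it.
        2^I≤D : 2 ^ I ≤ D
        2^I≤D = ^-monoʳ-≤ 2 (begin
          2 + Q / 3       ≤⟨ +-monoʳ-≤ 2 (m/n≤m Q 3) ⟩
          2 + Q           ≤⟨ s≤s (m<2^m Q) ⟩
          suc (2 ^ Q)     ≤⟨ l ⟩
          k               ≤⟨ <⇒≤ (m<2^m k) ⟩
          2 ^ k           ≡⟨ sym (*-identityˡ (2 ^ k)) ⟩
          1 * 2 ^ k ∎)
          where open ≤-Reasoning
        n^p≤ : n ^ p ≤ (D * r ^ I) ^ q
        n^p≤ = power-cancel (suc (2 * suc x)) (begin
          (n ^ p) ^ (2 + 2 * suc x)             ≡⟨ cong ((n ^ p) ^_) 2Q≡ ⟩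
          (n ^ p) ^ (2 * Q)                     ≡⟨ ^-*-assoc n p (2 * Q) ⟩
          n ^ (p * (2 * Q))                     ≤⟨ ^-monoʳ-≤ n exponents ⟩
          n ^ (suc x * (I * q))                 ≡⟨ sym (^-*-assoc n (suc x) (I * q)) ⟩
          (n ^ suc x) ^ (I * q)                 ≤⟨ ^-monoˡ-≤ (I * q) n≤ ⟩
          ((2 * r) ^ (2 + 2 * suc x)) ^ (I * q)
            ≡⟨ trans (^-*-assoc (2 * r) (2 + 2 * suc x) (I * q))
                     (trans (cong ((2 * r) ^_) (*-comm (2 + 2 * suc x) (I * q))) (sym (^-*-assoc (2 * r) (I * q) (2 + 2 * suc x)))) ⟩
          ((2 * r) ^ (I * q)) ^ (2 + 2 * suc x) ≤⟨ ^-monoˡ-≤ (2 + 2 * suc x) inner ⟩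
          ((D * r ^ I) ^ q) ^ (2 + 2 * suc x) ∎)
          where
            open ≤-Reasoning
            inner : (2 * r) ^ (I * q) ≤ (D * r ^ I) ^ q
            inner = ≤-trans (≤-reflexive (trans (sym (^-*-assoc (2 * r) I q)) (cong (_^ q) (m*n^p 2 r I)))) (^-monoˡ-≤ q (*-monoˡ-≤ (r ^ I) 2^I≤D))

theorem5p8 : Σ ℕ (λ C → 0 < C × ((n k : ℕ) → 1 ≤ n → 2 ≤ k →
    (A : Pathset n k ⊤) → (c : ℕ) → ChiLe n k ⊤ A c →
    (p q : ℕ) → 0 < q → 2 ^ (6 * p) < k ^ q →
    n ^ p * card A ^ q ≤ (c * 2 ^ (C * 2 ^ k) * n ^ (suc k)) ^ q))
theorem5p8 = 1 , ≤-refl , inequality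
  where
    inequality : ∀ n k → 1 ≤ n → 2 ≤ k → (A : Pathset n k ⊤) → ∀ c → ChiLe n k ⊤ A c → ∀ p q → 0 < q → 2 ^ (6 * p) < k ^ q →
            n ^ p * card A ^ q ≤ (c * 2 ^ (1 * 2 ^ k) * n ^ suc k) ^ q
    inequality n (suc (suc k)) 1≤n 2≤k A c χ p q q>0 h with log₂-bracket k
    ... | zero        , l , u = Finish.finish-small 1≤n 2≤k A χ p q q>0 h (≤-trans u (s≤s (s≤s z≤n)))
    ... | suc zero    , l , u = Finish.finish-small 1≤n 2≤k A χ p q q>0 h u
    ... | suc (suc x) , l , u = Finish.finish-large 1≤n 2≤k A χ p q q>0 h x l u
    inequality n (suc zero) _ (s≤s ())
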